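{- Let $L$ be any fixed graph with at least one edge, and let $k=k(n)$. If $k=o(n^{v(L)})$, then $$\lim_{n\to\infty}\frac{\log M_{L}(n,k)}{\binom{n}{2}}=\frac{1}{\chi(L)-1}.$$ If $k=cn^{v(L)}$ for some constant $c>0$, then $$\lim_{n\to\infty}\frac{\log M_{L}(n,k)}{\binom{n}{2}}\leq \frac{1}{\chi(L)-1}-\frac{2c}{e(L)}.$$
   Context: Logarithms are base 2. $v(L)$, $e(L)$, $\chi(L)$ denote the number of vertices, number of edges and chromatic number of $L$. For graphs $G,G'$ on the same vertex set $[n]$, their symmetric difference $G\oplus G'$ is the graph on $[n]$ whose edge set consists of all edges belonging to exactly one of $G,G'$. $M_{L}(n,k)$ denotes the largest cardinality of a family $\mathcal{G}$ of graphs on vertex set $[n]$ such that for any two distinct members $G,G'\in\mathcal{G}$, the graph $G\oplus G'$ contains at least $k$ copies of $L$ (subgraphs isomorphic to $L$).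
   Formalization: Assumes k(n)>0 in the first part (false for k=0, χ(L)≥3) and 1/(χ(L)-1) - 2c/e(L) ≥ 0 in the second (otherwise the bound is false, since M_L ≥ 1); the second "lim ≤" is read as limsup ≤. -}

module Defs where

open import Data.Bool using (Bool; false; T; T?; _xor_)
open import Data.Fin as Fin using (Fin)
import Data.Fin.Properties as Fin
open import Data.Fin.Subset using (Subset; _∈_)
open import Data.Integer as ℤ using (ℤ; +_; -[1+_])
import Data.Integer.Properties as ℤ
open import Data.List using (length; filter; allFin; cartesianProduct)
open import Data.Nat as ℕ using (ℕ; zero; suc; z≤n; s≤s)
open import Data.Nat.Combinatorics using (_C_)
import Data.Nat.Coprimality as Coprime
import Data.Nat.Properties as ℕ
open import Data.Product using (Σ; ∃; ∃-syntax; _×_; _,_)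
open import Data.Rational as ℚ
  using (ℚ; 0ℚ; 1ℚ; ↥_; ↧ₙ_; mkℚ; Positive)
import Data.Rational.Properties as ℚ
open import Data.Sum using (_⊎_; inj₁; inj₂; swap)
open import Function.Bundles using (_⇔_; mk⇔; module Equivalence)
open import Function.Definitions using (Injective)
open import Relation.Binary.PropositionalEquality
  using (_≡_; _≢_; refl; sym; trans; cong; cong₂; subst; subst₂; module ≡-Reasoning)
open import Relation.Nullary using (¬_; yes; no)
open import Relation.Nullary.Decidable using (_×-dec_)

------------------------------------------------------------------------
-- Real numbers, as located two-sided Dedekind cuts

record ℝ : Set₁ where
  field
    -- lower q means q < x, and upper q means x < q
    lower upper     : ℚ → Set
    lower-inhabited : ∃ lower
    upper-inhabited : ∃ upper
    lower-rounded   : ∀ q → lower q ⇔ (∃[ r ] q ℚ.< r × lower r)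
    upper-rounded   : ∀ q → upper q ⇔ (∃[ r ] r ℚ.< q × upper r)
    disjoint        : ∀ q → ¬ (lower q × upper q)
    located         : ∀ {q r} → q ℚ.< r → lower q ⊎ upper r

open ℝ public

infix 4 _≤_ _<_ _≃_

_≤_ _<_ _≃_ : ℝ → ℝ → Set
x ≤ y = ∀ q → lower x q → lower y q
x < y = ∃[ q ] upper x q × lower y q
x ≃ y = x ≤ y × y ≤ x

private
  q-1<q : ∀ q → q ℚ.- 1ℚ ℚ.< q
  q-1<q q = subst (q ℚ.- 1ℚ ℚ.<_) (ℚ.+-identityʳ q)
              (ℚ.+-monoʳ-< q (ℚ.negative⁻¹ (ℚ.- 1ℚ)))

  q<q+1 : ∀ q → q ℚ.< q ℚ.+ 1ℚ
  q<q+1 q = subst (ℚ._< q ℚ.+ 1ℚ) (ℚ.+-identityʳ q)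
              (ℚ.+-monoʳ-< q (ℚ.positive⁻¹ 1ℚ))

fromℚ : ℚ → ℝ
fromℚ p = record
  { lower = ℚ._< p
  ; upper = p ℚ.<_
  ; lower-inhabited = p ℚ.- 1ℚ , q-1<q p
  ; upper-inhabited = p ℚ.+ 1ℚ , q<q+1 p
  ; lower-rounded = λ q → mk⇔
      (λ q<p → let r , q<r , r<p = ℚ.<-dense q<p in r , q<r , r<p)
      (λ (_ , q<r , r<p) → ℚ.<-trans q<r r<p)
  ; upper-rounded = λ q → mk⇔
      (λ p<q → let r , p<r , r<q = ℚ.<-dense p<q in r , r<q , p<r)
      (λ (_ , r<q , p<r) → ℚ.<-trans p<r r<q)
  ; disjoint = λ _ (q<p , p<q) → ℚ.<-asym q<p p<q
  ; located = loc
  }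
  where
  loc : ∀ {q r} → q ℚ.< r → q ℚ.< p ⊎ p ℚ.< r
  loc {q} q<r with q ℚ.<? p
  ... | yes q<p = inj₁ q<p
  ... | no  q≮p = inj₂ (ℚ.≤-<-trans (ℚ.≮⇒≥ q≮p) q<r)

ℕ→ℚ : ℕ → ℚ
ℕ→ℚ n = + n ℚ./ 1

fromℕ : ℕ → ℝ
fromℕ n = fromℚ (ℕ→ℚ n)

0ℝ : ℝ
0ℝ = fromℚ 0ℚ

-- x / t for a positive rational t
private
  divide : (t : ℚ) .{{_ : Positive t}} → ℝ → ℝ
  divide t x = record
    { lower = λ q → lower x (q ℚ.* t)
    ; upper = λ q → upper x (q ℚ.* t)
    ; lower-inhabited = let q , l = lower-inhabited x in
        q ℚ.* s , subst (lower x) (sym (cancel q)) l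
    ; upper-inhabited = let q , u = upper-inhabited x in
        q ℚ.* s , subst (upper x) (sym (cancel q)) u
    ; lower-rounded = λ q → mk⇔
        (λ l → let r , qt<r , lr = Equivalence.to (lower-rounded x _) l in
           r ℚ.* s , reflect (subst (q ℚ.* t ℚ.<_) (sym (cancel r)) qt<r)
                   , subst (lower x) (sym (cancel r)) lr)
        (λ (r , q<r , lr) → Equivalence.from (lower-rounded x _)
           (r ℚ.* t , ℚ.*-monoˡ-<-pos t q<r , lr))
    ; upper-rounded = λ q → mk⇔
        (λ u → let r , r<qt , ur = Equivalence.to (upper-rounded x _) u in
           r ℚ.* s , reflect (subst (ℚ._< q ℚ.* t) (sym (cancel r)) r<qt)
                   , subst (upper x) (sym (cancel r)) ur)
        (λ (r , r<q , ur) → Equivalence.from (upper-rounded x _)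
           (r ℚ.* t , ℚ.*-monoˡ-<-pos t r<q , ur))
    ; disjoint = λ q → disjoint x (q ℚ.* t)
    ; located = λ q<r → located x (ℚ.*-monoˡ-<-pos t q<r)
    }
    where
    instance
      t≢0 : ℚ.NonZero t
      t≢0 = ℚ.pos⇒nonZero t
    s : ℚ
    s = ℚ.1/ t
    cancel : ∀ q → (q ℚ.* s) ℚ.* t ≡ q
    cancel q = trans (ℚ.*-assoc q s t)
      (trans (cong (q ℚ.*_) (ℚ.*-inverseˡ t)) (ℚ.*-identityʳ q))
    reflect : ∀ {p q} → p ℚ.* t ℚ.< q ℚ.* t → p ℚ.< q
    reflect = ℚ.*-cancelʳ-<-nonNeg t {{ℚ.pos⇒nonNeg t}}

infixl 7 _·_ _/_

_·_ : ℕ → ℝ → ℝ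
zero  · x = 0ℝ
suc n · x = divide (+ 1 ℚ./ suc n) {{ℚ.normalize-pos 1 (suc n)}} x

-- Total division by a natural number, with x / 0 = 0.
_/_ : ℝ → ℕ → ℝ
x / zero  = 0ℝ
x / suc n = divide (+ suc n ℚ./ 1) {{ℚ.normalize-pos (suc n) 1}} x

-- The rational 1 / n, with 1 / 0 = 0.
recip : ℕ → ℚ
recip zero    = 0ℚ
recip (suc n) = + 1 ℚ./ suc n

infixl 6 _⊖_

-- p ⊖ x is the difference of a rational p and a real x.
_⊖_ : ℚ → ℝ → ℝ
p ⊖ x = record
  { lower = λ q → upper x (p ℚ.- q)
  ; upper = λ q → lower x (p ℚ.- q)
  ; lower-inhabited = let q , u = upper-inhabited x in
      p ℚ.- q , subst (upper x) (sym (twice q)) u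
  ; upper-inhabited = let q , l = lower-inhabited x in
      p ℚ.- q , subst (lower x) (sym (twice q)) l
  ; lower-rounded = λ q → mk⇔
      (λ u → let r , r<p-q , ur = Equivalence.to (upper-rounded x _) u in
         p ℚ.- r , subst (ℚ._< p ℚ.- r) (twice q) (anti r<p-q)
                 , subst (upper x) (sym (twice r)) ur)
      (λ (r , q<r , ur) → Equivalence.from (upper-rounded x _)
         (p ℚ.- r , anti q<r , ur))
  ; upper-rounded = λ q → mk⇔
      (λ l → let r , p-q<r , lr = Equivalence.to (lower-rounded x _) l in
         p ℚ.- r , subst (p ℚ.- r ℚ.<_) (twice q) (anti p-q<r)
                 , subst (lower x) (sym (twice r)) lr)
      (λ (r , r<q , lr) → Equivalence.from (lower-rounded x _)
         (p ℚ.- r , anti r<q , lr))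
  ; disjoint = λ q (u , l) → disjoint x (p ℚ.- q) (l , u)
  ; located = λ q<r → swap (located x (anti q<r))
  }
  where
  anti : ∀ {q r} → q ℚ.< r → p ℚ.- r ℚ.< p ℚ.- q
  anti q<r = ℚ.+-monoʳ-< p (ℚ.neg-antimono-< q<r)
  open ≡-Reasoning
  twice : ∀ q → p ℚ.- (p ℚ.- q) ≡ q
  twice q = begin
    p ℚ.- (p ℚ.- q)               ≡⟨ cong (p ℚ.+_) (ℚ.neg-distrib-+ p (ℚ.- q)) ⟩
    p ℚ.+ (ℚ.- p ℚ.+ ℚ.- (ℚ.- q)) ≡⟨ ℚ.+-assoc p (ℚ.- p) _ ⟨
    (p ℚ.- p) ℚ.+ ℚ.- (ℚ.- q)     ≡⟨ cong (ℚ._+ ℚ.- (ℚ.- q)) (ℚ.+-inverseʳ p) ⟩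
    0ℚ ℚ.+ ℚ.- (ℚ.- q)            ≡⟨ ℚ.+-identityˡ _ ⟩
    ℚ.- (ℚ.- q)                   ≡⟨ neg-neg q ⟩
    q                             ∎
    where
    neg-neg : ∀ q → ℚ.- (ℚ.- q) ≡ q
    neg-neg (mkℚ (+ zero)    _ _) = refl
    neg-neg (mkℚ (+ (suc _)) _ _) = refl
    neg-neg (mkℚ -[1+ _ ]    _ _) = refl

------------------------------------------------------------------------
-- The base 2 logarithm of a natural number

_⁺ _⁻ : ℤ → ℕ
(+ n)    ⁺ = n
-[1+ _ ] ⁺ = 0
(+ _)    ⁻ = 0
-[1+ n ] ⁻ = suc n

-- 2 ^ q ≤ m and m ≤ 2 ^ q for q = a / d, after raising to the power d and
-- multiplying by 2 ^ a ⁻.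
2^_≤_ : ℚ → ℕ → Set
2^ q ≤ m = 2 ℕ.^ (↥ q) ⁺ ℕ.≤ m ℕ.^ (↧ₙ q) ℕ.* 2 ℕ.^ (↥ q) ⁻

_≤2^_ : ℕ → ℚ → Set
m ≤2^ q = m ℕ.^ (↧ₙ q) ℕ.* 2 ℕ.^ (↥ q) ⁻ ℕ.≤ 2 ℕ.^ (↥ q) ⁺

private
  n≤2^n : ∀ n → n ℕ.≤ 2 ℕ.^ n
  n≤2^n zero    = z≤n
  n≤2^n (suc n) = ℕ.≤-trans (ℕ.+-mono-≤ (ℕ.m^n>0 2 n) (n≤2^n n))
    (ℕ.≤-reflexive (cong (2 ℕ.^ n ℕ.+_) (sym (ℕ.+-identityʳ _))))

  ^-cancelʳ-≤ : ∀ a b → 2 ℕ.^ a ℕ.≤ 2 ℕ.^ b → a ℕ.≤ b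
  ^-cancelʳ-≤ a b h with a ℕ.≤? b
  ... | yes a≤b = a≤b
  ... | no  a≰b with () ← ℕ.<⇒≱ (ℕ.^-monoʳ-< 2 (s≤s (s≤s z≤n)) (ℕ.≰⇒> a≰b)) h

  *-^ : ∀ x y k → (x ℕ.* y) ℕ.^ k ≡ x ℕ.^ k ℕ.* y ℕ.^ k
  *-^ x y zero    = refl
  *-^ x y (suc k) = trans (cong (x ℕ.* y ℕ.*_) (*-^ x y k))
    (ℕ.[m*n]*[o*p]≡[m*o]*[n*p] x y (x ℕ.^ k) (y ℕ.^ k))

  ^-dist : ∀ m d e k → (m ℕ.^ d ℕ.* 2 ℕ.^ e) ℕ.^ k ≡ m ℕ.^ (d ℕ.* k) ℕ.* 2 ℕ.^ (e ℕ.* k)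
  ^-dist m d e k = trans (*-^ (m ℕ.^ d) (2 ℕ.^ e) k)
    (cong₂ ℕ._*_ (ℕ.^-*-assoc m d k) (ℕ.^-*-assoc 2 e k))

  split : ∀ a → a ≡ + (a ⁺) ℤ.- + (a ⁻)
  split (+ n)    = sym (ℤ.+-identityʳ (+ n))
  split -[1+ n ] = refl

  cross : ∀ a b (d e : ℕ) → a ⁺ ℕ.* e ℕ.+ b ⁻ ℕ.* d ℕ.≤ b ⁺ ℕ.* d ℕ.+ a ⁻ ℕ.* e →
          a ℤ.* + e ℤ.≤ b ℤ.* + d
  cross (+ m) (+ n) d e h = subst₂ ℤ._≤_ (ℤ.pos-* m e) (ℤ.pos-* n d)
    (ℤ.+≤+ (subst₂ ℕ._≤_ (ℕ.+-identityʳ _) (ℕ.+-identityʳ _) h))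
  cross (+ m) -[1+ n ] d e h = ℤ.≤-trans
    (subst (ℤ._≤ + 0) (ℤ.pos-* m e)
      (ℤ.+≤+ (ℕ.≤-trans (ℕ.m≤m+n (m ℕ.* e) _) h)))
    (subst (+ 0 ℤ.≤_) (trans (cong ℤ.-_ (ℤ.pos-* (suc n) d)) (ℤ.neg-distribˡ-* (+ suc n) (+ d)))
      (ℤ.neg-mono-≤ (ℤ.+≤+ (ℕ.≤-trans (ℕ.m≤n+m (suc n ℕ.* d) (m ℕ.* e)) h))))
  cross -[1+ m ] (+ n) d e h = ℤ.≤-trans
    (subst (ℤ._≤ + 0) (trans (cong ℤ.-_ (ℤ.pos-* (suc m) e)) (ℤ.neg-distribˡ-* (+ suc m) (+ e)))
      (ℤ.neg-mono-≤ (ℤ.+≤+ z≤n)))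
    (subst (+ 0 ℤ.≤_) (ℤ.pos-* n d) (ℤ.+≤+ z≤n))
  cross -[1+ m ] -[1+ n ] d e h = subst₂ ℤ._≤_
    (trans (cong ℤ.-_ (ℤ.pos-* (suc m) e)) (ℤ.neg-distribˡ-* (+ suc m) (+ e)))
    (trans (cong ℤ.-_ (ℤ.pos-* (suc n) d)) (ℤ.neg-distribˡ-* (+ suc n) (+ d)))
    (ℤ.neg-mono-≤ (ℤ.+≤+ h))

  2^-cancel-≤ : ∀ p q m → 2^ p ≤ m → m ≤2^ q → p ℚ.≤ q
  2^-cancel-≤ p q m lo hi = ℚ.*≤* (cross (↥ p) (↥ q) d e (^-cancelʳ-≤ _ _ main))
    where
    d = ↧ₙ p
    e = ↧ₙ q
    a⁺ = (↥ p) ⁺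
    a⁻ = (↥ p) ⁻
    b⁺ = (↥ q) ⁺
    b⁻ = (↥ q) ⁻
    lo′ : 2 ℕ.^ (a⁺ ℕ.* e) ℕ.≤ m ℕ.^ (d ℕ.* e) ℕ.* 2 ℕ.^ (a⁻ ℕ.* e)
    lo′ = subst₂ ℕ._≤_ (ℕ.^-*-assoc 2 a⁺ e) (^-dist m d a⁻ e) (ℕ.^-monoˡ-≤ e lo)
    hi′ : m ℕ.^ (d ℕ.* e) ℕ.* 2 ℕ.^ (b⁻ ℕ.* d) ℕ.≤ 2 ℕ.^ (b⁺ ℕ.* d)
    hi′ = subst₂ ℕ._≤_
      (trans (^-dist m e b⁻ d) (cong (λ k → m ℕ.^ k ℕ.* 2 ℕ.^ (b⁻ ℕ.* d)) (ℕ.*-comm e d)))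
      (ℕ.^-*-assoc 2 b⁺ d) (ℕ.^-monoˡ-≤ d hi)
    open ℕ.≤-Reasoning
    X = m ℕ.^ (d ℕ.* e)
    A = 2 ℕ.^ (a⁻ ℕ.* e)
    B = 2 ℕ.^ (b⁻ ℕ.* d)
    main : 2 ℕ.^ (a⁺ ℕ.* e ℕ.+ b⁻ ℕ.* d) ℕ.≤ 2 ℕ.^ (b⁺ ℕ.* d ℕ.+ a⁻ ℕ.* e)
    main = begin
      2 ℕ.^ (a⁺ ℕ.* e ℕ.+ b⁻ ℕ.* d)  ≡⟨ ℕ.^-distribˡ-+-* 2 (a⁺ ℕ.* e) _ ⟩
      2 ℕ.^ (a⁺ ℕ.* e) ℕ.* B         ≤⟨ ℕ.*-monoˡ-≤ B lo′ ⟩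
      X ℕ.* A ℕ.* B                  ≡⟨ ℕ.*-assoc X A B ⟩
      X ℕ.* (A ℕ.* B)                ≡⟨ cong (X ℕ.*_) (ℕ.*-comm A B) ⟩
      X ℕ.* (B ℕ.* A)                ≡⟨ ℕ.*-assoc X B A ⟨
      X ℕ.* B ℕ.* A                  ≤⟨ ℕ.*-monoˡ-≤ A hi′ ⟩
      2 ℕ.^ (b⁺ ℕ.* d) ℕ.* A         ≡⟨ ℕ.^-distribˡ-+-* 2 (b⁺ ℕ.* d) _ ⟨
      2 ℕ.^ (b⁺ ℕ.* d ℕ.+ a⁻ ℕ.* e)  ∎

-- log₂ m = sup { q | 2 ^ q ≤ m } = inf { q | m ≤ 2 ^ q }, with log₂ 0 = 0.
log₂ : ℕ → ℝ
log₂ zero        = 0ℝ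
log₂ m@(suc m-1) = record
  { lower = λ q → ∃[ r ] q ℚ.< r × 2^ r ≤ m
  ; upper = λ q → ∃[ r ] r ℚ.< q × m ≤2^ r
  ; lower-inhabited = 0ℚ ℚ.- 1ℚ , 0ℚ , q-1<q 0ℚ , s≤s z≤n
  ; upper-inhabited = mℚ ℚ.+ 1ℚ , mℚ , q<q+1 mℚ , m≤2^m
  ; lower-rounded = λ q → mk⇔
      (λ (r , q<r , h) → let s , q<s , s<r = ℚ.<-dense q<r in s , q<s , r , s<r , h)
      (λ (s , q<s , r , s<r , h) → r , ℚ.<-trans q<s s<r , h)
  ; upper-rounded = λ q → mk⇔
      (λ (r , r<q , h) → let s , r<s , s<q = ℚ.<-dense r<q in s , s<q , r , r<s , h)
      (λ (s , s<q , r , r<s , h) → r , ℚ.<-trans r<s s<q , h)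
  ; disjoint = λ q ((r , q<r , lo) , (s , s<q , hi)) →
      ℚ.<-irrefl refl
        (ℚ.<-≤-trans (ℚ.<-trans s<q q<r) (2^-cancel-≤ r s m lo hi))
  ; located = loc
  }
  where
  mℚ : ℚ
  mℚ = mkℚ (+ m) 0 (Coprime.sym (Coprime.1-coprimeTo m))
  m≤2^m : m ≤2^ mℚ
  m≤2^m = subst (ℕ._≤ 2 ℕ.^ m)
    (sym (trans (ℕ.*-identityʳ (m ℕ.^ 1)) (ℕ.^-identityʳ m))) (n≤2^n m)
  loc : ∀ {q r} → q ℚ.< r →
        (∃[ s ] q ℚ.< s × 2^ s ≤ m) ⊎ (∃[ s ] s ℚ.< r × m ≤2^ s)
  loc q<r with ℚ.<-dense q<r
  ... | s , q<s , s<r with ℕ.≤-total (2 ℕ.^ (↥ s) ⁺) (m ℕ.^ (↧ₙ s) ℕ.* 2 ℕ.^ (↥ s) ⁻)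
  ...   | inj₁ lo = inj₁ (s , q<s , lo)
  ...   | inj₂ hi = inj₂ (s , s<r , hi)

------------------------------------------------------------------------
-- Asymptotics

Eventually : (ℕ → Set) → Set
Eventually P = ∃[ N ] ∀ n → N ℕ.≤ n → P n

infix 4 _⟶_ limsup_≤_ _=o_

-- Convergence: every open interval with rational endpoints around x
-- eventually contains the sequence.
_⟶_ : (ℕ → ℝ) → ℝ → Set
a ⟶ x = ∀ p q → lower x p → upper x q →
        Eventually λ n → lower (a n) p × upper (a n) q

-- The sequence is eventually below every rational exceeding x.
limsup_≤_ : (ℕ → ℝ) → ℝ → Set
limsup a ≤ x = ∀ q → upper x q → Eventually λ n → upper (a n) q

-- Only meaningful for nonnegative k, as no absolute value is taken.
_=o_ : (ℕ → ℝ) → (ℕ → ℕ) → Set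
k =o f = ∀ ε → 0ℚ ℚ.< ε → Eventually λ n → k n ≤ fromℚ (ε ℚ.* ℕ→ℚ (f n))

------------------------------------------------------------------------
-- Graphs

IsLeast IsGreatest : (ℕ → Set) → ℕ → Set
IsLeast    P m = P m × (∀ j → P j → m ℕ.≤ j)
IsGreatest P m = P m × (∀ j → P j → j ℕ.≤ m)

-- Finite simple graphs with vertex set Fin n
record Graph (n : ℕ) : Set where
  field
    adj        : Fin n → Fin n → Bool
    adj-sym    : ∀ i j → adj i j ≡ adj j i
    adj-irrefl : ∀ i → adj i i ≡ false

  Adj : Fin n → Fin n → Set
  Adj i j = T (adj i j)

open Graph public

private
  variable
    n v : ℕ

infix 4 _≈_

-- Equality of labelled graphs, i.e. of edge sets
_≈_ : Graph n → Graph n → Set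
G ≈ G′ = ∀ i j → adj G i j ≡ adj G′ i j

infixl 6 _⊕_

_⊕_ : Graph n → Graph n → Graph n
G ⊕ G′ = record
  { adj        = λ i j → adj G i j xor adj G′ i j
  ; adj-sym    = λ i j → cong₂ _xor_ (adj-sym G i j) (adj-sym G′ i j)
  ; adj-irrefl = λ i → cong₂ _xor_ (adj-irrefl G i) (adj-irrefl G′ i)
  }

numEdges : Graph n → ℕ
numEdges {n} G = length (filter (λ (i , j) → (i Fin.<? j) ×-dec T? (adj G i j))
                                (cartesianProduct (allFin n) (allFin n)))

Colourable : Graph n → ℕ → Set
Colourable {n} G r =
  Σ (Fin n → Fin r) λ f → ∀ i j → Adj G i j → f i ≢ f j

IsChromaticNumber : Graph n → ℕ → Set
IsChromaticNumber G = IsLeast (Colourable G)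

record Subgraph (G : Graph n) : Set where
  field
    verts    : Subset n
    edges    : Graph n
    edges⊆   : ∀ i j → Adj edges i j → Adj G i j
    edges-in : ∀ i j → Adj edges i j → i ∈ verts

open Subgraph public

_≈ₛ_ : {G : Graph n} → Subgraph G → Subgraph G → Set
H ≈ₛ H′ = verts H ≡ verts H′ × edges H ≈ edges H′

record IsCopy (L : Graph v) {G : Graph n} (H : Subgraph G) : Set where
  field
    φ         : Fin v → Fin n
    injective : Injective _≡_ _≡_ φ
    image     : ∀ i → i ∈ verts H ⇔ (∃[ a ] φ a ≡ i)
    adj-iff   : ∀ a b → Adj L a b ⇔ Adj (edges H) (φ a) (φ b)

-- G contains at least k copies of L: there are N pairwise distinct ones for
-- some natural number N ≥ k.
HasCopies : Graph v → Graph n → ℝ → Set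
HasCopies L G k =
  ∃[ N ] k ≤ fromℕ N ×
  Σ (Fin N → Subgraph G) λ H →
    (∀ i → IsCopy L (H i)) × (∀ i j → i ≢ j → ¬ (H i ≈ₛ H j))

-- There is a family of m distinct graphs on Fin n any two distinct members
-- of which have at least k copies of L in their symmetric difference.
HasFamily : Graph v → (n : ℕ) → ℝ → ℕ → Set
HasFamily L n k m =
  Σ (Fin m → Graph n) λ 𝒢 →
    ∀ i j → i ≢ j → ¬ (𝒢 i ≈ 𝒢 j) × HasCopies L (𝒢 i ⊕ 𝒢 j) k

-- IsM L n k m says that M_L(n, k) = m.
IsM : Graph v → (n : ℕ) → ℝ → ℕ → Set
IsM L n k = IsGreatest (HasFamily L n k)

-- The sequence log₂ (M n) / binom n 2; its values for n < 2, where the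
-- denominator vanishes, are irrelevant to its limit.
rate : (ℕ → ℕ) → ℕ → ℝ
rate M n = log₂ (M n) / (n C 2)

{-# OPTIONS --safe #-}
-- Write r = χ(L) - 1.
--
-- Upper bounds.  Let S be a graph with fewer than k copies of L.  Two members
-- of the family that agree on the non-edges of S differ by a subgraph of S, so
-- M is at most 2 to the number of non-edges of S.  Without copies, S is the
-- Turán graph with r parts.  When k = c n^v, add edges of density θ evenly
-- inside the parts: every r-colouring of L has a monochromatic edge, so at most
-- θ n^v maps of L land in S, which leaves fewer than c n^v copies if θ < c.  The
-- resulting rate (1 - θ)/r is at most 1/r - 2c/e(L) if e(L) ≥ 2r; in the
-- remaining cases (an edge, a triangle) L has a symmetry of order 2, so that
-- each copy arises from two maps and θ < 2c suffices.
--
-- Lower bound.  By maximality every graph has a poor distance from a member of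
-- the family, so 2^C(n,2) ≤ M · #{graphs with few copies of L}, and it remains to
-- show that log #{graphs with few copies} ≤ (1 - 1/r + o(1)) n²/2.
--   For graphs without K_{r+1}(t), peel off a copy of K_r(T) with T large (if
-- there is none, use induction on r): all but boundedly many other vertices
-- have at most t neighbours in one of its parts, so they cost about (r - 1) T
-- bits for its r T vertices, and the sum over all steps is (1 - 1/r) n²/2.
--   For graphs with few copies, cut most of the vertex set into m groups of b
-- elements of ℤ/b, b prime to m!.  The lines i ↦ s i + α i + β split the edges
-- between groups into b² cliques K_m; averaging over the shift s, almost all of
-- them contain no L, and by the first step each costs about (1 - 1/r) m²/2 bits.
module Submission where

-- The usual way from few copies to none is the removal lemma. Here the lines replace it, so that an
-- estimate for L-free graphs is needed only for one fixed number m of vertices. A single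
-- decomposition would not do: for v > 2, far fewer than n^v copies could spoil all of its b² lines,
-- one copy each. Over all b^m shifts, however, distinct shifts give distinct lines for each fixed
-- α, β, so v prescribed values occur on at most b^(m - v) of them, and few copies spoil few lines
-- on average. A spoiled line costs m² bits instead of about (1 - 1/r) m²/2; with at most b²/m² of
-- them the loss is b² bits, negligible for large m. The constants are chosen in this order: a
-- rational A/B below 1/r fixes D; D fixes the part size T and the constant Q of the bound for
-- graphs without K_{r+1}(v); these fix m; only then does n grow. Hence k = o(n^v) is applied with a
-- single factor Z depending on m. Real numbers stay outside: every estimate compares A C(n,2) with
-- B u in natural numbers, where 2^u bounds M from one side.

-- Counting up to a relation by means of codes

module Counting where

  open import Data.Bool using (Bool; true; false)
  open import Data.Empty using (⊥-elim)
  open import Data.Fin using (Fin; zero; suc; combine; inject≤; _↑ˡ_; _↑ʳ_; punchIn; punchOut)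
  import Data.Fin.Properties as Fin
  open import Data.Nat
  open import Data.Nat.Properties
  open import Data.Product using (Σ; ∃; ∃-syntax; _×_; _,_; proj₁)
  open import Data.Sum using (_⊎_; inj₁; inj₂)
  open import Function using (_∘_; id)
  open import Function.Definitions using (Injective)
  open import Relation.Binary.PropositionalEquality using (_≡_; _≢_; refl; sym; trans; cong; subst)
  open import Relation.Nullary using (¬_; Dec; yes; no; does; contradiction)
  open import Relation.Nullary.Decidable using (_→-dec_; map′; dec-true)

  private
    variable
      n m ℓ K J : ℕ
      A B : Set
      R S : A → A → Set

  dec-true⁻ : {P : Set} (P? : Dec P) → does P? ≡ true → P
  dec-true⁻ (yes p) _ = p

  dec-false⁻ : {P : Set} (P? : Dec P) → does P? ≡ false → ¬ P
  dec-false⁻ (no ¬p) _ = ¬p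

  infix 4 _↣/_

  -- A code with values in Fin K: a code word determines the object up to R.
  -- So K bounds the number of R-classes, without choosing representatives.
  record Code {A : Set} (R : A → A → Set) (K : ℕ) : Set where
    constructor _↣/_
    field
      code  : A → Fin K
      sound : ∀ {a b} → code a ≡ code b → R a b

  open Code public

  Code⇒≤ : Code {Fin n} _≡_ K → n ≤ K
  Code⇒≤ (c ↣/ s) = Fin.injective⇒≤ s

  weaken : K ≤ J → Code R K → Code R J
  weaken K≤J (c ↣/ s) =
    (λ a → inject≤ (c a) K≤J) ↣/ λ eq → s (Fin.inject≤-injective K≤J K≤J _ _ eq)

  pullback : (f : A → B) {R : A → A → Set} {S : B → B → Set} →
             (∀ {a b} → S (f a) (f b) → R a b) → Code S K → Code R K
  pullback f h (c ↣/ s) = (λ a → c (f a)) ↣/ λ eq → h (s eq)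

  coarsen : {R S : A → A → Set} → (∀ {a b} → R a b → S a b) → Code R K → Code S K
  coarsen h = pullback id h

  trivial : (∀ {a b : A} → R a b) → Code R 1
  trivial h = (λ _ → zero) ↣/ λ _ → h

  empty : ¬ A → Code {A} R 0
  empty ¬a = (λ a → ⊥-elim (¬a a)) ↣/ λ {a} → ⊥-elim (¬a a)

  letter : (f : A → Fin K) → Code (λ a b → f a ≡ f b) K
  letter f = f ↣/ id

  bit : (f : A → Bool) → Code (λ a b → f a ≡ f b) 2
  bit f = (λ a → enc (f a)) ↣/ inj _ _
    where
    enc : Bool → Fin 2
    enc false = zero
    enc true  = suc zero
    inj : ∀ x y → enc x ≡ enc y → x ≡ y
    inj false false _ = refl
    inj true  true  _ = refl

  infixr 4 _⊗_

  _⊗_ : Code R K → Code S J → Code (λ a b → R a b × S a b) (K * J)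
  (c ↣/ s) ⊗ (d ↣/ t) = (λ a → combine (c a) (d a)) ↣/
    λ eq → let p , q = Fin.combine-injective _ _ _ _ eq in s p , t q

  ⨂ : {R : Fin n → A → A → Set} → (∀ i → Code (R i) K) →
      Code (λ a b → ∀ i → R i a b) (K ^ n)
  ⨂ {n = zero}  c = trivial λ ()
  ⨂ {n = suc n} c = coarsen (λ (p , q) → λ { zero → p ; (suc i) → q i })
                            (c zero ⊗ ⨂ (c ∘ suc))

  module _ {A : Set} (R : A → A → Set) where

    restrict : (P : A → Set) → ∃ P → ∃ P → Set
    restrict P (a , _) (b , _) = R a b

    -- The code of the remainder may depend on the value of f. In this way a choice made for an
    -- object (a sparse part, a good shift, a near member of the family) enters its code word
    -- without having to be canonical.
    choose : (f : A → Fin J) → (∀ x → Code (restrict λ a → f a ≡ x) K) → Code R (J * K)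
    choose f c = (λ a → combine (f a) (code (c (f a)) (a , refl))) ↣/ inj
      where
      inj : ∀ {a b} → combine (f a) (code (c (f a)) (a , refl)) ≡
                      combine (f b) (code (c (f b)) (b , refl)) → R a b
      inj {a} {b} eq with Fin.combine-injective (f a) _ (f b) _ eq
      ... | p , q = aux (f a) (f b) p refl refl q
        where
        -- Codes of different fibres have different domains, so both values of f become variables
        -- and are identified before the inner code words are compared.
        aux : ∀ x y → x ≡ y → (fa : f a ≡ x) (fb : f b ≡ y) →
              code (c x) (a , fa) ≡ code (c y) (b , fb) → R a b
        aux x _ refl fa fb q = sound (c x) q

    cases : (f : A → Bool) → Code (restrict λ a → f a ≡ false) K →
            Code (restrict λ a → f a ≡ true) J → Code R (K + J)
    cases {K = K} {J = J} f c d = (λ a → enc a (f a) refl) ↣/ inj _ _ refl refl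
      where
      enc : ∀ a x → f a ≡ x → Fin (K + J)
      enc a false eq = code c (a , eq) ↑ˡ J
      enc a true  eq = K ↑ʳ code d (a , eq)
      lr : ∀ (i : Fin K) (j : Fin J) → ¬ (i ↑ˡ J ≡ K ↑ʳ j)
      lr i j eq with trans (sym (Fin.splitAt-↑ˡ K i J)) (trans (cong (Data.Fin.splitAt K) eq) (Fin.splitAt-↑ʳ K J j))
      ... | ()
      inj : ∀ {a b} x y (fa : f a ≡ x) (fb : f b ≡ y) → enc a x fa ≡ enc b y fb → R a b
      inj false false fa fb eq = sound c (Fin.↑ˡ-injective J _ _ eq)
      inj false true  fa fb eq = ⊥-elim (lr _ _ eq)
      inj true  false fa fb eq = ⊥-elim (lr _ _ (sym eq))
      inj true  true  fa fb eq = sound d (Fin.↑ʳ-injective K _ _ eq)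

    cases? : {P : A → Set} → (∀ a → Dec (P a)) → Code (restrict P) K →
             Code (restrict λ a → ¬ P a) J → Code R (J + K)
    cases? P? c d = cases (does ∘ P?)
      (pullback (λ (a , eq) → a , dec-false⁻ (P? a) eq) id d)
      (pullback (λ (a , eq) → a , dec-true⁻ (P? a) eq) id c)

  count : (Fin n → Bool) → ℕ
  count {zero}  p = 0
  count {suc n} p with p zero
  ... | true  = suc (count (p ∘ suc))
  ... | false = count (p ∘ suc)

  -- Together with `pick`, which gives the converse inequality, this makes `count p` the exact size
  -- of the set where p is true.
  rank : (p : Fin n → Bool) → Code {∃ λ i → p i ≡ true} (λ (i , _) (j , _) → i ≡ j) (count p)
  rank {zero}  p = (λ ()) ↣/ λ { {()} }
  rank {suc n} p with p zero in eq | rank (p ∘ suc)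
  ... | false | c ↣/ s = (λ { (zero , q) → ⊥-elim (absurd q) ; (suc i , q) → c (i , q) }) ↣/
      λ { {zero , q} → ⊥-elim (absurd q) ; {suc i , q} {zero , q′} → ⊥-elim (absurd q′)
        ; {suc i , q} {suc j , q′} e → cong suc (s e) }
    where
    absurd : ¬ (p zero ≡ true)
    absurd q with () ← trans (sym eq) q
  ... | true  | c ↣/ s = (λ { (zero , q) → zero ; (suc i , q) → suc (c (i , q)) }) ↣/
      λ { {zero , q} {zero , q′} e → refl ; {suc i , q} {suc j , q′} e → cong suc (s (Fin.suc-injective e)) }

  pick : (p : Fin n → Bool) → Σ (Fin (count p) → Fin n) λ f →
         Injective _≡_ _≡_ f × ∀ i → p (f i) ≡ true
  pick {zero}  p = (λ ()) , (λ { {()} }) , λ ()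
  pick {suc n} p with p zero in eq | pick (p ∘ suc)
  ... | false | f , inj , h = suc ∘ f , inj ∘ Fin.suc-injective , h
  ... | true  | f , inj , h = g , ginj , gh
    where
    g : Fin (suc (count (p ∘ suc))) → Fin (suc _)
    g zero    = zero
    g (suc i) = suc (f i)
    ginj : Injective _≡_ _≡_ g
    ginj {zero}  {zero}  e = refl
    ginj {suc i} {suc j} e = cong suc (inj (Fin.suc-injective e))
    gh : ∀ i → p (g i) ≡ true
    gh zero    = eq
    gh (suc i) = h i

  pick≤ : (p : Fin n → Bool) → K ≤ count p → Σ (Fin K → Fin n) λ f →
          Injective _≡_ _≡_ f × ∀ i → p (f i) ≡ true
  pick≤ p K≤ = let f , inj , h = pick p in
    (λ i → f (inject≤ i K≤)) , (λ e → Fin.inject≤-injective K≤ K≤ _ _ (inj e)) , λ i → h _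

  -- Words of length ℓ with at most B bad letters, where a letter has F good
  -- values and X bad ones.
  W : ℕ → ℕ → ℕ → ℕ → ℕ
  W F X zero    B       = 1
  W F X (suc ℓ) zero    = F * W F X ℓ zero
  W F X (suc ℓ) (suc B) = F * W F X ℓ (suc B) + X * W F X ℓ B

  -- The case split on the first letter is the recurrence of `W`: a bad letter uses up one of the B
  -- allowed, and none is possible once B is 0.
  words : ∀ {F X} B {A : Set} (R : Fin ℓ → A → A → Set) (bad : A → Fin ℓ → Bool) →
          (∀ i → Code (restrict (R i) λ a → bad a i ≡ false) F) →
          (∀ i → Code (restrict (R i) λ a → bad a i ≡ true) X) →
          (∀ a → count (bad a) ≤ B) →
          Code (λ a b → ∀ i → R i a b) (W F X ℓ B)
  words {zero}  B R bad good ill few = trivial λ ()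
  words {suc ℓ} {F} {X} B {A} R bad good ill few = split B few
    where
    R⁺ : A → A → Set
    R⁺ a b = ∀ i → R i a b
    glue : ∀ {a b} → R zero a b × (∀ i → R (suc i) a b) → R⁺ a b
    glue (p , q) zero    = p
    glue (p , q) (suc i) = q i
    tail : ∀ {P : A → Set} B′ → ((x : Σ A P) → count (bad (proj₁ x) ∘ suc) ≤ B′) →
           Code {Σ A P} (λ a b → ∀ i → R (suc i) (proj₁ a) (proj₁ b)) (W F X ℓ B′)
    tail B′ few′ = words B′ (λ i a b → R (suc i) (proj₁ a) (proj₁ b)) (λ a i → bad (proj₁ a) (suc i))
      (λ i → pullback (λ ((a , _) , e) → a , e) id (good (suc i)))
      (λ i → pullback (λ ((a , _) , e) → a , e) id (ill (suc i))) few′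
    count-false : ∀ a → bad a zero ≡ false → count (bad a) ≡ count (bad a ∘ suc)
    count-false a eq with false ← bad a zero = refl
    count-true : ∀ a → bad a zero ≡ true → count (bad a) ≡ suc (count (bad a ∘ suc))
    count-true a eq with true ← bad a zero = refl
    split : ∀ B → (∀ a → count (bad a) ≤ B) → Code R⁺ (W F X (suc ℓ) B)
    split zero few = weaken (≤-reflexive (+-identityʳ _)) (cases R⁺ (λ a → bad a zero)
      (coarsen glue (good zero ⊗ tail 0 λ (a , e) → subst (_≤ 0) (count-false a e) (few a)))
      (empty λ (a , e) → n≮0 (subst (_≤ 0) (count-true a e) (few a))))
    split (suc B) few = cases R⁺ (λ a → bad a zero)
      (coarsen glue (good zero ⊗ tail (suc B) λ (a , e) → subst (_≤ suc B) (count-false a e) (few a)))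
      (coarsen glue (ill zero ⊗ tail B λ (a , e) → s≤s⁻¹ (subst (_≤ suc B) (count-true a e) (few a))))

  -- If every fibre had at most J elements, `choose` would embed `Fin n` into `Fin (K * J)`.
  pigeonhole : (f : Fin n → Fin K) → K * J < n →
               ∃[ x ] suc J ≤ count (λ i → does (f i Fin.≟ x))
  pigeonhole {n} {K} {J} f KJ<n with Fin.any? (λ x → suc J ≤? count (λ i → does (f i Fin.≟ x)))
  ... | yes p = p
  ... | no ¬p = contradiction (Code⇒≤ (choose _≡_ f each)) (<⇒≱ KJ<n)
    where
    each : ∀ x → Code (restrict _≡_ λ i → f i ≡ x) J
    each x = weaken (s≤s⁻¹ (≰⇒> λ h → ¬p (x , h)))
      (pullback (λ (i , e) → i , dec-true (f i Fin.≟ x) e) id (rank (λ i → does (f i Fin.≟ x))))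

  injective? : (f : Fin n → Fin m) → Dec (Injective _≡_ _≡_ f)
  injective? f = map′ (λ h {i} {j} → h i j) (λ h i j → h)
    (Fin.all? λ i → Fin.all? λ j → (f i Fin.≟ f j) →-dec (i Fin.≟ j))

  -- z is produced for every y, because it must be fixed before any graph is given in which y is
  -- known to be injective; only the covering property assumes injectivity.
  complement : n ≡ m + ℓ → (y : Fin m → Fin n) → Σ (Fin ℓ → Fin n) λ z →
    Injective _≡_ _≡_ z ×
    (Injective _≡_ _≡_ y → ∀ i → (∃[ j ] y j ≡ i) ⊎ (∃[ j ] z j ≡ i))
  complement {m = m} {ℓ} refl y with injective? y
  ... | no ¬inj = m ↑ʳ_ , Fin.↑ʳ-injective m _ _ , λ inj → ⊥-elim (¬inj inj)
  ... | yes inj = let z , zinj , cov = build y inj in z , zinj , λ _ → cov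
    where
    build : ∀ {m} (y : Fin m → Fin (m + ℓ)) → Injective _≡_ _≡_ y →
            Σ (Fin ℓ → Fin (m + ℓ)) λ z → Injective _≡_ _≡_ z ×
            (∀ i → (∃[ j ] y j ≡ i) ⊎ (∃[ j ] z j ≡ i))
    build {zero} y inj = id , id , λ i → inj₂ (i , refl)
    build {suc m} y inj with build {m} (λ i → punchOut (y₀≢ i)) (λ e → Fin.suc-injective (inj (Fin.punchOut-injective (y₀≢ _) (y₀≢ _) e)))
      where
      y₀≢ : ∀ i → y zero ≢ y (suc i)
      y₀≢ i e with () ← inj e
    ... | z , zinj , cov = punchIn (y zero) ∘ z , zinj ∘ Fin.punchIn-injective (y zero) _ _ , cov′
      where
      y₀≢ : ∀ i → y zero ≢ y (suc i)
      y₀≢ i e with () ← inj e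
      cov′ : ∀ i → (∃[ j ] y j ≡ i) ⊎ (∃[ j ] punchIn (y zero) (z j) ≡ i)
      cov′ i with y zero Fin.≟ i
      ... | yes e = inj₁ (zero , e)
      ... | no ≢i with cov (punchOut ≢i)
      ...   | inj₁ (j , e) = inj₁ (suc j , Fin.punchOut-injective (y₀≢ j) ≢i (trans (Fin.punchOut-cong (y zero) refl) e))
      ...   | inj₂ (j , e) = inj₂ (j , trans (cong (punchIn (y zero)) e) (Fin.punchIn-punchOut ≢i))

-- Exponential estimates

module Arithmetic where

  open import Data.Nat
  open import Data.Nat.DivMod
  open import Data.Nat.Properties
  open import Data.Nat.Tactic.RingSolver using (solve-∀)
  open import Data.Sum using (inj₁; inj₂)
  open import Relation.Binary.PropositionalEquality using (_≡_; refl; sym; trans; cong)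

  open Counting

  open ≤-Reasoning

  n<2^n : ∀ n → n < 2 ^ n
  n<2^n zero    = s≤s z≤n
  n<2^n (suc n) = begin-strict
    suc n             <⟨ +-mono-≤-< (m^n>0 2 n) (n<2^n n) ⟩
    2 ^ n + 2 ^ n     ≡⟨ cong (2 ^ n +_) (+-identityʳ (2 ^ n)) ⟨
    2 ^ suc n         ∎

  2^-sum : ∀ {a b e} → a ≤ 2 ^ e → b ≤ 2 ^ e → a + b ≤ 2 ^ suc e
  2^-sum {e = e} p q = ≤-trans (+-mono-≤ p q) (≤-reflexive (cong (2 ^ e +_) (sym (+-identityʳ (2 ^ e)))))

  2^-product : ∀ {a b d e} → a ≤ 2 ^ d → b ≤ 2 ^ e → a * b ≤ 2 ^ (d + e)
  2^-product {d = d} {e} p q = ≤-trans (*-mono-≤ p q) (≤-reflexive (sym (^-distribˡ-+-* 2 d e)))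

  2^-power : ∀ {a d} k → a ≤ 2 ^ d → a ^ k ≤ 2 ^ (d * k)
  2^-power {d = d} k p = ≤-trans (^-monoˡ-≤ k p) (≤-reflexive (^-*-assoc 2 d k))

  -- For u = n / c one has n ≤ c (u + 1) ≤ 2^(c + u), and u c ≤ n. Polynomial factors thus cost n
  -- bits and a constant, which is small against n².
  poly≤exp : ∀ n c → n ^ c ≤ 2 ^ (c * c + n)
  poly≤exp n zero      = m^n>0 2 n
  poly≤exp n c@(suc _) = begin
    n ^ c                     ≤⟨ 2^-power {d = c + u} c n≤2^ ⟩
    2 ^ ((c + u) * c)         ≤⟨ ^-monoʳ-≤ 2 exponent ⟩
    2 ^ (c * c + n)           ∎
    where
    u = n / c
    n≤2^ : n ≤ 2 ^ (c + u)
    n≤2^ = begin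
      n                   ≡⟨ m≡m%n+[m/n]*n n c ⟩
      n % c + u * c       ≤⟨ +-monoˡ-≤ (u * c) (<⇒≤ (m%n<n n c)) ⟩
      suc u * c           ≡⟨ *-comm (suc u) c ⟩
      c * suc u           ≤⟨ 2^-product {d = c} {u} (<⇒≤ (n<2^n c)) (n<2^n u) ⟩
      2 ^ (c + u)         ∎
    exponent : (c + u) * c ≤ c * c + n
    exponent = begin
      (c + u) * c   ≡⟨ *-distribʳ-+ c c u ⟩
      c * c + u * c ≤⟨ +-monoʳ-≤ (c * c) (m/n*n≤m n c) ⟩
      c * c + n     ∎

  -- The exponent 4c makes 2^(4c) a square exceeding (2c + 1)².
  linear<exp : ∀ c → c * suc (4 * c) < 2 ^ (4 * c)
  linear<exp c = begin-strict
    c * suc (4 * c)                     <⟨ m<n+m _ (s≤s (z≤n {3 * c})) ⟩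
    suc (3 * c) + c * suc (4 * c)       ≡⟨ lemma c ⟩
    suc (2 * c) * suc (2 * c)           ≤⟨ 2^-product {d = 2 * c} {2 * c} (n<2^n (2 * c)) (n<2^n (2 * c)) ⟩
    2 ^ (2 * c + 2 * c)                 ≡⟨ cong (2 ^_) (double c) ⟩
    2 ^ (4 * c)                         ∎
    where
    lemma : ∀ c → suc (3 * c) + c * suc (4 * c) ≡ suc (2 * c) * suc (2 * c)
    lemma = solve-∀
    double : ∀ c → 2 * c + 2 * c ≡ 4 * c
    double = solve-∀

  *≤squares : ∀ a b → a * b ≤ a * a + b * b
  *≤squares a b with ≤-total a b
  ... | inj₁ a≤b = ≤-trans (*-monoˡ-≤ b a≤b) (m≤n+m _ _)
  ... | inj₂ b≤a = ≤-trans (*-monoʳ-≤ a b≤a) (m≤m+n _ _)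

  ^-distribʳ-* : ∀ k a b → (a * b) ^ k ≡ a ^ k * b ^ k
  ^-distribʳ-* zero    a b = refl
  ^-distribʳ-* (suc k) a b = trans (cong (a * b *_) (^-distribʳ-* k a b))
    ([m*n]*[o*p]≡[m*o]*[n*p] a b (a ^ k) (b ^ k))

  -- For bounded B: a factor ℓ + 1 per bad letter pays for its position.
  W-poly : ∀ F X ℓ B → 1 ≤ F → 1 ≤ X → W F X ℓ B ≤ F ^ ℓ * (suc ℓ * X) ^ B
  W-poly F X zero    B       1≤F 1≤X = begin
    1                       ≡⟨ ^-zeroˡ B ⟨
    1 ^ B                   ≤⟨ ^-monoˡ-≤ B 1≤X ⟩
    X ^ B                   ≡⟨ cong (_^ B) (*-identityˡ X) ⟨
    (1 * X) ^ B             ≡⟨ *-identityˡ _ ⟨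
    1 * (1 * X) ^ B         ∎
  W-poly F X (suc ℓ) zero    1≤F 1≤X = begin
    F * W F X ℓ 0           ≤⟨ *-monoʳ-≤ F (W-poly F X ℓ 0 1≤F 1≤X) ⟩
    F * (F ^ ℓ * 1)         ≡⟨ *-assoc F (F ^ ℓ) 1 ⟨
    F ^ suc ℓ * 1           ∎
  W-poly F X (suc ℓ) (suc B) 1≤F 1≤X = begin
    F * W F X ℓ (suc B) + X * W F X ℓ B
      ≤⟨ +-mono-≤ (*-monoʳ-≤ F (W-poly F X ℓ (suc B) 1≤F 1≤X)) (*-monoʳ-≤ X (W-poly F X ℓ B 1≤F 1≤X)) ⟩
    F * (P * (Y * Y ^ B)) + X * (P * Y ^ B)
      ≤⟨ +-monoʳ-≤ (F * (P * (Y * Y ^ B))) (m≤n*m (X * (P * Y ^ B)) F {{>-nonZero 1≤F}}) ⟩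
    F * (P * (Y * Y ^ B)) + F * (X * (P * Y ^ B))
      ≡⟨ rearrange F P X ℓ (Y ^ B) ⟩
    F * P * ((suc (suc ℓ) * X) * Y ^ B)
      ≤⟨ *-monoʳ-≤ (F * P) (*-monoʳ-≤ (suc (suc ℓ) * X) (^-monoˡ-≤ B (*-monoˡ-≤ X (n≤1+n (suc ℓ))))) ⟩
    F ^ suc ℓ * (suc (suc ℓ) * X) ^ suc B ∎
    where
    P = F ^ ℓ
    Y = suc ℓ * X
    rearrange : ∀ F P X ℓ Z → F * (P * (suc ℓ * X * Z)) + F * (X * (P * Z)) ≡ F * P * ((suc (suc ℓ) * X) * Z)
    rearrange = solve-∀

  -- For B proportional to ℓ: a factor 2 per letter pays for marking the bad ones.
  W-exp : ∀ F X ℓ B → 1 ≤ F → 1 ≤ X → W F X ℓ B ≤ (2 * F) ^ ℓ * X ^ B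
  W-exp F X zero    B       1≤F 1≤X = begin
    1             ≡⟨ ^-zeroˡ B ⟨
    1 ^ B         ≤⟨ ^-monoˡ-≤ B 1≤X ⟩
    X ^ B         ≡⟨ *-identityˡ _ ⟨
    1 * X ^ B     ∎
  W-exp F X (suc ℓ) zero    1≤F 1≤X = begin
    F * W F X ℓ 0                 ≤⟨ *-mono-≤ (m≤n*m F 2) (W-exp F X ℓ 0 1≤F 1≤X) ⟩
    2 * F * ((2 * F) ^ ℓ * 1)     ≡⟨ *-assoc (2 * F) _ 1 ⟨
    (2 * F) ^ suc ℓ * 1           ∎
  W-exp F X (suc ℓ) (suc B) 1≤F 1≤X = begin
    F * W F X ℓ (suc B) + X * W F X ℓ B
      ≤⟨ +-mono-≤ (*-monoʳ-≤ F (W-exp F X ℓ (suc B) 1≤F 1≤X)) (*-monoʳ-≤ X (W-exp F X ℓ B 1≤F 1≤X)) ⟩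
    F * (P * (X * X ^ B)) + X * (P * X ^ B)
      ≤⟨ +-monoʳ-≤ (F * (P * (X * X ^ B))) (m≤n*m (X * (P * X ^ B)) F {{>-nonZero 1≤F}}) ⟩
    F * (P * (X * X ^ B)) + F * (X * (P * X ^ B))
      ≡⟨ rearrange F P X (X ^ B) ⟩
    2 * F * P * (X * X ^ B)   ∎
    where
    P = (2 * F) ^ ℓ
    rearrange : ∀ F P X Z → F * (P * (X * Z)) + F * (X * (P * Z)) ≡ 2 * F * P * (X * Z)
    rearrange = solve-∀

-- Peeling off a complete multipartite subgraph

module Multipartite where

  open import Defs using (Graph; adj; adj-sym; adj-irrefl; _≈_)
  open import Data.Bool using (Bool; true; false)
  import Data.Bool.Properties as Bool
  open import Data.Fin using (Fin; zero; suc; combine; remQuot; punchIn; punchOut; finToFun; funToFin)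
  import Data.Fin.Properties as Fin
  open import Data.Nat
  open import Data.Nat.Properties
  open import Data.Product using (Σ; ∃; ∃-syntax; _×_; _,_; proj₁; proj₂; uncurry)
  open import Data.Sum using (_⊎_; inj₁; inj₂)
  open import Function using (_∘_; id)
  open import Function.Definitions using (Injective)
  open import Relation.Binary.PropositionalEquality using (_≡_; _≢_; refl; sym; trans; cong; cong₂; subst)
  open import Relation.Nullary using (¬_; Dec; yes; no; does; contradiction)
  open import Relation.Nullary.Decidable using (_→-dec_; _×-dec_; ¬?; map′)

  open Counting

  private
    variable
      n m k t : ℕ

  infix 4 _≋_

  _≋_ : {P : Graph n → Set} → ∃ P → ∃ P → Set
  (G , _) ≋ (H , _) = G ≈ H

  induced : (Fin m → Fin n) → Graph n → Graph m
  induced z G = record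
    { adj        = λ i j → adj G (z i) (z j)
    ; adj-sym    = λ i j → adj-sym G (z i) (z j)
    ; adj-irrefl = λ i → adj-irrefl G (z i)
    }

  adjacent⇒≢ : (G : Graph n) → ∀ {i j} → adj G i j ≡ true → i ≢ j
  adjacent⇒≢ G h refl with () ← trans (sym (adj-irrefl G _)) h

  -- ρ i a is the a-th vertex of part i of a complete multipartite subgraph.
  IsMultipartite : Graph n → (Fin k → Fin t → Fin n) → Set
  IsMultipartite G ρ =
    (∀ i → Injective _≡_ _≡_ (ρ i)) ×
    (∀ i j → i ≢ j → ∀ a b → adj G (ρ i a) (ρ j b) ≡ true)

  Multipartite : (k t : ℕ) → Graph n → Set
  Multipartite {n} k t G = Σ (Fin k → Fin t → Fin n) (IsMultipartite G)

  Free : (k t n : ℕ) → Set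
  Free k t n = Σ (Graph n) λ G → ¬ Multipartite k t G

  -- Numbers stand for the maps, so that these can be searched through, sorted into pigeonholes and
  -- used as code words although functions have no decidable equality here.
  encode : (Fin k → Fin t → Fin n) → Fin ((n ^ t) ^ k)
  encode ρ = funToFin λ i → funToFin (ρ i)

  decode : Fin ((n ^ t) ^ k) → Fin k → Fin t → Fin n
  decode x i = finToFun (finToFun x i)

  decode-encode : (ρ : Fin k → Fin t → Fin n) → ∀ i a → decode (encode ρ) i a ≡ ρ i a
  decode-encode ρ i a =
    trans (cong (λ x → finToFun x a) (Fin.finToFun-funToFin (λ i → funToFin (ρ i)) i)) (Fin.finToFun-funToFin (ρ i) a)

  isMultipartite-≗ : (G : Graph n) {ρ σ : Fin k → Fin t → Fin n} → (∀ i a → ρ i a ≡ σ i a) →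
                     IsMultipartite G ρ → IsMultipartite G σ
  isMultipartite-≗ G eq (inj , h) =
    (λ i e → inj i (trans (eq i _) (trans e (sym (eq i _))))) ,
    λ i j i≢j a b → trans (sym (cong₂ (adj G) (eq i a) (eq j b))) (h i j i≢j a b)

  isMultipartite? : (G : Graph n) (ρ : Fin k → Fin t → Fin n) → Dec (IsMultipartite G ρ)
  isMultipartite? G ρ = Fin.all? (λ i → injective? (ρ i)) ×-dec
    Fin.all? λ i → Fin.all? λ j → ¬? (i Fin.≟ j) →-dec
    (Fin.all? λ a → Fin.all? λ b → adj G (ρ i a) (ρ j b) Bool.≟ true)

  multipartite? : ∀ k t (G : Graph n) → Dec (Multipartite k t G)
  multipartite? {n} k t G = map′
    (λ (x , h) → decode {n} {t} {k} x , h)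
    (λ (ρ , h) → encode ρ , isMultipartite-≗ G (λ i a → sym (decode-encode ρ i a)) h)
    (Fin.any? λ x → isMultipartite? G (decode {n} {t} {k} x))

  free-induced : (z : Fin m → Fin n) → Injective _≡_ _≡_ z → (G : Graph n) →
                 ¬ Multipartite k t G → ¬ Multipartite k t (induced z G)
  free-induced z zinj G free (ρ , inj , h) = free ((λ i a → z (ρ i a)) , (λ i e → inj i (zinj e)) , h)

  -- y will list the q = r T vertices of the K_r(T), and z the other m. F and X bound the rows of
  -- adjacencies to y of a good and of a bad vertex; K is t times the number of ways to take a
  -- t-tuple in each of the r parts.
  module Peel (r′ T t β : ℕ) (β-bound : suc r′ * (W 1 1 T t * (2 ^ T) ^ r′) ≤ 2 ^ β)
              {n m : ℕ} (split : n ≡ suc r′ * T + m) where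

    r q F X K : ℕ
    r = suc r′
    q = r * T
    F = 2 ^ β
    X = 2 ^ q
    K = (T ^ t) ^ r * t

    Peelable : Set
    Peelable = Σ (Free (suc r) t n) (Multipartite r T ∘ proj₁)

    _≋ₚ_ : Peelable → Peelable → Set
    _≋ₚ_ = restrict _≋_ _

    module _ (ρ : Fin r → Fin T → Fin n) where

      y : Fin q → Fin n
      y = uncurry ρ ∘ remQuot T

      y-combine : ∀ i a → y (combine i a) ≡ ρ i a
      y-combine i a = cong (uncurry ρ) (Fin.remQuot-combine i a)

      y-injective : (G : Graph n) → IsMultipartite G ρ → Injective _≡_ _≡_ y
      y-injective G (inj , h) {j} {j′} e = begin
        j                                ≡⟨ Fin.combine-remQuot {r} T j ⟨
        uncurry combine (remQuot {r} T j)    ≡⟨ aux (remQuot {r} T j) (remQuot {r} T j′) e ⟩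
        uncurry combine (remQuot {r} T j′)   ≡⟨ Fin.combine-remQuot {r} T j′ ⟩
        j′                               ∎
        where
        open Relation.Binary.PropositionalEquality.≡-Reasoning
        aux : ∀ x x′ → uncurry ρ x ≡ uncurry ρ x′ → uncurry combine x ≡ uncurry combine x′
        aux (i , a) (j , b) e with i Fin.≟ j
        ... | yes refl = cong (combine i) (inj i e)
        ... | no i≢j   = contradiction e (adjacent⇒≢ G (h i j i≢j a b))

      z : Fin m → Fin n
      z = proj₁ (complement {m = q} split y)

      z-injective : Injective _≡_ _≡_ z
      z-injective = proj₁ (proj₂ (complement {m = q} split y))

      covers : Injective _≡_ _≡_ y → ∀ i → (∃[ j ] y j ≡ i) ⊎ (∃[ j ] z j ≡ i)
      covers = proj₂ (proj₂ (complement {m = q} split y))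

      Obj : Set
      Obj = Σ (Graph n) λ G → (¬ Multipartite (suc r) t G) × IsMultipartite G ρ

      row : Obj → Fin m → Fin r → Fin T → Bool
      row (G , _) i p a = adj G (z i) (ρ p a)

      bad? : ∀ o i → Dec (∀ p → suc t ≤ count (row o i p))
      bad? o i = Fin.all? λ p → suc t ≤? count (row o i p)

      bad : Obj → Fin m → Bool
      bad o i = does (bad? o i)

      from-bad : ∀ o i → bad o i ≡ true → ∀ p → suc t ≤ count (row o i p)
      from-bad o i = dec-true⁻ (bad? o i)

      from-good : ∀ o i → bad o i ≡ false → ∃[ p ] count (row o i p) ≤ t
      from-good o i eq =
        let p , h = Fin.¬∀⟶∃¬ r _ (λ p → suc t ≤? count (row o i p)) (dec-false⁻ (bad? o i) eq)
        in p , s≤s⁻¹ (≰⇒> h)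

      -- Every bad vertex picks t neighbours in each part. Among K + 1 bad vertices more than t make
      -- the same picks, and t of these complete a K_{r+1}(t).
      few-bad : ∀ o → count (bad o) ≤ K
      few-bad o@(G , free , ρinj , ρadj) = ≮⇒≥ λ K<c → free (build K<c)
        where
        build : K < count (bad o) → Multipartite (suc r) t G
        build K<c = ρ⁺ , inj⁺ , adj⁺
          where
          g∃ = pick≤ (bad o) K<c
          g = proj₁ g∃
          σ∃ : ∀ i p → Σ (Fin t → Fin T) λ f → Injective _≡_ _≡_ f × ∀ b → row o (g i) p (f b) ≡ true
          σ∃ i p = pick≤ (row o (g i) p) (≤-trans (n≤1+n t) (from-bad o (g i) (proj₂ (proj₂ g∃) i) p))
          σ : Fin (suc K) → Fin r → Fin t → Fin T
          σ i p = proj₁ (σ∃ i p)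
          hole = pigeonhole {J = t} (λ i → encode (σ i)) ≤-refl
          x = proj₁ hole
          h∃ = pick≤ (λ i → does (encode (σ i) Fin.≟ x)) (≤-trans (n≤1+n t) (proj₂ hole))
          h = proj₁ h∃
          same : ∀ a p b → σ (h a) p b ≡ decode {T} {t} {r} x p b
          same a p b = trans (sym (decode-encode (σ (h a)) p b)) (cong (λ x → decode {T} {t} {r} x p b)
            (dec-true⁻ (encode (σ (h a)) Fin.≟ x) (proj₂ (proj₂ h∃) a)))
          ρ⁺ : Fin (suc r) → Fin t → Fin n
          ρ⁺ zero    a = z (g (h a))
          ρ⁺ (suc p) b = ρ p (decode {T} {t} {r} x p b)
          inj⁺ : ∀ i → Injective _≡_ _≡_ (ρ⁺ i)
          inj⁺ zero    e = proj₁ (proj₂ h∃) (proj₁ (proj₂ g∃) (z-injective e))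
          inj⁺ (suc p) {b} {b′} e = proj₁ (proj₂ (σ∃ (h b) p))
            (trans (same b p b) (trans (ρinj p e) (sym (same b p b′))))
          cross : ∀ a p b → adj G (z (g (h a))) (ρ p (decode {T} {t} {r} x p b)) ≡ true
          cross a p b = trans (cong (λ c → adj G (z (g (h a))) (ρ p c)) (sym (same a p b)))
            (proj₂ (proj₂ (σ∃ (h a) p)) b)
          adj⁺ : ∀ i j → i ≢ j → ∀ a b → adj G (ρ⁺ i a) (ρ⁺ j b) ≡ true
          adj⁺ zero    zero    i≢j a b = contradiction refl i≢j
          adj⁺ zero    (suc p) _   a b = cross a p b
          adj⁺ (suc p) zero    _   a b = trans (adj-sym G _ _) (cross b p a)
          adj⁺ (suc i) (suc j) i≢j a b = ρadj i j (λ e → i≢j (cong suc e)) _ _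

      SameRow : Fin m → Obj → Obj → Set
      SameRow i o o′ = ∀ p a → row o i p a ≡ row o′ i p a

      -- The factor r chooses a part with at most t neighbours, and `W 1 1 T t` is for the
      -- neighbours there: with one value for each kind of letter, `W` counts sets of at most t
      -- elements. The other r - 1 parts take T bits each.
      good-row : ∀ i → Code (restrict (SameRow i) λ o → bad o i ≡ false) F
      good-row i = weaken β-bound (choose _ (λ (o , eq) → proj₁ (from-good o i eq)) λ p →
        coarsen (λ {a} {b} → glue p {a} {b}) (sparse p ⊗ ⨂ λ p′ → ⨂ λ a → bit λ ((o , _) , _) → row o i (punchIn p p′) a))
        where
        Part : Fin r → Set
        Part p = ∃ λ (oe : ∃ λ o → bad o i ≡ false) → proj₁ (from-good (proj₁ oe) i (proj₂ oe)) ≡ p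
        glue : ∀ p {a b : Part p} →
          (∀ x → row (proj₁ (proj₁ a)) i p x ≡ row (proj₁ (proj₁ b)) i p x) ×
          (∀ p′ x → row (proj₁ (proj₁ a)) i (punchIn p p′) x ≡ row (proj₁ (proj₁ b)) i (punchIn p p′) x) →
          SameRow i (proj₁ (proj₁ a)) (proj₁ (proj₁ b))
        glue p {a} {b} (u , v) p′ x with p Fin.≟ p′
        ... | yes refl = u x
        ... | no p≢p′  = subst (λ k → row (proj₁ (proj₁ a)) i k x ≡ row (proj₁ (proj₁ b)) i k x)
                           (Fin.punchIn-punchOut p≢p′) (v (punchOut p≢p′) x)
        sparse : ∀ p → Code {Part p} (λ a b → ∀ x → row (proj₁ (proj₁ a)) i p x ≡ row (proj₁ (proj₁ b)) i p x) (W 1 1 T t)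
        sparse p = words t _ (λ a x → row (proj₁ (proj₁ a)) i p x)
          (λ x → trivial λ {a} {b} → trans (proj₂ a) (sym (proj₂ b)))
          (λ x → trivial λ {a} {b} → trans (proj₂ a) (sym (proj₂ b)))
          λ { ((o , eq) , refl) → proj₂ (from-good o i eq) }

      bad-row : ∀ i → Code (restrict (SameRow i) λ o → bad o i ≡ true) X
      bad-row i = coarsen
        (λ {a} {b} h p x → subst (λ c → adj (proj₁ (proj₁ a)) (z i) c ≡ adj (proj₁ (proj₁ b)) (z i) c)
                                 (y-combine p x) (h (combine p x)))
        (⨂ λ j → bit λ ((G , _) , _) → adj G (z i) (y j))

      rows : Code (λ o o′ → ∀ i → SameRow i o o′) (W F X m K)
      rows = words K SameRow bad good-row bad-row few-bad

      core : Code {Obj} (λ (G , _) (H , _) → ∀ j j′ → adj G (y j) (y j′) ≡ adj H (y j) (y j′)) ((2 ^ q) ^ q)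
      core = ⨂ λ j → ⨂ λ j′ → bit λ (G , _) → adj G (y j) (y j′)

      objects : ∀ {J} → Code {Free (suc r) t m} _≋_ J →
                Code {Obj} (λ (G , _) (H , _) → G ≈ H) ((2 ^ q) ^ q * (W F X m K * J))
      objects c = coarsen (λ {a} {b} → glue {a} {b})
        (core ⊗ rows ⊗ pullback (λ (G , free , _) → induced z G , free-induced z z-injective G free) id c)
        where
        glue : ∀ {a b : Obj} → let G = proj₁ a; H = proj₁ b in
          (∀ j j′ → adj G (y j) (y j′) ≡ adj H (y j) (y j′)) ×
          (∀ i → SameRow i a b) × induced z G ≈ induced z H → G ≈ H
        glue {G , _ , mp} {H , _} (yy , zy , zz) i j with covers (y-injective G mp) i | covers (y-injective G mp) j
        ... | inj₁ (k , refl) | inj₁ (l , refl) = yy k l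
        ... | inj₁ (k , refl) | inj₂ (l , refl) =
          trans (adj-sym G _ _) (trans (zy l _ _) (adj-sym H _ _))
        ... | inj₂ (k , refl) | inj₁ (l , refl) = zy k _ _
        ... | inj₂ (k , refl) | inj₂ (l , refl) = zz k l

    -- The K_r(T) is whichever one comes with the graph. Its number opens the code word, and graphs
    -- with the same number are compared along the decoded map, which they share, rather than along
    -- their own.
    peel : ∀ {J} → Code {Free (suc r) t m} _≋_ J →
           Code _≋ₚ_ ((n ^ T) ^ r * ((2 ^ q) ^ q * (W F X m K * J)))
    peel c = choose _≋ₚ_ (λ (_ , ρ , _) → encode ρ) λ x →
      pullback
        (λ (((G , free) , ρ , h) , eq) → G , free ,
          isMultipartite-≗ G (λ i a → trans (sym (decode-encode ρ i a)) (cong (λ x → decode {n} {T} {r} x i a) eq)) h)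
        {S = λ (G , _) (H , _) → G ≈ H} id (objects (decode {n} {T} {r} x) c)

-- Counting graphs without a large complete multipartite subgraph

module Turan where

  open import Defs using (Graph; adj)
  open import Data.Fin using (Fin; zero; suc; inject≤)
  import Data.Fin.Properties as Fin
  open import Data.Nat
  open import Data.Nat.Properties
  open import Data.Nat.Tactic.RingSolver using (solve-∀)
  open import Data.Product using (Σ; ∃; ∃-syntax; _×_; _,_; proj₁; proj₂)
  open import Function using (_∘_; id)
  open import Relation.Binary.PropositionalEquality using (_≡_; refl; sym; trans; cong; cong₂; subst)
  open import Relation.Nullary using (yes; no; contradiction)

  open Counting
  open Arithmetic
  open Multipartite

  open ≤-Reasoning

  all-graphs : ∀ n (P : Graph n → Set) → Code {∃ P} _≋_ (2 ^ (n * n))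
  all-graphs n P = weaken (≤-reflexive (^-*-assoc 2 n n))
    (⨂ λ i → ⨂ λ j → bit λ (G , _) → adj G i j)

  -- Both bounds allow about (1 - 1/r) n²/2 bits, for r = r′ + 1.  This is generous
  -- for graphs without K_r(T), and sharp for graphs without K_{r+1}(t) up to the
  -- error term n²/2D, with D + 1 in place of D to make it positive.
  PreviousBound : (r′ T : ℕ) → Set
  PreviousBound r′ T = ∃[ C ] ∀ n e → r′ * (n * n) + C ≤ 2 * suc r′ * e →
    Code {Free (suc r′) T n} _≋_ (2 ^ e)

  FreeBound : (r′ t : ℕ) → Set
  FreeBound r′ t = ∀ D → ∃[ C ] ∀ n e → (r′ * suc D + suc r′) * (n * n) + C ≤ 2 * suc r′ * suc D * e →
    Code {Free (2 + r′) t n} _≋_ (2 ^ e)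

  peel : ∀ {r r′ T t β q K n m J} → r ≡ suc r′ → q ≡ r * T → K ≡ (T ^ t) ^ r * t →
         r * (W 1 1 T t * (2 ^ T) ^ r′) ≤ 2 ^ β → n ≡ q + m → Code {Free (suc r) t m} _≋_ J →
         Code {Σ (Free (suc r) t n) (Multipartite r T ∘ proj₁)} (restrict _≋_ _)
              ((n ^ T) ^ r * ((2 ^ q) ^ q * (W (2 ^ β) (2 ^ q) m K * J)))
  peel {β = β} refl refl refl β-bound n≡ c = Peel.peel _ _ _ β β-bound n≡ c

  -- r, q and K are tied by equations rather than defined, so that powers such as
  -- 2 ^ q do not unfold.
  module Recursion (r r′ t T q K β : ℕ) {{_ : NonZero T}} {{_ : NonZero q}}
                   (r≡ : r ≡ suc r′) (q≡ : q ≡ r * T) (K≡ : K ≡ (T ^ t) ^ r * t)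
                   (β-bound : r * (W 1 1 T t * (2 ^ T) ^ r′) ≤ 2 ^ β)
                   (β≥ : r′ * T ≤ β)
                   (C : ℕ) (previous : ∀ n e → r′ * (n * n) + C ≤ 2 * r * e → Code {Free r T n} _≋_ (2 ^ e)) where

    -- n^a collects the polynomial factors of one step, and b the bits independent of n and m. A
    -- step costs (β + 1) m + (q + b + 1) bits; the second summand, over n / q steps and times the
    -- factor 2 q of `Goal`, is the origin of `linear`. In `constant`, one summand pays for
    -- `previous` and the other for all graphs on fewer than q vertices.
    a b linear constant : ℕ
    a = T * r + K
    b = a * a + q * q + q * K
    linear = 2 * (q + b + 1)
    constant = T * (C + 2 * r) + 2 * q * (q * q)

    instance
      2q≢0 : NonZero (2 * q)
      2q≢0 = m*n≢0 2 q

    overhead : ∀ n m J → n ≡ q + m →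
      (n ^ T) ^ r * ((2 ^ q) ^ q * (W (2 ^ β) (2 ^ q) m K * J)) ≤ 2 ^ (β * m + n + b) * J
    overhead n m J n≡ = begin
      (n ^ T) ^ r * ((2 ^ q) ^ q * (W (2 ^ β) (2 ^ q) m K * J))
        ≤⟨ *-monoʳ-≤ ((n ^ T) ^ r) (*-monoʳ-≤ ((2 ^ q) ^ q) (*-monoˡ-≤ J
             (≤-trans (W-poly (2 ^ β) (2 ^ q) m K (m^n>0 2 β) (m^n>0 2 q))
               (*-monoʳ-≤ ((2 ^ β) ^ m) (^-monoˡ-≤ K (*-monoˡ-≤ (2 ^ q) m<n)))))) ⟩
      (n ^ T) ^ r * ((2 ^ q) ^ q * ((2 ^ β) ^ m * (n * 2 ^ q) ^ K * J))
        ≡⟨ cong (λ x → (n ^ T) ^ r * ((2 ^ q) ^ q * ((2 ^ β) ^ m * x * J))) (^-distribʳ-* K n (2 ^ q)) ⟩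
      (n ^ T) ^ r * ((2 ^ q) ^ q * ((2 ^ β) ^ m * (n ^ K * (2 ^ q) ^ K) * J))
        ≡⟨ rearrange ((n ^ T) ^ r) ((2 ^ q) ^ q) ((2 ^ β) ^ m) (n ^ K) ((2 ^ q) ^ K) J ⟩
      (2 ^ β) ^ m * ((n ^ T) ^ r * n ^ K) * ((2 ^ q) ^ q * (2 ^ q) ^ K) * J
        ≤⟨ *-monoˡ-≤ J (2^-product {d = β * m + (a * a + n)} {e = q * q + q * K}
             (2^-product {d = β * m} {e = a * a + n} (2^-power {d = β} m ≤-refl) poly)
             (2^-product {d = q * q} {e = q * K} (2^-power {d = q} q ≤-refl) (2^-power {d = q} K ≤-refl))) ⟩
      2 ^ (β * m + (a * a + n) + (q * q + q * K)) * J
        ≡⟨ cong (λ x → 2 ^ x * J) (exponent (β * m) (a * a) n (q * q) (q * K)) ⟩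
      2 ^ (β * m + n + b) * J ∎
      where
      m<n : suc m ≤ n
      m<n = subst (suc m ≤_) (sym n≡) (m<n+m m (>-nonZero⁻¹ q))
      poly : (n ^ T) ^ r * n ^ K ≤ 2 ^ (a * a + n)
      poly = begin
        (n ^ T) ^ r * n ^ K   ≡⟨ cong (_* n ^ K) (^-*-assoc n T r) ⟩
        n ^ (T * r) * n ^ K   ≡⟨ ^-distribˡ-+-* n (T * r) K ⟨
        n ^ a                 ≤⟨ poly≤exp n a ⟩
        2 ^ (a * a + n)       ∎
      rearrange : ∀ x y z u v J → x * (y * (z * (u * v) * J)) ≡ z * (x * u) * (y * v) * J
      rearrange = solve-∀
      exponent : ∀ x y n z w → x + (y + n) + (z + w) ≡ x + n + (y + z + w)
      exponent = solve-∀

    Goal : ℕ → ℕ → Set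
    Goal n e = suc β * (n * n) + linear * n + constant ≤ 2 * q * e

    base : ∀ n e → n < q → Goal n e → Code {Free (suc r) t n} _≋_ (2 ^ e)
    base n e n<q goal = weaken (^-monoʳ-≤ 2 (≤-trans (*-mono-≤ (<⇒≤ n<q) (<⇒≤ n<q)) q*q≤e)) (all-graphs n _)
      where
      q*q≤e : q * q ≤ e
      q*q≤e = *-cancelˡ-≤ (2 * q) (≤-trans (m≤n+m (2 * q * (q * q)) (T * (C + 2 * r))) (≤-trans (m≤n+m constant (suc β * (n * n) + linear * n)) goal))

    cost : ℕ → ℕ
    cost m = β * m + (q + m) + b

    -- The bound on m = n - q survives paying for one step out of n² - m².
    step-cost : ∀ m e → Goal (q + m) e → 2 * q * suc (cost m) + (suc β * (m * m) + linear * m + constant) ≤ 2 * q * e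
    step-cost m e goal = ≤-trans (≤-trans (m≤m+n _ (suc β * (q * q))) (≤-reflexive (identity q m β b constant))) goal
      where
      identity : ∀ q m β b c →
        2 * q * suc (β * m + (q + m) + b) + (suc β * (m * m) + 2 * (q + b + 1) * m + c) + suc β * (q * q) ≡
        suc β * ((q + m) * (q + m)) + 2 * (q + b + 1) * (q + m) + c
      identity = solve-∀

    -- As r′ T ≤ β, the budget for peeling also covers graphs without K_r(T). The summand 2 r in
    -- `constant` pays for the bit that separates the two cases.
    previous-cost : ∀ n e → Goal n (suc e) → r′ * (n * n) + C ≤ 2 * r * e
    previous-cost n e goal = +-cancelʳ-≤ (2 * r) _ _ (*-cancelˡ-≤ T (begin
      T * (r′ * (n * n) + C + 2 * r)                  ≡⟨ expand T r′ (n * n) C r ⟩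
      r′ * T * (n * n) + T * (C + 2 * r)              ≤⟨ +-mono-≤ (*-monoˡ-≤ (n * n) (≤-trans β≥ (n≤1+n β))) (m≤m+n _ _) ⟩
      suc β * (n * n) + constant                      ≤⟨ +-monoˡ-≤ constant (m≤m+n (suc β * (n * n)) (linear * n)) ⟩
      suc β * (n * n) + linear * n + constant         ≤⟨ goal ⟩
      2 * q * suc e                                   ≡⟨ cong (λ q → 2 * q * suc e) q≡ ⟩
      2 * (r * T) * suc e                             ≡⟨ expand′ T r e ⟩
      T * (2 * r * e + 2 * r)                         ∎))
      where
      expand : ∀ T r′ s C r → T * (r′ * s + C + 2 * r) ≡ r′ * T * s + T * (C + 2 * r)
      expand = solve-∀
      expand′ : ∀ T r e → 2 * (r * T) * suc e ≡ T * (2 * r * e + 2 * r)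
      expand′ = solve-∀

    extend : ∀ m e → Goal (q + m) (suc (cost m + e)) → Code {Free (suc r) t m} _≋_ (2 ^ e) →
             Code {Free (suc r) t (q + m)} _≋_ (2 ^ suc (cost m + e))
    extend m e goal c = weaken (2^-sum {e = cost m + e} ≤-refl size)
      (cases? _≋_ (λ (G , _) → multipartite? r T G) (peel {β = β} r≡ q≡ K≡ β-bound refl c)
        (pullback (λ ((G , _) , free) → G , free) id (previous (q + m) (cost m + e) (previous-cost (q + m) _ goal))))
      where
      size : ((q + m) ^ T) ^ r * ((2 ^ q) ^ q * (W (2 ^ β) (2 ^ q) m K * 2 ^ e)) ≤ 2 ^ (cost m + e)
      size = ≤-trans (overhead (q + m) m (2 ^ e) refl) (≤-reflexive (sym (^-distribˡ-+-* 2 (cost m) e)))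

    bound : ∀ N n e → n ≤ N → Goal n e → Code {Free (suc r) t n} _≋_ (2 ^ e)
    bound N n e n≤N goal with n <? q
    ... | yes n<q = base n e n<q goal
    bound zero n e n≤0 goal | no n≮q = contradiction (≤-<-trans n≤0 (>-nonZero⁻¹ q)) n≮q
    bound (suc N) n e n≤N goal | no n≮q with m≤n⇒∃[o]m+o≡n (≮⇒≥ n≮q)
    ... | m , refl with m≤n⇒∃[o]m+o≡n {suc (cost m)} (*-cancelˡ-≤ (2 * q) (≤-trans (m≤m+n _ _) (step-cost m e goal)))
    ... | e′ , refl = extend m e′ goal (bound N m e′ (s≤s⁻¹ (≤-trans (m<n+m m (>-nonZero⁻¹ q)) n≤N)) goal′)
      where
      goal′ : Goal m e′
      goal′ = +-cancelˡ-≤ (2 * q * suc (cost m)) _ _ (≤-trans (step-cost m (suc (cost m) + e′) goal)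
        (≤-reflexive (*-distribˡ-+ (2 * q) (suc (cost m)) e′)))

  -- T + 1 is a power of two so that (T + 1)^t costs exactly w t bits. The constant c is such that c
  -- (w + 1) covers D (r + w t + 1) + 1, while `linear<exp` keeps c (w + 1) below 2^w.
  part-size : ∀ D r t → ∃[ w ] ∃[ T ] suc T ≡ 2 ^ w × D * suc (r + w * t) + 1 ≤ T
  part-size D r t = 4 * c , 2 ^ (4 * c) ∸ 1 , m+[n∸m]≡n (m^n>0 2 (4 * c)) , ≤-trans (≤-trans (m≤m+n _ _) (≤-reflexive (identity D r t (4 * c))))
    (∸-monoˡ-≤ 1 (linear<exp c))
    where
    c = D * (r + t + 1) + 1
    identity : ∀ D r t w → D * suc (r + w * t) + 1 + (D * (r * w + t + w) + w) ≡ (D * (r + t + 1) + 1) * suc w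
    identity = solve-∀

  module FreeBound′ (r r′ t D w T q : ℕ) {{_ : NonZero T}} {{_ : NonZero D}} {{_ : NonZero q}} {{_ : NonZero r}}
                    (r≡ : r ≡ suc r′) (q≡ : q ≡ r * T) (sucT : suc T ≡ 2 ^ w) (T-large : D * suc (r + w * t) + 1 ≤ T)
                    (C : ℕ) (previous : ∀ n e → r′ * (n * n) + C ≤ 2 * r * e → Code {Free r T n} _≋_ (2 ^ e)) where

    -- The bits of a good row beyond (r - 1) T: r of them, generously, for the choice of the sparse
    -- part and w t for its neighbours.
    ω : ℕ
    ω = r + w * t

    β-bound : r * (W 1 1 T t * (2 ^ T) ^ r′) ≤ 2 ^ (ω + r′ * T)
    β-bound = begin
      r * (W 1 1 T t * (2 ^ T) ^ r′)
        ≤⟨ *-mono-≤ (<⇒≤ (n<2^n r)) (*-mono-≤ sparse (2^-power {a = 2 ^ T} {d = T} r′ ≤-refl)) ⟩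
      2 ^ r * (2 ^ (w * t) * 2 ^ (T * r′))  ≡⟨ *-assoc (2 ^ r) _ _ ⟨
      2 ^ r * 2 ^ (w * t) * 2 ^ (T * r′)    ≤⟨ 2^-product {d = ω} {T * r′} (2^-product {a = 2 ^ r} {b = 2 ^ (w * t)} {d = r} {w * t} ≤-refl ≤-refl) (≤-refl {2 ^ (T * r′)}) ⟩
      2 ^ (ω + T * r′)                      ≡⟨ cong (λ x → 2 ^ (ω + x)) (*-comm T r′) ⟩
      2 ^ (ω + r′ * T)                      ∎
      where
      sparse : W 1 1 T t ≤ 2 ^ (w * t)
      sparse = begin
        W 1 1 T t               ≤⟨ W-poly 1 1 T t ≤-refl ≤-refl ⟩
        1 ^ T * (suc T * 1) ^ t ≡⟨ cong₂ _*_ (^-zeroˡ T) (cong (_^ t) (trans (*-identityʳ (suc T)) sucT)) ⟩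
        1 * (2 ^ w) ^ t         ≡⟨ *-identityˡ _ ⟩
        (2 ^ w) ^ t             ≤⟨ 2^-power {a = 2 ^ w} {d = w} t ≤-refl ⟩
        2 ^ (w * t)             ∎

    open Recursion r r′ t T q ((T ^ t) ^ r * t) (ω + r′ * T) r≡ q≡ refl β-bound (m≤n+m _ ω) C previous public
      using (linear; constant; Goal; bound)

    Const : ℕ
    Const = (D * linear) * (D * linear) + D * constant
    -- The slack in the hypothesis is r n², that is r T n² after multiplication by T. Of T ≥ D (ω +
    -- 1) + 1, the first summand absorbs the excess of β + 1 over (r - 1) T, and the 1 absorbs the
    -- linear term, which `*≤squares` turns into n² and a constant.
    goal : ∀ n e → (r′ * D + r) * (n * n) + Const ≤ 2 * r * D * e → Goal n e
    goal n e h = *-cancelˡ-≤ D (begin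
      D * (suc (ω + r′ * T) * (n * n) + linear * n + constant)
        ≡⟨ expand D ω (r′ * T) (n * n) linear n constant ⟩
      D * suc ω * (n * n) + D * (r′ * T) * (n * n) + n * (D * linear) + D * constant
        ≤⟨ +-monoˡ-≤ (D * constant) (+-monoʳ-≤ (D * suc ω * (n * n) + D * (r′ * T) * (n * n)) (*≤squares n (D * linear))) ⟩
      D * suc ω * (n * n) + D * (r′ * T) * (n * n) + (n * n + (D * linear) * (D * linear)) + D * constant
        ≡⟨ collect (D * suc ω) (D * (r′ * T)) (n * n) ((D * linear) * (D * linear)) (D * constant) ⟩
      (D * suc ω + 1) * (n * n) + D * (r′ * T) * (n * n) + Const
        ≤⟨ +-mono-≤ (+-monoˡ-≤ (D * (r′ * T) * (n * n)) (*-monoˡ-≤ (n * n) (≤-trans T-large (m≤n*m T r)))) (m≤n*m Const T) ⟩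
      r * T * (n * n) + D * (r′ * T) * (n * n) + T * Const
        ≡⟨ factor r T (n * n) D r′ Const ⟩
      T * ((r′ * D + r) * (n * n) + Const)  ≤⟨ *-monoʳ-≤ T h ⟩
      T * (2 * r * D * e)                   ≡⟨ reorder T r D e ⟩
      D * (2 * (r * T) * e)                 ≡⟨ cong (λ q → D * (2 * q * e)) q≡ ⟨
      D * (2 * q * e)                       ∎)
      where
      expand : ∀ D ω x s l n k → D * (suc (ω + x) * s + l * n + k) ≡ D * suc ω * s + D * x * s + n * (D * l) + D * k
      expand = solve-∀
      collect : ∀ a b s x y → a * s + b * s + (s + x) + y ≡ (a + 1) * s + b * s + (x + y)
      collect = solve-∀
      factor : ∀ r T s D r′ k → r * T * s + D * (r′ * T) * s + T * k ≡ T * ((r′ * D + r) * s + k)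
      factor = solve-∀
      reorder : ∀ T r D e → T * (2 * r * D * e) ≡ D * (2 * (r * T) * e)
      reorder = solve-∀

    result : ∃[ C ] ∀ n e → (r′ * D + r) * (n * n) + C ≤ 2 * r * D * e → Code {Free (suc r) t n} _≋_ (2 ^ e)
    result = Const , λ n e h → bound n n e ≤-refl (goal n e h)

  free-bound : ∀ r′ → (∀ T → PreviousBound r′ T) → ∀ t → FreeBound r′ t
  free-bound r′ previous t D′ = finish (part-size (suc D′) (suc r′) t)
    where
    r D : ℕ
    r = suc r′
    D = suc D′
    finish : (∃[ w ] ∃[ T ] suc T ≡ 2 ^ w × D * suc (r + w * t) + 1 ≤ T) →
      ∃[ C ] ∀ n e → (r′ * D + r) * (n * n) + C ≤ 2 * r * D * e → Code {Free (suc r) t n} _≋_ (2 ^ e)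
    finish (w , T , sucT , T-large) = FreeBound′.result r r′ t D w T (r * T) {{T≢0}} {{_}} {{m*n≢0 r T {{_}} {{T≢0}}}}
      refl refl sucT T-large (proj₁ (previous T)) (proj₂ (previous T))
      where
      T≢0 : NonZero T
      T≢0 = >-nonZero (≤-trans (m≤n+m 1 (D * suc (r + w * t))) T-large)

  -- 1 - 1/r + 1/r(r+1) = 1 - 1/(r+1).
  rescale : ∀ r r′ D s C e → r ≡ suc r′ → D ≡ r * suc r → r * s + C ≤ 2 * suc r * e →
            (r′ * D + r) * s + C ≤ 2 * r * D * e
  rescale r r′ D s C e refl refl h = begin
    (r′ * (r * suc r) + r) * s + C      ≡⟨ cong (_+ C) (square r′ s) ⟩
    r * r * (r * s) + C                 ≤⟨ +-monoʳ-≤ (r * r * (r * s)) (m≤n*m C (r * r)) ⟩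
    r * r * (r * s) + r * r * C         ≡⟨ *-distribˡ-+ (r * r) (r * s) C ⟨
    r * r * (r * s + C)                 ≤⟨ *-monoʳ-≤ (r * r) h ⟩
    r * r * (2 * suc r * e)             ≡⟨ reorder r (suc r) e ⟩
    2 * r * (r * suc r) * e             ∎
    where
    square : ∀ r′ s → (r′ * (suc r′ * suc (suc r′)) + suc r′) * s ≡ suc r′ * suc r′ * (suc r′ * s)
    square = solve-∀
    reorder : ∀ r q e → r * r * (2 * q * e) ≡ 2 * r * (r * q) * e
    reorder = solve-∀

  -- Induction on the number of parts: the sharp bound at one stage is generous at the next. At the
  -- start, a graph without K_1(T) has fewer than T vertices.
  previous-bound : ∀ r′ T → PreviousBound r′ T
  previous-bound zero T = 2 * (T * T) , bound
    where
    bound : ∀ n e → 0 + 2 * (T * T) ≤ 2 * 1 * e → Code {Free 1 T n} _≋_ (2 ^ e)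
    bound n e h with T ≤? n
    ... | yes T≤n = weaken z≤n (empty λ (G , free) → free
      ((λ _ a → inject≤ a T≤n) , (λ _ e → Fin.inject≤-injective T≤n T≤n _ _ e) ,
       λ { zero zero 0≢0 → contradiction refl 0≢0 }))
    ... | no T≰n = weaken (^-monoʳ-≤ 2 (≤-trans (*-mono-≤ n≤T n≤T) T*T≤e)) (all-graphs n _)
      where
      n≤T : n ≤ T
      n≤T = <⇒≤ (≰⇒> T≰n)
      T*T≤e : T * T ≤ e
      T*T≤e = *-cancelˡ-≤ 2 h
  previous-bound (suc r′) T =
    -- The last argument is D - 1 for D = (r′ + 1) (r′ + 2), the value that `rescale` expects.
    let C , bound = free-bound r′ (previous-bound r′) T (r′ * suc (suc r′) + suc r′)
    in C , λ n e h → bound n e (rescale (suc r′) r′ _ (n * n) C e refl (cong suc (+-comm _ (suc r′))) h)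

-- Congruences and lines modulo b

module Modular where

  open import Data.Fin using (Fin; toℕ)
  import Data.Fin.Properties as Fin
  open import Data.Nat
  open import Data.Nat.DivMod
  open import Data.Nat.Properties
  open import Data.Nat.Tactic.RingSolver using (solve-∀)
  open import Data.Product using (∃-syntax; _×_; _,_)
  open import Relation.Binary.PropositionalEquality using (_≡_; sym; trans; cong; cong₂; module ≡-Reasoning)

  toℕ-mod : ∀ a b .{{_ : NonZero b}} → toℕ (a mod b) ≡ a % b
  toℕ-mod a b = Fin.toℕ-fromℕ< (m%n<n a b)

  mod-cong : ∀ a c k l b .{{_ : NonZero b}} → a + k * b ≡ c + l * b → a mod b ≡ c mod b
  mod-cong a c k l b e = Fin.toℕ-injective (begin
    toℕ (a mod b)     ≡⟨ toℕ-mod a b ⟩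
    a % b             ≡⟨ [m+kn]%n≡m%n a k b ⟨
    (a + k * b) % b   ≡⟨ cong (_% b) e ⟩
    (c + l * b) % b   ≡⟨ [m+kn]%n≡m%n c l b ⟩
    c % b             ≡⟨ toℕ-mod c b ⟨
    toℕ (c mod b)     ∎)
    where open ≡-Reasoning

  mod-toℕ : ∀ {b} .{{_ : NonZero b}} (x : Fin b) → toℕ x mod b ≡ x
  mod-toℕ {b} x = Fin.toℕ-injective (trans (toℕ-mod (toℕ x) b) (m<n⇒m%n≡m (Fin.toℕ<n x)))

  mod-quotient : ∀ a b .{{_ : NonZero b}} → a ≡ toℕ (a mod b) + (a / b) * b
  mod-quotient a b = trans (m≡m%n+[m/n]*n a b) (cong (_+ (a / b) * b) (sym (toℕ-mod a b)))

  shift-injective : ∀ {b} .{{_ : NonZero b}} c (x y : Fin b) →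
                    (toℕ x + c) mod b ≡ (toℕ y + c) mod b → x ≡ y
  shift-injective {b} c x y e = begin
    x             ≡⟨ mod-toℕ x ⟨
    toℕ x mod b   ≡⟨ mod-cong (toℕ x) (toℕ y) l k b (+-cancelˡ-≡ c _ _ shifted) ⟩
    toℕ y mod b   ≡⟨ mod-toℕ y ⟩
    y             ∎
    where
    open ≡-Reasoning
    k = (toℕ x + c) / b
    l = (toℕ y + c) / b
    swap : ∀ p k l b → p + k * b + l * b ≡ p + l * b + k * b
    swap = solve-∀
    move : ∀ x c z → c + (x + z) ≡ x + c + z
    move = solve-∀
    shifted : c + (toℕ x + l * b) ≡ c + (toℕ y + k * b)
    shifted = begin
      c + (toℕ x + l * b)                       ≡⟨ move (toℕ x) c (l * b) ⟩
      toℕ x + c + l * b                         ≡⟨ cong (_+ l * b) (mod-quotient (toℕ x + c) b) ⟩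
      toℕ ((toℕ x + c) mod b) + k * b + l * b   ≡⟨ cong (λ p → toℕ p + k * b + l * b) e ⟩
      toℕ ((toℕ y + c) mod b) + k * b + l * b   ≡⟨ swap (toℕ ((toℕ y + c) mod b)) k l b ⟩
      toℕ ((toℕ y + c) mod b) + l * b + k * b   ≡⟨ cong (_+ k * b) (mod-quotient (toℕ y + c) b) ⟨
      toℕ y + c + k * b                         ≡⟨ move (toℕ y) c (k * b) ⟨
      c + (toℕ y + k * b)                       ∎

  -- Two points of a line s + α i + β determine it when the difference d of
  -- their abscissas has an inverse g modulo b.
  interpolate : ∀ {b} .{{_ : NonZero b}} i d g h → d * g ≡ 1 + h * b → (s s′ u w : Fin b) →
    ∃[ α ] ∃[ β ] (toℕ s + (toℕ {b} α * i + toℕ {b} β)) mod b ≡ u ×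
                  (toℕ s′ + (toℕ α * (i + d) + toℕ β)) mod b ≡ w
  interpolate {b} i d g h dg s s′ u w = A mod b , B mod b ,
    trans (mod-cong _ (toℕ u) l (1 + i) b first) (mod-toℕ u) ,
    trans (mod-cong _ (toℕ w) (l + k * d) (3 + h * δ + i) b second) (mod-toℕ w)
    where
    open ≡-Reasoning
    neg : Fin b → ℕ
    neg x = b ∸ toℕ x
    neg-≡ : ∀ x → toℕ x + neg x ≡ b
    neg-≡ x = m+[n∸m]≡n (Fin.toℕ≤n x)
    -- Modulo b the solution is α = g (w - s′ - u + s) and β = u - s - α i, with `neg` for the
    -- subtractions; k and l are the quotients dropped by the reductions.
    δ A k α B l β : ℕ
    δ = toℕ w + neg s′ + neg u + toℕ s
    A = g * δ
    k = A / b
    α = toℕ (A mod b)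
    B = toℕ u + neg s + neg (A mod b) * i
    l = B / b
    β = toℕ (B mod b)
    first : toℕ s + (α * i + β) + l * b ≡ toℕ u + (1 + i) * b
    first = begin
      toℕ s + (α * i + β) + l * b         ≡⟨ regroup (toℕ s) (α * i) β (l * b) ⟩
      toℕ s + α * i + (β + l * b)         ≡⟨ cong (toℕ s + α * i +_) (mod-quotient B b) ⟨
      toℕ s + α * i + B                   ≡⟨ collect (toℕ s) α i (toℕ u) (neg s) (neg (A mod b)) ⟩
      toℕ u + (toℕ s + neg s) + (α + neg (A mod b)) * i
                                          ≡⟨ cong₂ (λ x y → toℕ u + x + y * i) (neg-≡ s) (neg-≡ (A mod b)) ⟩
      toℕ u + b + b * i                   ≡⟨ final (toℕ u) b i ⟩
      toℕ u + (1 + i) * b                 ∎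
      where
      regroup : ∀ s a β x → s + (a + β) + x ≡ s + a + (β + x)
      regroup = solve-∀
      collect : ∀ s α i u s⁻ α⁻ → s + α * i + (u + s⁻ + α⁻ * i) ≡ u + (s + s⁻) + (α + α⁻) * i
      collect = solve-∀
      final : ∀ u b i → u + b + b * i ≡ u + (1 + i) * b
      final = solve-∀
    second : toℕ s′ + (α * (i + d) + β) + (l + k * d) * b ≡ toℕ w + (3 + h * δ + i) * b
    second = begin
      toℕ s′ + (α * (i + d) + β) + (l + k * d) * b
        ≡⟨ regroup (toℕ s′) α i d β l k b ⟩
      toℕ s′ + α * i + (α + k * b) * d + (β + l * b)
        ≡⟨ cong₂ (λ x y → toℕ s′ + α * i + x * d + y) (mod-quotient A b) (mod-quotient B b) ⟨
      toℕ s′ + α * i + A * d + B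
        ≡⟨ expose (toℕ s′) α i d g δ (toℕ u) (neg s) (neg (A mod b)) ⟩
      toℕ s′ + (d * g) * δ + toℕ u + neg s + (α + neg (A mod b)) * i
        ≡⟨ cong₂ (λ x y → toℕ s′ + x * δ + toℕ u + neg s + y * i) dg (neg-≡ (A mod b)) ⟩
      toℕ s′ + (1 + h * b) * δ + toℕ u + neg s + b * i
        ≡⟨ pair (toℕ s) (toℕ s′) (toℕ u) (toℕ w) (neg s) (neg s′) (neg u) h b i ⟩
      toℕ w + (toℕ s + neg s) + (toℕ s′ + neg s′) + (toℕ u + neg u) + (h * δ + i) * b
        ≡⟨ cong₂ (λ x y → toℕ w + x + y + (toℕ u + neg u) + (h * δ + i) * b) (neg-≡ s) (neg-≡ s′) ⟩
      toℕ w + b + b + (toℕ u + neg u) + (h * δ + i) * b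
        ≡⟨ cong (λ x → toℕ w + b + b + x + (h * δ + i) * b) (neg-≡ u) ⟩
      toℕ w + b + b + b + (h * δ + i) * b
        ≡⟨ final (toℕ w) b (h * δ) i ⟩
      toℕ w + (3 + h * δ + i) * b         ∎
      where
      regroup : ∀ s α i d β l k b → s + (α * (i + d) + β) + (l + k * d) * b ≡ s + α * i + (α + k * b) * d + (β + l * b)
      regroup = solve-∀
      expose : ∀ s′ α i d g δ u s⁻ α⁻ → s′ + α * i + (g * δ) * d + (u + s⁻ + α⁻ * i) ≡ s′ + (d * g) * δ + u + s⁻ + (α + α⁻) * i
      expose = solve-∀
      pair : ∀ s s′ u w s⁻ s′⁻ u⁻ h b i → let δ = w + s′⁻ + u⁻ + s in
             s′ + (1 + h * b) * δ + u + s⁻ + b * i ≡ w + (s + s⁻) + (s′ + s′⁻) + (u + u⁻) + (h * δ + i) * b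
      pair = solve-∀
      final : ∀ w b x i → w + b + b + b + (x + i) * b ≡ w + (3 + x + i) * b
      final = solve-∀

-- Decomposition into cliques along lines

module Design where

  open import Defs using (Graph; adj; adj-sym; _≈_)
  open import Data.Bool using (Bool; true)
  import Data.Bool.Properties as Bool
  open import Data.Fin using (Fin; zero; suc; toℕ; combine; remQuot; splitAt; _↑ˡ_; _↑ʳ_; finToFun; funToFin)
  import Data.Fin.Properties as Fin
  open import Data.Nat
  open import Data.Nat.Divisibility using (divides; m≤n⇒m!∣n!; m∣m*n; ∣-trans)
  open import Data.Nat.DivMod
  open import Data.Nat.Properties
  open import Data.Nat.Tactic.RingSolver using (solve-∀)
  open import Data.Product using (Σ; ∃; ∃-syntax; _×_; _,_; proj₁; proj₂; uncurry)
  open import Data.Sum using (_⊎_; inj₁; inj₂)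
  open import Function using (_∘_; id)
  open import Function.Definitions using (Injective)
  open import Relation.Binary.Definitions using (tri<; tri≈; tri>)
  open import Relation.Binary.PropositionalEquality using (_≡_; _≢_; refl; sym; trans; cong; cong₂; subst; module ≡-Reasoning)
  open import Relation.Nullary using (¬_; Dec; yes; no; does; contradiction)
  open import Relation.Nullary.Decidable using (_→-dec_; _×-dec_; dec-true)

  open Counting
  open Multipartite
  open Modular

  private
    variable
      n m v : ℕ

  funToFin-cong : (f g : Fin m → Fin n) → (∀ i → f i ≡ g i) → funToFin f ≡ funToFin g
  funToFin-cong {zero}  f g eq = refl
  funToFin-cong {suc m} f g eq = cong₂ combine (eq zero) (funToFin-cong (f ∘ suc) (g ∘ suc) (eq ∘ suc))

  finToFun-injective : ∀ {n m} (x y : Fin (n ^ m)) → (∀ i → finToFun {n} {m} x i ≡ finToFun y i) → x ≡ y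
  finToFun-injective {n} {m} x y eq = begin
    x                               ≡⟨ Fin.funToFin-finToFin {m} {n} x ⟨
    funToFin (finToFun {n} {m} x)   ≡⟨ funToFin-cong (finToFun {n} {m} x) (finToFun y) eq ⟩
    funToFin (finToFun {n} {m} y)   ≡⟨ Fin.funToFin-finToFin {m} {n} y ⟩
    y                               ∎
    where open ≡-Reasoning

  Homomorphism : Graph v → Graph n → (Fin v → Fin n) → Set
  Homomorphism L G φ = ∀ a c → adj L a c ≡ true → adj G (φ a) (φ c) ≡ true

  homomorphism? : (L : Graph v) (G : Graph n) (φ : Fin v → Fin n) → Dec (Homomorphism L G φ)
  homomorphism? L G φ = Fin.all? λ a → Fin.all? λ c →
    (adj L a c Bool.≟ true) →-dec (adj G (φ a) (φ c) Bool.≟ true)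

  homomorphism-≗ : (L : Graph v) (G : Graph n) {φ χ : Fin v → Fin n} → (∀ a → φ a ≡ χ a) →
                   Homomorphism L G φ → Homomorphism L G χ
  homomorphism-≗ L G eq h a c l = trans (sym (cong₂ (adj G) (eq a) (eq c))) (h a c l)

  injective-≗ : {φ χ : Fin v → Fin n} → (∀ a → φ a ≡ χ a) → Injective _≡_ _≡_ φ → Injective _≡_ _≡_ χ
  injective-≗ eq inj e = inj (trans (eq _) (trans e (sym (eq _))))

  -- The embedding is given by its number, so that it can be searched for.
  Contains : Graph v → Graph n → Set
  Contains {v} {n} L G = ∃[ x ] Injective _≡_ _≡_ (finToFun {n} {v} x) × Homomorphism L G (finToFun {n} {v} x)

  contains? : (L : Graph v) (G : Graph n) → Dec (Contains L G)
  contains? {v} {n} L G = Fin.any? λ x → injective? (finToFun {n} {v} x) ×-dec homomorphism? L G (finToFun x)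

  contains : (L : Graph v) (G : Graph n) (φ : Fin v → Fin n) → Injective _≡_ _≡_ φ → Homomorphism L G φ → Contains L G
  contains L G φ inj h = funToFin φ , injective-≗ eq inj , homomorphism-≗ L G eq h
    where
    eq : ∀ a → φ a ≡ finToFun (funToFin φ) a
    eq a = sym (Fin.finToFun-funToFin φ a)

  -- As d divides m!, it divides b + 1, and the quotient inverts d modulo b. Tying b + 1 to m! thus
  -- makes all inverses explicit.
  inverse : ∀ m t b → suc b ≡ t * m ! → ∀ d → 1 ≤ d → d ≤ m → ∃[ g ] d * g ≡ 1 + 1 * b
  inverse m t b b≡ (suc d) _ d≤m with ∣-trans (m∣m*n (d !)) (m≤n⇒m!∣n! d≤m)
  ... | divides g eq = g * t , (begin
    suc d * (g * t)   ≡⟨ reorder (suc d) g t ⟩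
    t * (g * suc d)   ≡⟨ cong (t *_) eq ⟨
    t * m !           ≡⟨ b≡ ⟨
    suc b             ≡⟨ cong suc (*-identityˡ b) ⟨
    1 + 1 * b         ∎)
    where
    open ≡-Reasoning
    reorder : ∀ d g t → d * (g * t) ≡ t * (g * d)
    reorder = solve-∀

  -- The vertices outside the last l ones form m groups of size b. For each
  -- shift s, the b² lines i ↦ s i + α i + β decompose the complete m-partite graph
  -- on the groups into copies of K_m.
  module Lines (m b l t : ℕ) {{_ : NonZero b}} (b≡ : suc b ≡ t * m !) where

    vtx : Fin m → Fin b → Fin (m * b + l)
    vtx i x = combine i x ↑ˡ l

    rest : Fin l → Fin (m * b + l)
    rest j = (m * b) ↑ʳ j

    vtx-injective : ∀ i x j y → vtx i x ≡ vtx j y → i ≡ j × x ≡ y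
    vtx-injective i x j y e = Fin.combine-injective i x j y (Fin.↑ˡ-injective l _ _ e)

    vertex : ∀ u → (∃[ i ] ∃[ x ] vtx i x ≡ u) ⊎ (∃[ j ] rest j ≡ u)
    vertex u with splitAt (m * b) u in eq
    ... | inj₁ p = inj₁ (proj₁ (remQuot {m} b p) , proj₂ (remQuot {m} b p) ,
      trans (cong (_↑ˡ l) (Fin.combine-remQuot {m} b p)) (Fin.splitAt⁻¹-↑ˡ eq))
    ... | inj₂ j = inj₂ (j , Fin.splitAt⁻¹-↑ʳ eq)

    slope : Fin (b * b) → ℕ → ℕ
    slope γ i = toℕ (proj₁ (remQuot {b} b γ)) * i + toℕ (proj₂ (remQuot {b} b γ))

    line : Fin (b ^ m) → Fin (b * b) → Fin m → Fin b
    line s γ i = (toℕ (finToFun {b} {m} s i) + slope γ (toℕ i)) mod b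

    -- This drives the averaging: once γ is fixed, prescribing a line on v groups leaves at most
    -- b^(m - v) shifts.
    line-injective : ∀ s s′ γ → (∀ i → line s γ i ≡ line s′ γ i) → s ≡ s′
    line-injective s s′ γ eq = finToFun-injective {b} {m} s s′ λ i → shift-injective (slope γ (toℕ i)) _ _ (eq i)

    line-through-< : ∀ s i j → toℕ i < toℕ j → ∀ x y → ∃[ γ ] line s γ i ≡ x × line s γ j ≡ y
    line-through-< s i j i<j x y =
      let g , dg = inverse m t b b≡ (toℕ j ∸ toℕ i) (m<n⇒0<n∸m i<j) (≤-trans (m∸n≤m (toℕ j) (toℕ i)) (Fin.toℕ≤n j))
          α , β , p , q = interpolate (toℕ i) (toℕ j ∸ toℕ i) g 1 dg (finToFun s i) (finToFun s j) x y
          eq = Fin.remQuot-combine {b} {b} α β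
      in combine α β ,
         trans (cong (λ γ → (toℕ (finToFun s i) + (toℕ (proj₁ γ) * toℕ i + toℕ (proj₂ γ))) mod b) eq) p ,
         trans (cong (λ γ → (toℕ (finToFun s j) + (toℕ (proj₁ γ) * toℕ j + toℕ (proj₂ γ))) mod b) eq)
               (trans (cong (λ k → (toℕ (finToFun s j) + (toℕ α * k + toℕ β)) mod b) (sym (m+[n∸m]≡n (<⇒≤ i<j)))) q)

    line-through : ∀ s i j → i ≢ j → ∀ x y → ∃[ γ ] line s γ i ≡ x × line s γ j ≡ y
    line-through s i j i≢j x y with <-cmp (toℕ i) (toℕ j)
    ... | tri≈ _ e _   = contradiction (Fin.toℕ-injective e) i≢j
    ... | tri< i<j _ _ = line-through-< s i j i<j x y
    ... | tri> _ _ j<i = let γ , p , q = line-through-< s j i j<i y x in γ , q , p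

  -- The left side is the number of pairs of a shift and one of B + 1 bad lines. On the right, m^v
  -- counts the groups of a copy of L on the line, b² the lines, and K b^m′ the shifts that remain.
  -- After multiplication by m², the right side is at most b^m b² and the left side exceeds it.
  too-many-bad : ∀ m v m′ b K → {{_ : NonZero b}} {{_ : NonZero (m * m)}} → m ≡ v + m′ → K * m ^ (v + 2) ≤ b ^ v →
                 ¬ (b ^ m * suc ((b * b) / (m * m)) ≤ m ^ v * (b * b * (K * b ^ m′)))
  too-many-bad m v m′ b K m≡ K-small h = <⇒≱ beyond (*-cancelˡ-≤ (b ^ m) {{m^n≢0 b m}} (begin
    b ^ m * (suc Q * (m * m))                   ≡⟨ *-assoc (b ^ m) (suc Q) (m * m) ⟨
    b ^ m * suc Q * (m * m)                     ≤⟨ *-monoˡ-≤ (m * m) h ⟩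
    m ^ v * (b * b * (K * b ^ m′)) * (m * m)    ≡⟨ reorder (m ^ v) (b * b) K (b ^ m′) m ⟩
    K * (m ^ v * m ^ 2) * (b ^ m′ * (b * b))    ≡⟨ cong (λ x → K * x * (b ^ m′ * (b * b))) (^-distribˡ-+-* m v 2) ⟨
    K * m ^ (v + 2) * (b ^ m′ * (b * b))        ≤⟨ *-monoˡ-≤ _ K-small ⟩
    b ^ v * (b ^ m′ * (b * b))                  ≡⟨ *-assoc (b ^ v) (b ^ m′) (b * b) ⟨
    b ^ v * b ^ m′ * (b * b)                    ≡⟨ cong (_* (b * b)) (trans (sym (^-distribˡ-+-* b v m′)) (cong (b ^_) (sym m≡))) ⟩
    b ^ m * (b * b)                             ∎))
    where
    open ≤-Reasoning
    Q = (b * b) / (m * m)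
    beyond : b * b < suc Q * (m * m)
    beyond = begin-strict
      b * b                               ≡⟨ m≡m%n+[m/n]*n (b * b) (m * m) ⟩
      (b * b) % (m * m) + Q * (m * m)     <⟨ +-monoˡ-< (Q * (m * m)) (m%n<n (b * b) (m * m)) ⟩
      suc Q * (m * m)                     ∎
    reorder : ∀ x y K z m → x * (y * (K * z)) * (m * m) ≡ K * (x * (m * (m * 1))) * (z * y)
    reorder = solve-∀

  module Poor {v : ℕ} (L : Graph v) (m m′ b l t K : ℕ) {{_ : NonZero b}} {{_ : NonZero (m * m)}}
              (m≡ : m ≡ v + m′) (b≡ : suc b ≡ t * m !) (K-small : K * m ^ (v + 2) ≤ b ^ v) where

    open Lines m b l t b≡ public

    N B : ℕ
    N = m * b + l
    B = (b * b) / (m * m)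

    place : Fin (m ^ v) → Fin (b ^ v) → Fin v → Fin N
    place x y a = vtx (finToFun {m} {v} x a) (finToFun {b} {v} y a)

    placed : Graph N → Fin (m ^ v) → Fin (b ^ v) → Bool
    placed G x y = does (homomorphism? L G (place x y))

    -- Only copies with their vertices in distinct groups can lie on lines. For injective x,
    -- different y even give copies with different vertex sets, since the group of a vertex tells
    -- which vertex of L it represents; so K + 1 maps are K + 1 copies.
    IsPoor : Graph N → Set
    IsPoor G = ∀ x → Injective _≡_ _≡_ (finToFun {m} {v} x) → count (placed G x) ≤ K

    poor? : ∀ G → IsPoor G ⊎ ∃[ x ] Injective _≡_ _≡_ (finToFun {m} {v} x) × suc K ≤ count (placed G x)
    poor? G with Fin.any? (λ x → injective? (finToFun {m} {v} x) ×-dec (suc K ≤? count (placed G x)))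
    ... | yes rich = inj₂ rich
    ... | no ¬rich = inj₁ λ x inj → s≤s⁻¹ (≰⇒> λ h → ¬rich (x , inj , h))

    clique : Graph N → Fin (b ^ m) → Fin (b * b) → Graph m
    clique G s γ = induced (λ i → vtx i (line s γ i)) G

    bad : Graph N → Fin (b ^ m) → Fin (b * b) → Bool
    bad G s γ = does (contains? L (clique G s γ))

    Pos : Set
    Pos = Fin (b ^ m) × Fin (suc B)

    module Averaging (G : Graph N) (poor : IsPoor G) (γ : Pos → Fin (b * b))
                     (γ-injective : ∀ s {k k′} → γ (s , k) ≡ γ (s , k′) → k ≡ k′)
                     (x : Pos → Fin (m ^ v))
                     (x-injective : ∀ p → Injective _≡_ _≡_ (finToFun {m} {v} (x p)))
                     (x-hom : ∀ p → Homomorphism L (clique G (proj₁ p) (γ p)) (finToFun {m} {v} (x p))) where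

      At : Fin (m ^ v) → Fin (b * b) → Set
      At x₀ γ₀ = Σ (∃ λ p → x p ≡ x₀) λ (p , _) → γ p ≡ γ₀

      same : ∀ s k s′ k′ → s ≡ s′ → γ (s , k) ≡ γ (s′ , k′) → (s , k) ≡ (s′ , k′)
      same s k _ k′ refl e = cong (s ,_) (γ-injective s e)

      -- On the groups of ψ the line carries one of at most K placed copies of L. With its m′ other
      -- values this gives the whole line, hence the shift, and then γ₀ determines k.
      at : ∀ x₀ γ₀ → Code {At x₀ γ₀} (restrict (restrict _≡_ _) _) (K * b ^ m′)
      at x₀ γ₀ with injective? (finToFun {m} {v} x₀)
      ... | no ¬inj = weaken z≤n (empty λ ((p , x≡) , _) → ¬inj (subst (λ x → Injective _≡_ _≡_ (finToFun {m} {v} x)) x≡ (x-injective p)))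
      ... | yes inj = coarsen (λ {a} {a′} → glue {a} {a′}) (inside ⊗ ⨂ λ i → letter λ ((p , _) , _) → line (proj₁ p) γ₀ (z i))
        where
        ψ : Fin v → Fin m
        ψ = finToFun x₀
        z = proj₁ (complement m≡ ψ)
        cover = proj₂ (proj₂ (complement m≡ ψ)) inj
        y : At x₀ γ₀ → Fin (b ^ v)
        y (((s , _) , _) , _) = funToFin (λ a → line s γ₀ (ψ a))
        good : ∀ o → Homomorphism L G (place x₀ (y o))
        good ((p , x≡) , γ≡) = homomorphism-≗ L G (λ a → cong₂ vtx (cong (λ x → finToFun x a) x≡)
          (trans (cong₂ (λ x g → line (proj₁ p) g (finToFun x a)) x≡ γ≡) (sym (Fin.finToFun-funToFin (λ a → line (proj₁ p) γ₀ (ψ a)) a)))) (x-hom p)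
        inside : Code {At x₀ γ₀} (λ o o′ → y o ≡ y o′) K
        inside = weaken (poor x₀ inj) (pullback (λ o → y o , dec-true (homomorphism? L G (place x₀ (y o))) (good o)) id (rank (placed G x₀)))
        glue : ∀ {o o′ : At x₀ γ₀} → y o ≡ y o′ ×
          (∀ i → line (proj₁ (proj₁ (proj₁ o))) γ₀ (z i) ≡ line (proj₁ (proj₁ (proj₁ o′))) γ₀ (z i)) →
          proj₁ (proj₁ o) ≡ proj₁ (proj₁ o′)
        glue {((s , k) , _) , γ≡} {((s′ , k′) , _) , γ≡′} (ye , ze) =
          same s k s′ k′ (line-injective s s′ γ₀ on) (trans γ≡ (sym γ≡′))
          where
          on : ∀ i → line s γ₀ i ≡ line s′ γ₀ i
          on i with cover i
          ... | inj₂ (j , refl) = ze j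
          ... | inj₁ (a , refl) = trans (sym (Fin.finToFun-funToFin (λ a → line s γ₀ (ψ a)) a)) (trans (cong (λ y → finToFun {b} {v} y a) ye) (Fin.finToFun-funToFin (λ a → line s′ γ₀ (ψ a)) a))

      positions : Code {Pos} _≡_ (m ^ v * (b * b * (K * b ^ m′)))
      positions = choose _≡_ x λ x₀ → choose _ (λ (p , _) → γ p) λ γ₀ → at x₀ γ₀

      absurd : ∀ {A : Set} → A
      absurd = contradiction (Code⇒≤ (pullback (remQuot {b ^ m} (suc B)) unpair positions))
        (too-many-bad m v m′ b K m≡ K-small)
        where
        unpair : ∀ {i j} → remQuot {b ^ m} (suc B) i ≡ remQuot (suc B) j → i ≡ j
        unpair {i} {j} e = trans (sym (Fin.combine-remQuot {b ^ m} (suc B) i))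
          (trans (cong (uncurry combine) e) (Fin.combine-remQuot {b ^ m} (suc B) j))

    not-all-bad : ∀ G → IsPoor G → ¬ (∀ s → suc B ≤ count (bad G s))
    not-all-bad G poor many = Averaging.absurd G poor γ (λ s → proj₁ (proj₂ (pick≤ (bad G s) (many s))))
      (λ p → proj₁ (found p)) (λ p → proj₁ (proj₂ (found p))) (λ p → proj₂ (proj₂ (found p)))
      where
      γ : Pos → Fin (b * b)
      γ (s , k) = proj₁ (pick≤ (bad G s) (many s)) k
      found : ∀ p → Contains L (clique G (proj₁ p) (γ p))
      found p@(s , k) = dec-true⁻ (contains? L (clique G s (γ p))) (proj₂ (proj₂ (pick≤ (bad G s) (many s))) k)

    good-shift : ∀ G → IsPoor G → ∃[ s ] count (bad G s) ≤ B
    good-shift G poor with Fin.any? (λ s → count (bad G s) ≤? B)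
    ... | yes found = found
    ... | no ¬found = contradiction (λ s → ≰⇒> λ h → ¬found (s , h)) (not-all-bad G poor)

    module Decompose (shift : ∀ G → IsPoor G → ∃[ s ] count (bad G s) ≤ B) {F : ℕ} (free : Code {Σ (Graph m) λ H → ¬ Contains L H} _≋_ F) where

      X : ℕ
      X = (2 ^ m) ^ m

      -- No pair is missed: by `line-through`, two vertices of different groups lie on a common
      -- line; other pairs lie inside a group or meet the last l vertices.
      shifted : ∀ s → Code {∃ λ (o : ∃ IsPoor) → proj₁ (shift (proj₁ o) (proj₂ o)) ≡ s} (restrict _≋_ _)
                           (W F X (b * b) B * (((2 ^ b) ^ b) ^ m * (2 ^ N) ^ l))
      shifted s = coarsen (λ {o} {o′} → glue {o} {o′}) (lines ⊗ groups ⊗ ⨂ λ j → ⨂ λ u → bit λ o → adj (graph o) (rest j) u)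
        where
        Obj : Set
        Obj = ∃ λ (o : ∃ IsPoor) → proj₁ (shift (proj₁ o) (proj₂ o)) ≡ s
        graph : Obj → Graph N
        graph ((G , _) , _) = G
        lines : Code {Obj} (λ o o′ → ∀ γ → clique (graph o) s γ ≈ clique (graph o′) s γ) (W F X (b * b) B)
        lines = words B (λ γ o o′ → clique (graph o) s γ ≈ clique (graph o′) s γ) (λ o → bad (graph o) s)
          (λ γ → pullback (λ (o , e) → clique (graph o) s γ , dec-false⁻ (contains? L (clique (graph o) s γ)) e) id free)
          (λ γ → ⨂ λ i → ⨂ λ j → bit λ (o , _) → adj (clique (graph o) s γ) i j)
          λ ((G , poor) , e) → subst (λ s → count (bad G s) ≤ B) e (proj₂ (shift G poor))
        groups : Code {Obj} (λ o o′ → ∀ i x y → adj (graph o) (vtx i x) (vtx i y) ≡ adj (graph o′) (vtx i x) (vtx i y)) (((2 ^ b) ^ b) ^ m)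
        groups = ⨂ λ i → ⨂ λ x → ⨂ λ y → bit λ o → adj (graph o) (vtx i x) (vtx i y)
        glue : ∀ {o o′ : Obj} → let G = graph o; H = graph o′ in
          (∀ γ → clique G s γ ≈ clique H s γ) ×
          (∀ i x y → adj G (vtx i x) (vtx i y) ≡ adj H (vtx i x) (vtx i y)) ×
          (∀ j u → adj G (rest j) u ≡ adj H (rest j) u) → G ≈ H
        glue {o} {o′} (ls , gs , rs) u w with vertex u | vertex w
        ... | inj₂ (j , refl) | _ = rs j w
        ... | inj₁ _ | inj₂ (j , refl) = trans (adj-sym (graph o) _ _) (trans (rs j u) (adj-sym (graph o′) _ _))
        ... | inj₁ (i , x , refl) | inj₁ (j , y , refl) with i Fin.≟ j
        ...   | yes refl = gs i x y
        ...   | no i≢j with line-through s i j i≢j x y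
        ...     | γ , refl , refl = ls γ i j

      poor-graphs : Code {∃ IsPoor} _≋_ (b ^ m * (W F X (b * b) B * (((2 ^ b) ^ b) ^ m * (2 ^ N) ^ l)))
      poor-graphs = choose _≋_ (λ (G , poor) → proj₁ (shift G poor)) shifted

-- Copies of L and maximal families

module Copies where

  open import Defs
    using (ℝ; fromℕ; Graph; adj; adj-sym; adj-irrefl; Adj; _≈_; _⊕_; Subgraph; verts; edges; edges⊆; edges-in; IsCopy; HasCopies; IsM)
    renaming (_≤_ to _≤ᵣ_)
  open import Data.Bool using (Bool; true; false; T; _xor_)
  import Data.Bool.Properties as Bool
  open import Data.Fin using (Fin; zero; suc; finToFun; remQuot; combine; cast)
  import Data.Fin.Properties as Fin
  open import Data.Fin.Subset using (_∈_)
  open import Data.Nat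
  open import Data.Nat.Combinatorics using (_C_; nC1≡n; nCk+nC[k+1]≡[n+1]C[k+1])
  open import Data.Nat.Properties
  open import Data.Product using (∃; ∃-syntax; _×_; _,_; proj₁; proj₂)
  open import Data.Vec using (tabulate)
  open import Data.Vec.Properties using (lookup∘tabulate; lookup⇒[]=; []=⇒lookup)
  open import Function using (_∘_)
  open import Function.Bundles using (_⇔_; mk⇔; module Equivalence)
  open import Function.Definitions using (Injective)
  open import Relation.Binary.PropositionalEquality using (_≡_; _≢_; refl; sym; trans; cong; cong₂; subst)
  open import Relation.Nullary using (¬_; Dec; yes; no; does; contradiction)
  open import Relation.Nullary.Decidable using (_×-dec_; dec-true; dec-false; does-⇔)

  open Counting
  open Multipartite
  open Design using (Homomorphism; finToFun-injective)

  private
    variable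
      n v : ℕ

  T⇒≡ : ∀ {x} → T x → x ≡ true
  T⇒≡ = Equivalence.to Bool.T-≡

  ≡⇒T : ∀ {x} → x ≡ true → T x
  ≡⇒T = Equivalence.from Bool.T-≡

  module Embedded (L : Graph v) (G : Graph n) (φ : Fin v → Fin n)
                  (φ-injective : Injective _≡_ _≡_ φ) (φ-hom : Homomorphism L G φ) where

    hit? : ∀ i → Dec (∃[ a ] φ a ≡ i)
    hit? i = Fin.any? λ a → φ a Fin.≟ i

    Edge : Fin n → Fin n → Set
    Edge i j = ∃[ a ] ∃[ c ] φ a ≡ i × φ c ≡ j × adj L a c ≡ true

    edge? : ∀ i j → Dec (Edge i j)
    edge? i j = Fin.any? λ a → Fin.any? λ c → (φ a Fin.≟ i) ×-dec (φ c Fin.≟ j) ×-dec (adj L a c Bool.≟ true)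

    edge-sym : ∀ {i j} → Edge i j → Edge j i
    edge-sym (a , c , p , q , l) = c , a , q , p , trans (adj-sym L c a) l

    ∈-verts : ∀ i → i ∈ tabulate (does ∘ hit?) ⇔ (∃[ a ] φ a ≡ i)
    ∈-verts i = mk⇔
      (λ m → dec-true⁻ (hit? i) (trans (sym (lookup∘tabulate (does ∘ hit?) i)) ([]=⇒lookup m)))
      (λ h → lookup⇒[]= i _ (trans (lookup∘tabulate (does ∘ hit?) i) (dec-true (hit? i) h)))

    subgraph : Subgraph G
    subgraph = record
      { verts    = tabulate (does ∘ hit?)
      ; edges    = record
        { adj        = λ i j → does (edge? i j)
        ; adj-sym    = λ i j → does-⇔ (mk⇔ edge-sym edge-sym) (edge? i j) (edge? j i)
        ; adj-irrefl = λ i → dec-false (edge? i i) λ (a , c , p , q , l) →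
            adjacent⇒≢ L l (φ-injective (trans p (sym q)))
        }
      ; edges⊆   = λ i j e → ≡⇒T (inside (dec-true⁻ (edge? i j) (T⇒≡ e)))
      ; edges-in = λ i j e → let a , _ , p , _ = dec-true⁻ (edge? i j) (T⇒≡ e) in Equivalence.from (∈-verts i) (a , p)
      }
      where
      inside : ∀ {i j} → Edge i j → adj G i j ≡ true
      inside (a , c , refl , refl , l) = φ-hom a c l

    isCopy : IsCopy L subgraph
    isCopy = record
      { φ         = φ
      ; injective = φ-injective
      ; image     = ∈-verts
      ; adj-iff   = λ a c → mk⇔
          (λ l → ≡⇒T (dec-true (edge? (φ a) (φ c)) (a , c , refl , refl , T⇒≡ l)))
          (λ e → let a′ , c′ , p , q , l = dec-true⁻ (edge? (φ a) (φ c)) (T⇒≡ e) in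
             ≡⇒T (subst (λ x → adj L x c ≡ true) (φ-injective p) (subst (λ x → adj L a′ x ≡ true) (φ-injective q) l)))
      }

  -- Copies are told apart by their vertex sets alone: if two agreed, every φ i a would be a value
  -- of φ j.
  embedded-copies : (L : Graph v) (G : Graph n) {N : ℕ} (φ : Fin N → Fin v → Fin n) →
    (inj : ∀ i → Injective _≡_ _≡_ (φ i)) (hom : ∀ i → Homomorphism L G (φ i)) →
    (∀ i j → (∀ a → ∃[ c ] φ j c ≡ φ i a) → i ≡ j) → {k : ℝ} → k ≤ᵣ fromℕ N → HasCopies L G k
  embedded-copies L G {N} φ inj hom sep k≤N = N , k≤N , (λ i → Embedded.subgraph L G (φ i) (inj i) (hom i)) ,
    (λ i → Embedded.isCopy L G (φ i) (inj i) (hom i)) ,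
    λ i j i≢j (v≡ , _) → i≢j (sep i j λ a →
      Equivalence.to (Embedded.∈-verts L G (φ j) (inj j) (hom j) (φ i a))
        (subst (φ i a ∈_) v≡ (Equivalence.from (Embedded.∈-verts L G (φ i) (inj i) (hom i) (φ i a)) (a , refl))))

  hasCopies-mono : (L : Graph v) {G G′ : Graph n} {k : ℝ} → (∀ i j → Adj G i j → Adj G′ i j) →
                   HasCopies L G k → HasCopies L G′ k
  hasCopies-mono L {G} {G′} sub (N , k≤N , H , copy , distinct) = N , k≤N , H′ ,
    (λ i → let open IsCopy (copy i) in record { φ = φ ; injective = injective ; image = image ; adj-iff = adj-iff }) , distinct
    where
    H′ : Fin N → Subgraph G′
    H′ i = record
      { verts    = verts (H i)
      ; edges    = edges (H i)
      ; edges⊆   = λ a c e → sub a c (edges⊆ (H i) a c e)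
      ; edges-in = edges-in (H i)
      }

  pairs : ℕ → ℕ
  pairs zero    = 0
  pairs (suc n) = n + pairs n

  pairs≡nC2 : ∀ n → pairs n ≡ n C 2
  pairs≡nC2 zero    = refl
  pairs≡nC2 (suc n) = trans (cong₂ _+_ (sym (nC1≡n n)) (pairs≡nC2 n)) (nCk+nC[k+1]≡[n+1]C[k+1] n 1)

  isOne : Fin 2 → Bool
  isOne zero    = false
  isOne (suc _) = true

  isOne-injective : ∀ x y → isOne x ≡ isOne y → x ≡ y
  isOne-injective zero       zero       _ = refl
  isOne-injective (suc zero) (suc zero) _ = refl

  cone : (Fin n → Bool) → Graph n → Graph (suc n)
  cone {n} f G = record { adj = A ; adj-sym = A-sym ; adj-irrefl = A-irrefl }
    where
    A : Fin (suc n) → Fin (suc n) → Bool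
    A zero    zero    = false
    A zero    (suc j) = f j
    A (suc i) zero    = f i
    A (suc i) (suc j) = adj G i j
    A-sym : ∀ i j → A i j ≡ A j i
    A-sym zero    zero    = refl
    A-sym zero    (suc j) = refl
    A-sym (suc i) zero    = refl
    A-sym (suc i) (suc j) = adj-sym G i j
    A-irrefl : ∀ i → A i i ≡ false
    A-irrefl zero    = refl
    A-irrefl (suc i) = adj-irrefl G i

  nullGraph : Graph 0
  nullGraph = record { adj = λ () ; adj-sym = λ () ; adj-irrefl = λ () }

  halves : ∀ n → Fin (2 ^ pairs (suc n)) → Fin (2 ^ n) × Fin (2 ^ pairs n)
  halves n x = remQuot (2 ^ pairs n) (cast (^-distribˡ-+-* 2 n (pairs n)) x)

  graph : ∀ n → Fin (2 ^ pairs n) → Graph n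
  graph zero    x = nullGraph
  graph (suc n) x = cone (λ j → isOne (finToFun {2} {n} (proj₁ (halves n x)) j)) (graph n (proj₂ (halves n x)))

  graph-injective : ∀ n x y → graph n x ≈ graph n y → x ≡ y
  graph-injective zero    zero zero _  = refl
  graph-injective (suc n) x    y    eq = Fin.toℕ-injective (trans (sym (Fin.toℕ-cast _ x)) (trans (cong Data.Fin.toℕ whole) (Fin.toℕ-cast _ y)))
    where
    top : proj₁ (halves n x) ≡ proj₁ (halves n y)
    top = finToFun-injective {2} {n} _ _ λ j → isOne-injective _ _ (eq zero (suc j))
    rest : proj₂ (halves n x) ≡ proj₂ (halves n y)
    rest = graph-injective n _ _ λ i j → eq (suc i) (suc j)
    E = ^-distribˡ-+-* 2 n (pairs n)
    whole : cast E x ≡ cast E y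
    whole = trans (sym (Fin.combine-remQuot {2 ^ n} (2 ^ pairs n) (cast E x)))
      (trans (cong₂ combine top rest) (Fin.combine-remQuot {2 ^ n} (2 ^ pairs n) (cast E y)))

  xor-cancelˡ : ∀ x y z → x xor y ≡ x xor z → y ≡ z
  xor-cancelˡ false y     z     e = e
  xor-cancelˡ true  false false e = refl
  xor-cancelˡ true  true  true  e = refl

  -- A maximal family cannot be extended by any graph G, so every G lies at a
  -- poor distance from one of its members.
  maximal-family : (L : Graph v) {k : ℝ} {M : ℕ} → IsM L n k M →
    (P : Graph n → Set) → (∀ G → Dec (P G)) →
    (∀ G → ¬ P G → HasCopies L G k × ∃[ i ] ∃[ j ] adj G i j ≡ true) →
    ∀ {K} → Code {∃ P} _≋_ K → 2 ^ (n C 2) ≤ M * K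
  maximal-family {n = n} L {k} {M} ((𝒢 , far) , greatest) P P? rich {K} c =
    subst (λ N → 2 ^ N ≤ M * K) (pairs≡nC2 n) (Code⇒≤ (choose _≡_ near λ i →
      pullback (λ (x , e) → 𝒢 i ⊕ graph n x , subst (λ i → P (𝒢 i ⊕ graph n x)) e (near-poor x))
        (λ {x} {y} eq → graph-injective n (proj₁ x) (proj₁ y) λ a c → xor-cancelˡ (adj (𝒢 i) a c) _ _ (eq a c)) c))
    where
    near∃ : ∀ x → ∃[ i ] P (𝒢 i ⊕ graph n x)
    near∃ x with Fin.any? (λ i → P? (𝒢 i ⊕ graph n x))
    ... | yes found = found
    ... | no ¬found = contradiction (greatest (suc M) (𝒢⁺ , far⁺)) (<⇒≱ (n<1+n M))
      where
      G = graph n x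
      rich′ : ∀ i → HasCopies L (𝒢 i ⊕ G) k × ∃[ a ] ∃[ c ] adj (𝒢 i ⊕ G) a c ≡ true
      rich′ i = rich (𝒢 i ⊕ G) λ p → ¬found (i , p)
      -- That G is a new graph comes from the edge of the difference; the copies alone would not
      -- show it if k were not positive.
      differ : ∀ i → ¬ (∀ a c → adj (𝒢 i) a c ≡ adj G a c)
      differ i eq with rich′ i
      ... | _ , a , c , e with () ← trans (sym e) (trans (cong (_xor adj G a c) (eq a c)) (Bool.xor-same (adj G a c)))
      𝒢⁺ : Fin (suc M) → Graph n
      𝒢⁺ zero    = G
      𝒢⁺ (suc i) = 𝒢 i
      far⁺ : ∀ i j → i ≢ j → ¬ (𝒢⁺ i ≈ 𝒢⁺ j) × HasCopies L (𝒢⁺ i ⊕ 𝒢⁺ j) k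
      far⁺ zero    zero    i≢j = contradiction refl i≢j
      far⁺ zero    (suc j) i≢j = (λ eq → differ j λ a c → sym (eq a c)) ,
        hasCopies-mono L {𝒢 j ⊕ G} {G ⊕ 𝒢 j} {k} (λ a c → subst T (Bool.xor-comm (adj (𝒢 j) a c) (adj G a c))) (proj₁ (rich′ j))
      far⁺ (suc i) zero    i≢j = differ i , proj₁ (rich′ i)
      far⁺ (suc i) (suc j) i≢j = far i j (i≢j ∘ cong suc)
    near : Fin (2 ^ pairs n) → Fin M
    near x = proj₁ (near∃ x)
    near-poor : ∀ x → P (𝒢 (near x) ⊕ graph n x)
    near-poor x = proj₂ (near∃ x)

-- The lower bound on M

module Lower where

  open import Defs
    using (ℝ; fromℕ; Graph; adj; Adj; Colourable; HasCopies; IsM; Eventually)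
    renaming (_≤_ to _≤ᵣ_)
  open import Data.Bool using (true)
  open import Data.Fin using (Fin; zero; suc; finToFun)
  import Data.Fin.Properties as Fin
  open import Data.Nat
  open import Data.Nat.Combinatorics using (_C_)
  open import Data.Nat.DivMod
  open import Data.Nat.Properties
  open import Data.Nat.Tactic.RingSolver using (solve-∀)
  open import Data.Product using (Σ; ∃-syntax; _×_; _,_; proj₁; proj₂)
  open import Data.Sum using (inj₁; inj₂)
  open import Function using (id)
  open import Function.Definitions using (Injective)
  open import Relation.Binary.PropositionalEquality using (_≡_; refl; sym; trans; cong; cong₂; subst)
  open import Relation.Nullary using (¬_; Dec; yes; no; contradiction)

  open Counting
  open Arithmetic
  open Multipartite
  open Turan
  open Design
  open Copies

  private
    variable
      v : ℕ

  -- Vertex a of L takes the a-th place in the part of its colour, so parts of size v suffice.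
  multipartite⇒contains : (L : Graph v) {r n : ℕ} → Colourable L r → (G : Graph n) →
                          Multipartite r v G → Contains L G
  multipartite⇒contains L (f , proper) G (ρ , ρ-inj , ρ-adj) = contains L G (λ a → ρ (f a) a)
    (λ {a} {c} e → inj a c e)
    (λ a c l → ρ-adj (f a) (f c) (proper a c (≡⇒T l)) a c)
    where
    inj : ∀ a c → ρ (f a) a ≡ ρ (f c) c → a ≡ c
    inj a c e with f a Fin.≟ f c
    ... | yes p = ρ-inj (f c) (trans (cong (λ i → ρ i a) (sym p)) e)
    ... | no ¬p = contradiction e (adjacent⇒≢ G (ρ-adj (f a) (f c) ¬p a c))

  2pairs+n≡n² : ∀ n → 2 * (n C 2) + n ≡ n * n
  2pairs+n≡n² n = trans (cong (λ p → 2 * p + n) (sym (pairs≡nC2 n))) (go n)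
    where
    step : ∀ n p → 2 * (n + p) + suc n ≡ 2 * p + n + (n + suc n)
    step = solve-∀
    square : ∀ n → n * n + (n + suc n) ≡ suc n * suc n
    square = solve-∀
    go : ∀ n → 2 * pairs n + n ≡ n * n
    go zero    = refl
    go (suc n) = trans (step n (pairs n)) (trans (cong (_+ (n + suc n)) (go n)) (square n))

  open ≤-Reasoning

  -- The parameter m with its exponent e, chosen so that e is smaller than
  -- (1 - A/B) m²/2 by a margin linear in m.
  module Margin (r r′ A B D j Q m e v S : ℕ) (r≡ : r ≡ suc r′) (D≡ : D ≡ suc (B * r)) (A<B : A * r < B)
                (j≡ : j ≡ B * (Q + 4) + 1 + v) (m≡ : m ≡ 2 * r * D * j)
                (S≡ : S ≡ 2 * r * D * (j * j)) (e≡ : e ≡ (r′ * D + r) * S + Q) where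

    x : ℕ
    x = B ∸ suc (A * r)

    B≡ : B ≡ suc (A * r) + x
    B≡ = sym (m+[n∸m]≡n A<B)

    m²≡ : m * m ≡ 2 * (r * D) * S
    m²≡ = trans (cong₂ _*_ m≡ m≡) (trans (lemma r D j) (cong (2 * (r * D) *_) (sym S≡)))
      where
      lemma : ∀ r D j → 2 * r * D * j * (2 * r * D * j) ≡ 2 * (r * D) * (2 * r * D * (j * j))
      lemma = solve-∀

    -- Since A r < B, the product D (B - A r) is at least D = B r + 1. The B r pays for the error
    -- term of `FreeBound`, and the surplus 1 becomes the 2 S that `room` spends.
    BrD≡ : B * (r * D) ≡ B * (r′ * D + r) + A * (r * D) + 1 + x * D
    BrD≡ = begin-equality
      B * (r * D)                                           ≡⟨ cong (λ r → B * (r * D)) r≡ ⟩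
      B * (suc r′ * D)                                      ≡⟨ expand B r′ D ⟩
      B * (r′ * D) + B * D                                  ≡⟨ cong (λ b → B * (r′ * D) + b * D) B≡ ⟩
      B * (r′ * D) + (suc (A * r) + x) * D                  ≡⟨ split B r r′ D A x ⟩
      B * (r′ * D) + D + A * (r * D) + x * D                ≡⟨ cong (λ d → B * (r′ * D) + d + A * (r * D) + x * D) D≡ ⟩
      B * (r′ * D) + suc (B * r) + A * (r * D) + x * D      ≡⟨ collect B r r′ D A x ⟩
      B * (r′ * D + r) + A * (r * D) + 1 + x * D            ∎
      where
      expand : ∀ B r′ D → B * (suc r′ * D) ≡ B * (r′ * D) + B * D
      expand = solve-∀
      split : ∀ B r r′ D A x → B * (r′ * D) + (suc (A * r) + x) * D ≡ B * (r′ * D) + D + A * (r * D) + x * D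
      split = solve-∀
      collect : ∀ B r r′ D A x → B * (r′ * D) + suc (B * r) + A * (r * D) + x * D ≡ B * (r′ * D + r) + A * (r * D) + 1 + x * D
      collect = solve-∀

    1≤rD : 1 ≤ r * D
    1≤rD = *-mono-≤ (subst (1 ≤_) (sym r≡) (s≤s z≤n)) (subst (1 ≤_) (sym D≡) (s≤s z≤n))

    -- S is quadratic in j and m only linear; the value of j is read off from this inequality.
    room : 2 * B * (Q + m + 2) + 1 ≤ 2 * S
    room = begin
      2 * B * (Q + m + 2) + 1                             ≡⟨ cong (λ m → 2 * B * (Q + m + 2) + 1) m≡ ⟩
      2 * B * (Q + 2 * r * D * j + 2) + 1                 ≡⟨ split B Q r D j ⟩
      2 * B * (Q + 2) + 1 + 4 * B * (r * D * j)           ≤⟨ +-monoˡ-≤ _ (≤-trans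
                                                               (m≤m+n (2 * B * (Q + 2) + 1) (2 * B * (Q + 4) + 3 + 4 * v))
                                                               (≤-trans (≤-reflexive (spread B Q v)) (m≤m*n _ (r * D * j) {{rDj≢0}}))) ⟩
      4 * (B * (Q + 3) + 1 + v) * (r * D * j) + 4 * B * (r * D * j) ≡⟨ collect B Q v (r * D * j) ⟩
      4 * (r * D * j) * (B * (Q + 4) + 1 + v)             ≡⟨ cong (4 * (r * D * j) *_) j≡ ⟨
      4 * (r * D * j) * j                                 ≡⟨ assoc r D j ⟩
      2 * (2 * r * D * (j * j))                           ≡⟨ cong (2 *_) S≡ ⟨
      2 * S                                               ∎
      where
      1≤j : 1 ≤ j
      1≤j = subst (1 ≤_) (sym j≡) (≤-trans (m≤n+m 1 (B * (Q + 4))) (m≤m+n _ v))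
      rDj≢0 : NonZero (r * D * j)
      rDj≢0 = >-nonZero (*-mono-≤ 1≤rD 1≤j)
      split : ∀ B Q r D j → 2 * B * (Q + 2 * r * D * j + 2) + 1 ≡ 2 * B * (Q + 2) + 1 + 4 * B * (r * D * j)
      split = solve-∀
      spread : ∀ B Q v → 2 * B * (Q + 2) + 1 + (2 * B * (Q + 4) + 3 + 4 * v) ≡ 4 * (B * (Q + 3) + 1 + v)
      spread = solve-∀
      collect : ∀ B Q v z → 4 * (B * (Q + 3) + 1 + v) * z + 4 * B * z ≡ 4 * z * (B * (Q + 4) + 1 + v)
      collect = solve-∀
      assoc : ∀ r D j → 4 * (r * D * j) * j ≡ 2 * (2 * r * D * (j * j))
      assoc = solve-∀

    margin : 2 * B * (e + m + 2) + 1 + A * (m * m) ≤ B * (m * m)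
    margin = begin
      2 * B * (e + m + 2) + 1 + A * (m * m)
        ≡⟨ cong₂ (λ e s → 2 * B * (e + m + 2) + 1 + A * s) e≡ m²≡ ⟩
      2 * B * ((r′ * D + r) * S + Q + m + 2) + 1 + A * (2 * (r * D) * S)
        ≡⟨ regroup B (r′ * D + r) S Q m A (r * D) ⟩
      2 * B * (Q + m + 2) + 1 + 2 * S * (B * (r′ * D + r) + A * (r * D))
        ≤⟨ +-monoˡ-≤ _ room ⟩
      2 * S + 2 * S * (B * (r′ * D + r) + A * (r * D))
        ≤⟨ m≤m+n _ (2 * S * (x * D)) ⟩
      2 * S + 2 * S * (B * (r′ * D + r) + A * (r * D)) + 2 * S * (x * D)
        ≡⟨ factor S (B * (r′ * D + r) + A * (r * D)) (x * D) ⟩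
      2 * S * (B * (r′ * D + r) + A * (r * D) + 1 + x * D)
        ≡⟨ cong (2 * S *_) BrD≡ ⟨
      2 * S * (B * (r * D))
        ≡⟨ swap S B (r * D) ⟩
      B * (2 * (r * D) * S)
        ≡⟨ cong (B *_) m²≡ ⟨
      B * (m * m) ∎
      where
      regroup : ∀ B y S Q m A z → 2 * B * (y * S + Q + m + 2) + 1 + A * (2 * z * S) ≡ 2 * B * (Q + m + 2) + 1 + 2 * S * (B * y + A * z)
      regroup = solve-∀
      factor : ∀ S y z → 2 * S + 2 * S * y + 2 * S * z ≡ 2 * S * (y + 1 + z)
      factor = solve-∀
      swap : ∀ S B z → 2 * S * (B * z) ≡ B * (2 * z * S)
      swap = solve-∀

    fits : (r′ * D + r) * (m * m) + Q ≤ 2 * r * D * e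
    fits = begin
      (r′ * D + r) * (m * m) + Q                    ≡⟨ cong (λ s → (r′ * D + r) * s + Q) m²≡ ⟩
      (r′ * D + r) * (2 * (r * D) * S) + Q          ≤⟨ +-monoʳ-≤ _ (m≤n*m Q (2 * (r * D)) {{>-nonZero (*-mono-≤ (s≤s (z≤n {1})) 1≤rD)}}) ⟩
      (r′ * D + r) * (2 * (r * D) * S) + 2 * (r * D) * Q ≡⟨ collect (r′ * D + r) r D S Q ⟩
      2 * r * D * ((r′ * D + r) * S + Q)            ≡⟨ cong (2 * r * D *_) e≡ ⟨
      2 * r * D * e                                 ∎
      where
      collect : ∀ y r D S Q → y * (2 * (r * D) * S) + 2 * (r * D) * Q ≡ 2 * r * D * (y * S + Q)
      collect = solve-∀

    v≤m : v ≤ m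
    v≤m = begin
      v                         ≤⟨ m≤n+m v _ ⟩
      B * (Q + 4) + 1 + v       ≡⟨ j≡ ⟨
      j                         ≤⟨ m≤n*m j (2 * r * D) {{>-nonZero (≤-trans 1≤rD (≤-trans (m≤n*m (r * D) 2) (≤-reflexive (sym (*-assoc 2 r D)))))}} ⟩
      2 * r * D * j             ≡⟨ m≡ ⟨
      m                         ∎

    2≤m : 2 ≤ m
    2≤m = begin
      2                         ≤⟨ *-mono-≤ (s≤s (s≤s (z≤n {0}))) (*-mono-≤ 1≤rD 1≤j) ⟩
      2 * (r * D * j)           ≡⟨ assoc r D j ⟩
      2 * r * D * j             ≡⟨ m≡ ⟨
      m                         ∎
      where
      1≤j : 1 ≤ j
      1≤j = subst (1 ≤_) (sym j≡) (≤-trans (m≤n+m 1 (B * (Q + 4))) (m≤m+n _ v))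
      assoc : ∀ r D j → 2 * (r * D * j) ≡ 2 * r * D * j
      assoc = solve-∀

  -- After multiplication by 2 m², b² becomes (m b)² ≤ n². The 1 in the margin then leaves a whole
  -- n² to absorb the terms linear in n.
  gap : ∀ A B m e n c N₀ b size .{{_ : NonZero m}} →
    2 * B * (e + m + 2) + 1 + A * (m * m) ≤ B * (m * m) →
    size ≤ (e + m + 2) * (b * b) + (N₀ + 1) * n →
    m * b ≤ n → 2 * c + n ≡ n * n →
    2 * B * (m * m) * (N₀ + 1) + B * (m * m) < n →
    B * size + A * c < B * c
  gap A B m e n c N₀ b size margin size≤ mb≤n pairs n-large =
    *-cancelˡ-< (2 * (m * m)) _ _ (+-cancelʳ-< (B * (m * m) * n) _ _ (begin-strict
      2 * (m * m) * (B * size + A * c) + B * (m * m) * n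
        ≤⟨ +-monoˡ-≤ _ (*-monoʳ-≤ (2 * (m * m)) (+-monoˡ-≤ (A * c) (*-monoʳ-≤ B size≤))) ⟩
      2 * (m * m) * (B * ((e + m + 2) * (b * b) + (N₀ + 1) * n) + A * c) + B * (m * m) * n
        ≡⟨ expand m B (e + m + 2) b N₀ n A c ⟩
      2 * B * (e + m + 2) * (m * b * (m * b)) + (2 * B * (m * m) * (N₀ + 1) + B * (m * m)) * n + A * (m * m) * (2 * c)
        ≤⟨ +-mono-≤ (+-monoˡ-≤ _ (*-monoʳ-≤ (2 * B * (e + m + 2)) (*-mono-≤ mb≤n mb≤n)))
             (*-monoʳ-≤ (A * (m * m)) (≤-trans (m≤m+n (2 * c) n) (≤-reflexive pairs))) ⟩
      2 * B * (e + m + 2) * (n * n) + (2 * B * (m * m) * (N₀ + 1) + B * (m * m)) * n + A * (m * m) * (n * n)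
        <⟨ +-monoˡ-< _ (+-monoʳ-< (2 * B * (e + m + 2) * (n * n)) (*-monoˡ-< n {{>-nonZero (≤-<-trans z≤n n-large)}} n-large)) ⟩
      2 * B * (e + m + 2) * (n * n) + n * n + A * (m * m) * (n * n)
        ≡⟨ collect (2 * B * (e + m + 2)) (A * (m * m)) (n * n) ⟩
      (2 * B * (e + m + 2) + 1 + A * (m * m)) * (n * n)
        ≤⟨ *-monoˡ-≤ (n * n) margin ⟩
      B * (m * m) * (n * n)
        ≡⟨ cong (B * (m * m) *_) pairs ⟨
      B * (m * m) * (2 * c + n)
        ≡⟨ split B (m * m) c n ⟩
      2 * (m * m) * (B * c) + B * (m * m) * n ∎))
    where
    expand : ∀ m B f b N₀ n A c → 2 * (m * m) * (B * (f * (b * b) + (N₀ + 1) * n) + A * c) + B * (m * m) * n ≡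
      2 * B * f * (m * b * (m * b)) + (2 * B * (m * m) * (N₀ + 1) + B * (m * m)) * n + A * (m * m) * (2 * c)
    expand = solve-∀
    collect : ∀ x y s → x * s + s + y * s ≡ (x + 1 + y) * s
    collect = solve-∀
    split : ∀ B s c n → B * s * (2 * c + n) ≡ 2 * s * (B * c) + B * s * n
    split = solve-∀

  -- As b + 1 is to be t m!, one has m b + m = t m m!; hence n + m, not n, is divided by m m!. The
  -- lower bound on n gives t ≥ 2, so that b ≥ m! and the remainder is at most m b.
  grid : ∀ m n → 2 ≤ m → 2 * (m * m !) ≤ n →
         ∃[ t ] ∃[ b ] ∃[ l ] suc b ≡ t * m ! × n ≡ m * b + l × l ≤ m * m ! × m * m ! ≤ m * b × 1 ≤ b
  grid m n 2≤m n-large = t , b , l , sucb , n≡ , <⇒≤ (m%n<n (n + m) N₀) , *-monoʳ-≤ m m!≤b , ≤-trans 1≤m! m!≤b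
    where
    N₀ : ℕ
    N₀ = m * m !
    1≤m! : 1 ≤ m !
    1≤m! = 1≤n! m
    instance
      N₀≢0 : NonZero N₀
      N₀≢0 = >-nonZero (*-mono-≤ (≤-trans (s≤s z≤n) 2≤m) 1≤m!)
    t l b : ℕ
    t = (n + m) / N₀
    l = (n + m) % N₀
    b = t * m ! ∸ 1
    2≤t : 2 ≤ t
    2≤t = begin
      2                   ≡⟨ m*n/n≡m 2 N₀ ⟨
      2 * N₀ / N₀         ≤⟨ /-monoˡ-≤ N₀ (≤-trans n-large (m≤m+n n m)) ⟩
      t                   ∎
    2m!≤ : 2 * m ! ≤ t * m !
    2m!≤ = *-monoˡ-≤ (m !) 2≤t
    sucb : suc b ≡ t * m !
    sucb = m+[n∸m]≡n (≤-trans (≤-trans 1≤m! (m≤m+n _ _)) 2m!≤)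
    m!≤b : m ! ≤ b
    m!≤b = s≤s⁻¹ (begin
      suc (m !)           ≤⟨ +-monoˡ-≤ (m !) 1≤m! ⟩
      m ! + m !           ≡⟨ cong (m ! +_) (+-identityʳ (m !)) ⟨
      2 * m !             ≤⟨ 2m!≤ ⟩
      t * m !             ≡⟨ sucb ⟨
      suc b               ∎)
    n≡ : n ≡ m * b + l
    n≡ = +-cancelʳ-≡ m n (m * b + l) (begin-equality
      n + m                   ≡⟨ m≡m%n+[m/n]*n (n + m) N₀ ⟩
      l + t * (m * m !)       ≡⟨ cong (l +_) (shuffle t m (m !)) ⟩
      l + m * (t * m !)       ≡⟨ cong (λ x → l + m * x) sucb ⟨
      l + m * suc b           ≡⟨ regroup l m b ⟩
      m * b + l + m           ∎)
      where
      shuffle : ∀ t m f → t * (m * f) ≡ m * (t * f)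
      shuffle = solve-∀
      regroup : ∀ l m b → l + m * suc b ≡ m * b + l + m
      regroup = solve-∀

  -- In `size`, b m bits give the shift, (e + 1) b² the good lines and the marks of bad ones, m² B ≤
  -- b² the bad lines, b² m the edges inside groups and N l those at the last l vertices.
  poor-size : ∀ m b l N e B → B * (m * m) ≤ b * b → m * b ≤ N → l ≤ m * m ! →
    ∃[ size ] size ≤ (e + m + 2) * (b * b) + (m * m ! + 1) * N ×
      b ^ m * (W (2 ^ e) ((2 ^ m) ^ m) (b * b) B * (((2 ^ b) ^ b) ^ m * (2 ^ N) ^ l)) ≤ 2 ^ size
  poor-size m b l N e B B-small mb≤N l-small = size , small , fits
    where
    size : ℕ
    size = b * m + ((suc e * (b * b) + m * m * B) + (b * b * m + N * l))
    small : size ≤ (e + m + 2) * (b * b) + (m * m ! + 1) * N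
    small = begin
      size
        ≡⟨ regroup b m e (m * m * B) N l ⟩
      (e + m + 1) * (b * b) + m * m * B + (m * b + l * N)
        ≤⟨ +-mono-≤ (+-monoʳ-≤ ((e + m + 1) * (b * b)) (≤-trans (≤-reflexive (*-comm (m * m) B)) B-small)) (+-mono-≤ mb≤N (*-monoˡ-≤ N l-small)) ⟩
      (e + m + 1) * (b * b) + b * b + (N + m * m ! * N)
        ≡⟨ collect (e + m) (b * b) N (m * m !) ⟩
      (e + m + 2) * (b * b) + (m * m ! + 1) * N ∎
      where
      regroup : ∀ b m e z N l → b * m + ((suc e * (b * b) + z) + (b * b * m + N * l)) ≡ (e + m + 1) * (b * b) + z + (m * b + l * N)
      regroup = solve-∀
      collect : ∀ f s N z → (f + 1) * s + s + (N + z * N) ≡ (f + 2) * s + (z + 1) * N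
      collect = solve-∀
    fits : b ^ m * (W (2 ^ e) ((2 ^ m) ^ m) (b * b) B * (((2 ^ b) ^ b) ^ m * (2 ^ N) ^ l)) ≤ 2 ^ size
    fits = 2^-product {d = b * m} (2^-power {d = b} m (<⇒≤ (n<2^n b)))
      (2^-product {d = suc e * (b * b) + m * m * B}
        (≤-trans (W-exp (2 ^ e) ((2 ^ m) ^ m) (b * b) B (m^n>0 2 e) (subst (1 ≤_) (sym (^-*-assoc 2 m m)) (m^n>0 2 (m * m))))
          (2^-product {d = suc e * (b * b)} (2^-power {d = suc e} (b * b) ≤-refl)
            (2^-power {d = m * m} B (≤-reflexive (^-*-assoc 2 m m)))))
        (2^-product {d = b * b * m} (2^-power {d = b * b} m (≤-reflexive (^-*-assoc 2 b b))) (2^-power {d = N} l ≤-refl)))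

  poor-packing : (L : Graph v) → (∃[ a ] ∃[ c ] Adj L a c) → ∀ m m′ b l t K e {{_ : NonZero b}} {{_ : NonZero (m * m)}} →
    m ≡ v + m′ → suc b ≡ t * m ! → K * m ^ (v + 2) ≤ b ^ v →
    Code {Σ (Graph m) λ H → ¬ Contains L H} _≋_ (2 ^ e) →
    ∀ k M → IsM L (m * b + l) k M → k ≤ᵣ fromℕ (suc K) →
    2 ^ ((m * b + l) C 2) ≤ M * (b ^ m * (W (2 ^ e) ((2 ^ m) ^ m) (b * b) ((b * b) / (m * m)) *
                                         (((2 ^ b) ^ b) ^ m * (2 ^ (m * b + l)) ^ l)))
  poor-packing {v} L (a₀ , c₀ , l₀) m m′ b l t K e m≡ b≡ K-small free k M isM enough =
    maximal-family L {k} {M} isM IsPoor P? rich (Decompose.poor-graphs good-shift free)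
    where
    open Poor L m m′ b l t K m≡ b≡ K-small
    P? : ∀ G → Dec (IsPoor G)
    P? G with poor? G
    ... | inj₁ poor                = yes poor
    ... | inj₂ (x , x-inj , many)  = no λ poor → <⇒≱ many (poor x x-inj)
    module _ (G : Graph N) (x : Fin (m ^ v)) (x-inj : Injective _≡_ _≡_ (finToFun {m} {v} x))
             (y : Fin (suc K) → Fin (b ^ v)) (y-inj : Injective _≡_ _≡_ y) (y-placed : ∀ i → placed G x (y i) ≡ true) where
      φ : Fin (suc K) → Fin v → Fin N
      φ i = place x (y i)
      hom : ∀ i → Homomorphism L G (φ i)
      hom i = dec-true⁻ (homomorphism? L G (φ i)) (y-placed i)
      value : ∀ i j a c → φ j c ≡ φ i a → finToFun {b} {v} (y j) a ≡ finToFun (y i) a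
      value i j a c eq = let p , q = vtx-injective _ _ _ _ eq in
        trans (cong (finToFun {b} {v} (y j)) (sym (x-inj p))) q
      separated : ∀ i j → (∀ a → ∃[ c ] φ j c ≡ φ i a) → i ≡ j
      separated i j same = y-inj (finToFun-injective {b} {v} _ _ λ a → sym (value i j a _ (proj₂ (same a))))
      copies : HasCopies L G k × ∃[ i ] ∃[ j ] adj G i j ≡ true
      copies = embedded-copies L G φ (λ i e → x-inj (proj₁ (vtx-injective _ _ _ _ e))) hom separated {k} enough ,
        φ zero a₀ , φ zero c₀ , hom zero a₀ c₀ (T⇒≡ l₀)
    rich : ∀ G → ¬ IsPoor G → HasCopies L G k × ∃[ i ] ∃[ j ] adj G i j ≡ true
    rich G ¬poor with poor? G
    ... | inj₁ poor = contradiction poor ¬poor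
    ... | inj₂ (x , x-inj , many) = let y , y-inj , y-placed = pick≤ (placed G x) many in
      copies G x x-inj y y-inj y-placed

  lower-bound : (L : Graph v) → (∃[ a ] ∃[ c ] Adj L a c) → ∀ r′ → Colourable L (2 + r′) →
    (k : ℕ → ℝ) → (∀ Z → 1 ≤ Z → Eventually λ n → ∀ K → n ^ v ≤ Z * K → k n ≤ᵣ fromℕ K) →
    (M : ℕ → ℕ) → (∀ n → IsM L n (k n) (M n)) → ∀ A B → A * suc r′ < B →
    Eventually λ n → ∃[ u ] 2 ^ u ≤ M n × A * (n C 2) < B * u
  lower-bound {v} L (a₀ , c₀ , l₀) r′ colouring k k-small M isM A B A<B =
    go (free-bound r′ (previous-bound r′) v (B * suc r′))
    where
    r D : ℕ
    r = suc r′
    D = suc (B * r)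
    Target : ℕ → Set
    Target n = ∃[ u ] 2 ^ u ≤ M n × A * (n C 2) < B * u
    go : (∃[ Q ] ∀ n e → (r′ * D + r) * (n * n) + Q ≤ 2 * r * D * e → Code {Free (2 + r′) v n} _≋_ (2 ^ e)) →
         Eventually Target
    go (Q , free) = setup _ _ _ _ refl refl refl refl
      where
      setup : ∀ j S e m → j ≡ B * (Q + 4) + 1 + v → m ≡ 2 * r * D * j → S ≡ 2 * r * D * (j * j) →
              e ≡ (r′ * D + r) * S + Q → Eventually Target
      setup j S e m j≡ m≡ S≡ e≡ = n₀ , λ n n₀≤n → at n n₀≤n
        (grid m n 2≤m (≤-trans (m≤n+m _ (suc large)) (≤-trans (m≤n+m _ threshold) n₀≤n)))
        where
        open Margin r r′ A B D j Q m e v S refl refl A<B j≡ m≡ S≡ e≡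
        m≢0 : NonZero m
        m≢0 = >-nonZero (≤-trans (s≤s z≤n) 2≤m)
        instance
          m²≢0 : NonZero (m * m)
          m²≢0 = m*n≢0 m m {{m≢0}} {{m≢0}}
          mv≢0 : NonZero (m ^ (v + 2))
          mv≢0 = m^n≢0 m (v + 2) {{m≢0}}
        Z large threshold n₀ : ℕ
        -- K is b^v / m^(v + 2) rounded down and n ≤ 2 m b, so n^v ≤ Z (K + 1): eventually K + 1
        -- copies are at least k n.
        Z = (2 * m) ^ v * m ^ (v + 2)
        small = k-small Z (*-mono-≤ (m^n>0 (2 * m) {{m*n≢0 2 m {{_}} {{m≢0}}}} v) (m^n>0 m {{m≢0}} (v + 2)))
        threshold = proj₁ small
        large = 2 * B * (m * m) * (m * m ! + 1) + B * (m * m)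
        n₀ = threshold + (suc large + 2 * (m * m !))
        freeₘ : Code {Σ (Graph m) λ H → ¬ Contains L H} _≋_ (2 ^ e)
        freeₘ = pullback (λ (H , ¬has) → H , λ mp → ¬has (multipartite⇒contains L colouring H mp)) id (free m e fits)
        at : ∀ n → n₀ ≤ n →
             ∃[ t ] ∃[ b ] ∃[ l ] suc b ≡ t * m ! × n ≡ m * b + l × l ≤ m * m ! × m * m ! ≤ m * b × 1 ≤ b → Target n
        at _ n₀≤n (t , b , l , b≡ , refl , l-small , b-large , 1≤b) = n C 2 ∸ size ,
          *-cancelʳ-≤ _ (M n) (2 ^ size) {{m^n≢0 2 size}} (begin
            2 ^ (n C 2 ∸ size) * 2 ^ size     ≡⟨ ^-distribˡ-+-* 2 (n C 2 ∸ size) size ⟨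
            2 ^ (n C 2 ∸ size + size)         ≡⟨ cong (2 ^_) (m∸n+n≡m (<⇒≤ size<)) ⟩
            2 ^ (n C 2)                       ≤⟨ packed ⟩
            M n * Kbad                        ≤⟨ *-monoʳ-≤ (M n) (proj₂ (proj₂ sized)) ⟩
            M n * 2 ^ size                    ∎) ,
          (begin-strict
            A * (n C 2)                       <⟨ m+n≤o⇒m≤o∸n (suc (A * (n C 2))) (≤-trans (≤-reflexive (cong suc (+-comm _ (B * size)))) gap′) ⟩
            B * (n C 2) ∸ B * size            ≡⟨ *-distribˡ-∸ B (n C 2) size ⟨
            B * (n C 2 ∸ size)                ∎)
          where
          n K m′ Kbad : ℕ
          n = m * b + l
          K = b ^ v / m ^ (v + 2)
          m′ = m ∸ v
          instance
            b≢0 : NonZero b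
            b≢0 = >-nonZero 1≤b
          K-small : K * m ^ (v + 2) ≤ b ^ v
          K-small = m/n*n≤m (b ^ v) (m ^ (v + 2))
          B′ : ℕ
          B′ = (b * b) / (m * m)
          Kbad = b ^ m * (W (2 ^ e) ((2 ^ m) ^ m) (b * b) B′ * (((2 ^ b) ^ b) ^ m * (2 ^ n) ^ l))
          sized = poor-size m b l n e B′ (m/n*n≤m (b * b) (m * m)) (m≤m+n (m * b) l) l-small
          size = proj₁ sized
          gap′ : B * size + A * (n C 2) < B * (n C 2)
          gap′ = gap A B m e n (n C 2) (m * m !) b size {{m≢0}} margin (proj₁ (proj₂ sized)) (m≤m+n (m * b) l) (2pairs+n≡n² n)
            (≤-trans (≤-trans (m≤m+n (suc large) _) (m≤n+m _ threshold)) n₀≤n)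
          size< : size < n C 2
          size< = *-cancelˡ-< B _ _ (≤-<-trans (m≤m+n (B * size) _) gap′)
          n^v≤ : n ^ v ≤ Z * suc K
          n^v≤ = begin
            n ^ v                                   ≤⟨ ^-monoˡ-≤ v n≤ ⟩
            (2 * m * b) ^ v                         ≡⟨ ^-distribʳ-* v (2 * m) b ⟩
            (2 * m) ^ v * b ^ v                     ≤⟨ *-monoʳ-≤ ((2 * m) ^ v) b^v≤ ⟩
            (2 * m) ^ v * (m ^ (v + 2) * suc K)     ≡⟨ *-assoc ((2 * m) ^ v) _ _ ⟨
            Z * suc K                               ∎
            where
            double : ∀ m b → m * b + m * b ≡ 2 * m * b
            double = solve-∀
            n≤ : n ≤ 2 * m * b
            n≤ = begin
              m * b + l             ≤⟨ +-monoʳ-≤ (m * b) (≤-trans l-small b-large) ⟩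
              m * b + m * b         ≡⟨ double m b ⟩
              2 * m * b             ∎
            b^v≤ : b ^ v ≤ m ^ (v + 2) * suc K
            b^v≤ = begin
              b ^ v                                       ≡⟨ m≡m%n+[m/n]*n (b ^ v) (m ^ (v + 2)) ⟩
              b ^ v % m ^ (v + 2) + K * m ^ (v + 2)       ≤⟨ +-monoˡ-≤ _ (<⇒≤ (m%n<n (b ^ v) (m ^ (v + 2)))) ⟩
              suc K * m ^ (v + 2)                         ≡⟨ *-comm (suc K) _ ⟩
              m ^ (v + 2) * suc K                         ∎
          enough : k n ≤ᵣ fromℕ (suc K)
          enough = proj₂ small n (≤-trans (m≤m+n threshold _) n₀≤n) (suc K) n^v≤
          packed : 2 ^ (n C 2) ≤ M n * Kbad
          packed = poor-packing L (a₀ , c₀ , l₀) m m′ b l t K e (sym (m+[n∸m]≡n v≤m)) b≡ K-small freeₘ (k n) (M n) (isM n) enough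

-- Upper bounds on M from dense graphs with few copies

module Upper where

  open import Defs
    using (fromℕ; Graph; adj; adj-sym; adj-irrefl; Adj; _⊕_; Colourable; Subgraph; verts; edges; edges⊆; edges-in; _≈ₛ_; IsCopy; HasFamily)
    renaming (_≤_ to _≤ᵣ_)
  open import Data.Bool using (Bool; true; false; T; _xor_)
  import Data.Bool.Properties as Bool
  open import Data.Empty using (⊥-elim)
  open import Data.Fin using (Fin; zero; suc; toℕ; fromℕ<; combine; remQuot; punchIn; punchOut; finToFun; funToFin)
  import Data.Fin.Properties as Fin
  open import Data.Fin.Subset using (_∈_)
  open import Data.Fin.Subset.Properties using (⊆-antisym)
  open import Data.Nat
  open import Data.Nat.Combinatorics using (_C_)
  open import Data.Nat.DivMod
  open import Data.Nat.Properties
  open import Data.Nat.Tactic.RingSolver using (solve-∀)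
  open import Data.Product using (Σ; ∃; ∃-syntax; _×_; _,_; proj₁; proj₂)
  open import Function using (_∘_; id)
  open import Function.Bundles using (module Equivalence)
  open import Relation.Binary.Definitions using (tri<; tri≈; tri>)
  open import Relation.Binary.PropositionalEquality using (_≡_; _≢_; refl; sym; trans; cong; cong₂; subst; module ≡-Reasoning)
  open import Relation.Nullary using (¬_; Dec; yes; no; does; contradiction)
  open import Relation.Nullary.Decidable using (_×-dec_; dec-true)

  open Counting
  open Multipartite
  open Modular
  open Design using (Homomorphism)
  open Copies

  private
    variable
      n v : ℕ
      A : Set

  masked : ∀ {l} (P : Fin l → Bool) (e : Fin l → A → Bool) →
           Code (λ a b → ∀ x → P x ≡ true → e x a ≡ e x b) (2 ^ count P)
  masked {l = zero}  P e = trivial λ ()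
  masked {l = suc l} P e with P zero in eq
  ... | true  = coarsen (λ (p , q) → λ { zero _ → p ; (suc x) → q x }) (bit (e zero) ⊗ masked (P ∘ suc) (e ∘ suc))
  ... | false = coarsen (λ q → λ { zero h → contradiction (trans (sym eq) h) λ () ; (suc x) → q x }) (masked (P ∘ suc) (e ∘ suc))

  maskSize : (ℕ → ℕ → Bool) → ℕ → ℕ
  maskSize P zero    = 0
  maskSize P (suc y) = count {y} (λ x → P (toℕ x) y) + maskSize P y

  -- Vertices are natural numbers here, so that n can shrink while P and e stay the same.
  triangle : (P : ℕ → ℕ → Bool) (e : ℕ → ℕ → A → Bool) → ∀ n →
             Code (λ a b → ∀ x y → x < y → y < n → P x y ≡ true → e x y a ≡ e x y b) (2 ^ maskSize P n)
  triangle P e zero    = trivial λ x y _ ()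
  triangle P e (suc n) = weaken (≤-reflexive (sym (^-distribˡ-+-* 2 (count {n} (λ x → P (toℕ x) n)) (maskSize P n))))
    (coarsen (λ {a} {b} → glue {a} {b}) (masked (λ x → P (toℕ x) n) (λ x → e (toℕ x) n) ⊗ triangle P e n))
    where
    glue : ∀ {a b} → (∀ (x : Fin n) → P (toℕ x) n ≡ true → e (toℕ x) n a ≡ e (toℕ x) n b) ×
           (∀ x y → x < y → y < n → P x y ≡ true → e x y a ≡ e x y b) →
           ∀ x y → x < y → y < suc n → P x y ≡ true → e x y a ≡ e x y b
    glue {a} {b} (p , q) x y x<y y<1+n h with y ≟ n
    ... | no y≢n   = q x y x<y (≤∧≢⇒< (s≤s⁻¹ y<1+n) y≢n) h
    ... | yes refl = subst (λ x → P x n ≡ true → e x n a ≡ e x n b) (Fin.toℕ-fromℕ< x<y) (p (fromℕ< x<y)) h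

  adjℕ : Graph n → ℕ → ℕ → Bool
  adjℕ {n} G x y with x <? n | y <? n
  ... | yes p | yes q = adj G (fromℕ< p) (fromℕ< q)
  ... | _     | _     = false

  adjℕ-toℕ : (G : Graph n) → ∀ i j → adjℕ G (toℕ i) (toℕ j) ≡ adj G i j
  adjℕ-toℕ {n} G i j with toℕ i <? n | toℕ j <? n
  ... | yes p | yes q = cong₂ (adj G) (Fin.fromℕ<-toℕ i p) (Fin.fromℕ<-toℕ j q)
  ... | no ¬p | _     = contradiction (Fin.toℕ<n i) ¬p
  ... | yes _ | no ¬q = contradiction (Fin.toℕ<n j) ¬q

  -- Two vertices x and y are joined unless x ≡ y (mod r) and the sum of the
  -- classes of x / r and y / r modulo q has a residue in [p, q): a Turán graph
  -- with r parts, inside which edges of density p/q are added evenly.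
  module Dense (r q p : ℕ) {{_ : NonZero r}} {{_ : NonZero q}} where

    U : ℕ → Fin q
    U x = (x / r) mod q

    -- A sum is symmetric in x and y, and for fixed y it still determines the class of x.
    residue : ℕ → ℕ → Fin q
    residue x y = (toℕ (U x) + toℕ (U y)) mod q

    Gap : ℕ → ℕ → Set
    Gap x y = x % r ≡ y % r × p ≤ toℕ (residue x y)

    gap? : ∀ x y → Dec (Gap x y)
    gap? x y = (x % r ≟ y % r) ×-dec (p ≤? toℕ (residue x y))

    gap : ℕ → ℕ → Bool
    gap x y = does (gap? x y)

    residue-comm : ∀ x y → residue x y ≡ residue y x
    residue-comm x y = cong (_mod q) (+-comm (toℕ (U x)) (toℕ (U y)))

    gap-sym : ∀ {x y} → Gap x y → Gap y x
    gap-sym {x} {y} (e , h) = sym e , subst (λ z → p ≤ toℕ z) (residue-comm x y) h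

    residue-cancel : ∀ {x x′ y y′} → U y ≡ U y′ → residue x y ≡ residue x′ y′ → U x ≡ U x′
    residue-cancel {x} {x′} {y} {y′} ue e = shift-injective (toℕ (U y)) (U x) (U x′)
      (trans e (cong (λ u → (toℕ (U x′) + toℕ u) mod q) (sym ue)))

    coordinates : ∀ {x x′} → x % r ≡ x′ % r → U x ≡ U x′ → x / r / q ≡ x′ / r / q → x ≡ x′
    coordinates {x} {x′} c u w = begin
      x                     ≡⟨ m≡m%n+[m/n]*n x r ⟩
      x % r + x / r * r     ≡⟨ cong₂ (λ a b → a + b * r) c quotient ⟩
      x′ % r + x′ / r * r   ≡⟨ m≡m%n+[m/n]*n x′ r ⟨
      x′                    ∎
      where
      open ≡-Reasoning
      quotient : x / r ≡ x′ / r
      quotient = begin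
        x / r                                 ≡⟨ mod-quotient (x / r) q ⟩
        toℕ (U x) + x / r / q * q             ≡⟨ cong₂ (λ a b → toℕ a + b * q) u w ⟩
        toℕ (U x′) + x′ / r / q * q           ≡⟨ mod-quotient (x′ / r) q ⟨
        x′ / r                                ∎

    -- Given y, the vertex x is recovered from its residue modulo r, which is that of y, from one of
    -- q - p sums, which yields `U x`, and from its level x / r / q.
    row-gaps : ∀ y → count {y} (λ x → gap (toℕ x) y) ≤ (q ∸ p) * suc (y / r / q)
    row-gaps y = Code⇒≤ (pullback {A = Fin (count P)} (λ i → proj₁ picked i , isGap i)
      (λ e → proj₁ (proj₂ picked) e) gaps)
      where
      P : Fin y → Bool
      P x = gap (toℕ x) y
      picked = pick P
      isGap : ∀ i → Gap (toℕ (proj₁ picked i)) y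
      isGap i = dec-true⁻ (gap? _ y) (proj₂ (proj₂ picked) i)
      Gaps : Set
      Gaps = Σ (Fin y) λ x → Gap (toℕ x) y
      gaps : Code {Gaps} (λ a b → proj₁ a ≡ proj₁ b) ((q ∸ p) * suc (y / r / q))
      gaps = coarsen (λ {a} {b} → glue {a} {b}) (letter excess ⊗ letter level)
        where
        excess : Gaps → Fin (q ∸ p)
        excess (x , _ , h) = fromℕ< (∸-monoˡ-< (Fin.toℕ<n (residue (toℕ x) y)) h)
        level : Gaps → Fin (suc (y / r / q))
        level (x , _) = fromℕ< {m = toℕ x / r / q} (s≤s (/-monoˡ-≤ q (/-monoˡ-≤ r (<⇒≤ (Fin.toℕ<n x)))))
        glue : ∀ {a b} → excess a ≡ excess b × level a ≡ level b → proj₁ a ≡ proj₁ b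
        glue {x , c , h} {x′ , c′ , h′} (e , w) = Fin.toℕ-injective (coordinates (trans c (sym c′))
          (residue-cancel {y = y} {y} refl (Fin.toℕ-injective (∸-cancelʳ-≡ h h′ (Fin.fromℕ<-injective _ _ _ _ e))))
          (Fin.fromℕ<-injective _ _ _ _ w))

    open ≤-Reasoning

    mask-bound : ∀ n → r * q * maskSize gap n ≤ (q ∸ p) * (n C 2) + r * q * (q ∸ p) * n
    mask-bound n = ≤-trans (go n) (≤-reflexive (cong (λ c → (q ∸ p) * c + r * q * (q ∸ p) * n) (pairs≡nC2 n)))
      where
      below : ∀ y → r * q * (y / r / q) ≤ y
      below y = begin
        r * q * (y / r / q)     ≡⟨ trans (*-assoc r q _) (cong (r *_) (*-comm q _)) ⟩
        r * (y / r / q * q)     ≤⟨ *-monoʳ-≤ r (m/n*n≤m (y / r) q) ⟩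
        r * (y / r)             ≡⟨ *-comm r _ ⟩
        y / r * r               ≤⟨ m/n*n≤m y r ⟩
        y                       ∎
      go : ∀ n → r * q * maskSize gap n ≤ (q ∸ p) * pairs n + r * q * (q ∸ p) * n
      go zero    = ≤-trans (≤-reflexive (*-zeroʳ (r * q))) z≤n
      go (suc y) = begin
        r * q * (count {y} (λ x → gap (toℕ x) y) + maskSize gap y)
          ≡⟨ *-distribˡ-+ (r * q) (count {y} (λ x → gap (toℕ x) y)) _ ⟩
        r * q * count {y} (λ x → gap (toℕ x) y) + r * q * maskSize gap y
          ≤⟨ +-mono-≤ (*-monoʳ-≤ (r * q) (row-gaps y)) (go y) ⟩
        r * q * ((q ∸ p) * suc (y / r / q)) + ((q ∸ p) * pairs y + r * q * (q ∸ p) * y)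
          ≡⟨ expand (r * q) (q ∸ p) (y / r / q) (pairs y) y ⟩
        (q ∸ p) * (r * q * (y / r / q)) + ((q ∸ p) * pairs y + r * q * (q ∸ p) * suc y)
          ≤⟨ +-monoˡ-≤ _ (*-monoʳ-≤ (q ∸ p) (below y)) ⟩
        (q ∸ p) * y + ((q ∸ p) * pairs y + r * q * (q ∸ p) * suc y)
          ≡⟨ collect (q ∸ p) y (pairs y) (r * q * (q ∸ p) * suc y) ⟩
        (q ∸ p) * (y + pairs y) + r * q * (q ∸ p) * suc y ∎
        where
        expand : ∀ s d w c y → s * (d * suc w) + (d * c + s * d * y) ≡ d * (s * w) + (d * c + s * d * suc y)
        expand = solve-∀
        collect : ∀ d y c z → d * y + (d * c + z) ≡ d * (y + c) + z
        collect = solve-∀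

    module Maps {v′ : ℕ} (L : Graph (suc v′)) (hard : ¬ Colourable L r) (n : ℕ) where

      Map : Set
      Map = Σ (Fin (suc v′) → Fin n) λ φ → ∀ a c → adj L a c ≡ true → ¬ Gap (toℕ (φ a)) (toℕ (φ c))

      colour : Map → Fin (suc v′) → Fin r
      colour (φ , _) a = toℕ (φ a) mod r

      Mono : Fin (r ^ suc v′) → Set
      Mono κ = ∃[ a ] ∃[ c ] adj L a c ≡ true × finToFun {r} {suc v′} κ a ≡ finToFun κ c

      mono : ∀ κ → Mono κ
      mono κ with Fin.any? (λ a → Fin.any? λ c → (adj L a c Bool.≟ true) ×-dec (finToFun {r} {suc v′} κ a Fin.≟ finToFun κ c))
      ... | yes found = found
      ... | no ¬found = contradiction (finToFun κ , λ a c l e → ¬found (a , c , T⇒≡ l , e)) hard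

      bound : ℕ
      bound = r ^ suc v′ * (suc (n / r / q) ^ suc v′ * (q ^ v′ * p))

      SameMap : Map → Map → Set
      SameMap (φ , _) (ψ , _) = ∀ a → φ a ≡ ψ a

      -- The colours fix the monochromatic edge a c. The class of φ c need not be stored: it follows
      -- from the class of φ a and the sum along that edge, which has p possible values instead of
      -- q. This saves the factor p / q.
      with-colours : ∀ κ → Mono κ → Code {∃ λ o → funToFin (colour o) ≡ κ} (restrict SameMap _) (suc (n / r / q) ^ suc v′ * (q ^ v′ * p))
      with-colours κ (a , c , l , κa≡κc) = coarsen (λ {o} {o′} → glue {o} {o′})
        ((⨂ λ x → letter (level x)) ⊗ (⨂ λ x → letter λ o → U (at o (punchIn c x))) ⊗ letter (λ o → fromℕ< (small o)))
        where
        Obj : Set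
        Obj = ∃ λ o → funToFin (colour o) ≡ κ
        at : Obj → Fin (suc v′) → ℕ
        at ((φ , _) , _) x = toℕ (φ x)
        level : Fin (suc v′) → Obj → Fin (suc (n / r / q))
        level x ((φ , _) , _) = fromℕ< {m = toℕ (φ x) / r / q} (s≤s (/-monoˡ-≤ q (/-monoˡ-≤ r (<⇒≤ (Fin.toℕ<n (φ x))))))
        coloured : ∀ o x → at o x % r ≡ toℕ (finToFun {r} {suc v′} κ x)
        coloured ((φ , h) , refl) x = trans (sym (toℕ-mod (toℕ (φ x)) r)) (cong toℕ (sym (Fin.finToFun-funToFin (colour (φ , h)) x)))
        small : ∀ o → toℕ (residue (at o c) (at o a)) < p
        small o@((φ , h) , _) = ≰⇒> λ p≤ → h c a (trans (adj-sym L c a) l)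
          (trans (coloured o c) (trans (cong toℕ (sym κa≡κc)) (sym (coloured o a))) , p≤)
        glue : ∀ {o o′ : Obj} → (∀ x → level x o ≡ level x o′) ×
          (∀ x → U (at o (punchIn c x)) ≡ U (at o′ (punchIn c x))) × fromℕ< (small o) ≡ fromℕ< (small o′) → ∀ x → proj₁ (proj₁ o) x ≡ proj₁ (proj₁ o′) x
        glue {o} {o′} (w , u , e) x = Fin.toℕ-injective (coordinates
          (trans (coloured o x) (sym (coloured o′ x))) (classes x) (Fin.fromℕ<-injective _ _ _ _ (w x)))
          where
          classes′ : ∀ y → c ≢ y → U (at o y) ≡ U (at o′ y)
          classes′ y c≢y = subst (λ z → U (at o z) ≡ U (at o′ z)) (Fin.punchIn-punchOut c≢y) (u (punchOut c≢y))
          classes : ∀ y → U (at o y) ≡ U (at o′ y)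
          classes y with c Fin.≟ y
          ... | no c≢y = classes′ y c≢y
          ... | yes refl = residue-cancel (classes′ a λ { refl → adjacent⇒≢ L l refl })
            (Fin.toℕ-injective (Fin.fromℕ<-injective _ _ _ _ e))

      maps : Code SameMap bound
      maps = choose SameMap (λ o → funToFin (colour o)) λ κ → with-colours κ (mono κ)

  record Symmetries (L : Graph v) (a : ℕ) : Set where
    field
      σ        : Fin a → Fin v → Fin v
      onto     : ∀ s x → ∃[ y ] σ s y ≡ x
      preserve : ∀ s x y → adj L (σ s x) (σ s y) ≡ adj L x y
      distinct : ∀ s s′ → (∀ x → σ s x ≡ σ s′ x) → s ≡ s′

  T-ext : ∀ {x y} → (T x → T y) → (T y → T x) → x ≡ y
  T-ext {true}  {true}  f g = refl
  T-ext {false} {false} f g = refl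
  T-ext {true}  {false} f g = ⊥-elim (f _)
  T-ext {false} {true}  f g = ⊥-elim (g _)

  module Labelled (L : Graph v) {a : ℕ} (symmetries : Symmetries L a) {G : Graph n} {N : ℕ}
                  (H : Fin N → Subgraph G) (copy : ∀ i → IsCopy L (H i)) (apart : ∀ i j → i ≢ j → ¬ (H i ≈ₛ H j)) where

    open Symmetries symmetries

    φ : Fin N → Fin v → Fin n
    φ i = IsCopy.φ (copy i)

    labelling : Fin N → Fin a → Fin v → Fin n
    labelling i s x = φ i (σ s x)

    hom : ∀ i s → Homomorphism L G (labelling i s)
    hom i s x y l = T⇒≡ (edges⊆ (H i) _ _ (Equivalence.to (IsCopy.adj-iff (copy i) (σ s x) (σ s y))
      (≡⇒T (trans (preserve s x y) l))))

    module _ (i j : Fin N) (s s′ : Fin a) (same : ∀ x → labelling i s x ≡ labelling j s′ x) where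

      verts⊆ : ∀ {u} → u ∈ verts (H i) → u ∈ verts (H j)
      verts⊆ {u} u∈ with Equivalence.to (IsCopy.image (copy i) u) u∈
      ... | x , refl with onto s x
      ... | x′ , refl = Equivalence.from (IsCopy.image (copy j) _) (σ s′ x′ , sym (same x′))

      edges′⊆ : ∀ u w → Adj (edges (H i)) u w → Adj (edges (H j)) u w
      edges′⊆ u w e with Equivalence.to (IsCopy.image (copy i) u) (edges-in (H i) u w e)
                       | Equivalence.to (IsCopy.image (copy i) w) (edges-in (H i) w u (subst T (adj-sym (edges (H i)) u w) e))
      ... | x , refl | y , refl with onto s x | onto s y
      ... | x′ , refl | y′ , refl = subst T (sym (cong₂ (adj (edges (H j))) (same x′) (same y′)))
        (Equivalence.to (IsCopy.adj-iff (copy j) (σ s′ x′) (σ s′ y′))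
          (subst T (trans (preserve s x′ y′) (sym (preserve s′ x′ y′))) (Equivalence.from (IsCopy.adj-iff (copy i) (σ s x′) (σ s y′)) e)))

    -- Since symmetries are onto and preserve adjacency, equal labellings come from copies with
    -- equal vertices and edges. Within one copy, injectivity leaves only one symmetry.
    same⇒≡ : ∀ i j s s′ → (∀ x → labelling i s x ≡ labelling j s′ x) → i ≡ j × s ≡ s′
    same⇒≡ i j s s′ same with i Fin.≟ j
    ... | yes refl = refl , distinct s s′ λ x → IsCopy.injective (copy i) (same x)
    ... | no i≢j = contradiction
      (⊆-antisym (verts⊆ i j s s′ same) (verts⊆ j i s′ s (sym ∘ same)) ,
       λ u w → T-ext (edges′⊆ i j s s′ same u w) (edges′⊆ j i s′ s (sym ∘ same) u w))
      (apart i j i≢j)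

    labellings : ∀ {K} → Code {Σ (Fin v → Fin n) (Homomorphism L G)} (λ (φ , _) (ψ , _) → ∀ x → φ x ≡ ψ x) K → N * a ≤ K
    labellings c = Code⇒≤ (pullback (λ z → let i , s = remQuot {N} a z in labelling i s , hom i s)
      (λ {z} {z′} same → let p , q = same⇒≡ _ _ _ _ same in
        trans (sym (Fin.combine-remQuot {N} a z)) (trans (cong₂ combine p q) (Fin.combine-remQuot {N} a z′))) c)

  family-bound : ∀ {v′} (L : Graph (suc v′)) r q p {{_ : NonZero r}} {{_ : NonZero q}} → ¬ Colourable L r →
    ∀ {a} → Symmetries L a → ∀ n k → (∀ N → N * a ≤ r ^ suc v′ * (suc (n / r / q) ^ suc v′ * (q ^ v′ * p)) → ¬ (k ≤ᵣ fromℕ N)) →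
    ∀ M → HasFamily L n k M → M ≤ 2 ^ maskSize (Dense.gap r q p) n
  family-bound L r q p hard {a} symmetries n k few M (𝒢 , far) =
    Code⇒≤ (coarsen (λ {i} {j} → agree i j) (triangle gap (λ x y i → adjℕ (𝒢 i) x y) n))
    where
    open Dense r q p
    open Maps L hard n
    agree : ∀ i j → (∀ x y → x < y → y < n → gap x y ≡ true → adjℕ (𝒢 i) x y ≡ adjℕ (𝒢 j) x y) → i ≡ j
    agree i j eq with i Fin.≟ j
    ... | yes i≡j = i≡j
    ... | no i≢j = let _ , N , k≤N , H , copy , apart = far i j i≢j in
      contradiction k≤N (few N (Labelled.labellings L symmetries H copy apart (pullback
        (λ (φ , h) → φ , λ x y l → no-gap (φ x) (φ y) (h x y l)) id maps)))
      where
      ordered : ∀ x y → toℕ x < toℕ y → Gap (toℕ x) (toℕ y) → adj (𝒢 i) x y ≡ adj (𝒢 j) x y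
      ordered x y x<y g = trans (sym (adjℕ-toℕ (𝒢 i) x y))
        (trans (eq (toℕ x) (toℕ y) x<y (Fin.toℕ<n y) (dec-true (gap? _ _) g)) (adjℕ-toℕ (𝒢 j) x y))
      equal-on-gaps : ∀ x y → Gap (toℕ x) (toℕ y) → adj (𝒢 i) x y ≡ adj (𝒢 j) x y
      equal-on-gaps x y g with <-cmp (toℕ x) (toℕ y)
      ... | tri< x<y _ _ = ordered x y x<y g
      ... | tri> _ _ y<x = trans (adj-sym (𝒢 i) x y) (trans (ordered y x y<x (gap-sym g)) (adj-sym (𝒢 j) y x))
      ... | tri≈ _ e _ with refl ← Fin.toℕ-injective e = trans (adj-irrefl (𝒢 i) x) (sym (adj-irrefl (𝒢 j) x))
      no-gap : ∀ x y → adj (𝒢 i ⊕ 𝒢 j) x y ≡ true → ¬ Gap (toℕ x) (toℕ y)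
      no-gap x y e g with () ← trans (sym e) (trans (cong (_xor adj (𝒢 j) x y) (equal-on-gaps x y g)) (Bool.xor-same (adj (𝒢 j) x y)))

-- Edges and automorphisms of L

module Automorphism where

  open import Defs using (Graph; adj; adj-sym; adj-irrefl; Adj; Colourable; numEdges)
  open import Data.Bool using (true; T?)
  import Data.Bool.Properties as Bool
  open import Data.Fin as Fin using (Fin; zero; suc; toℕ; splitAt; join; punchOut)
  import Data.Fin.Properties as Fin
  open import Data.List using (List; filter; allFin; cartesianProduct)
  open import Data.List.Membership.Propositional using (_∈_)
  open import Data.List.Membership.Propositional.Properties using (∈-filter⁺; ∈-cartesianProduct⁺; ∈-allFin)
  open import Data.List.Membership.Setoid.Properties using (index-injective)
  open import Data.Nat
  open import Data.Nat.Properties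
  open import Data.Product using (∃-syntax; _×_; _,_; proj₁; proj₂)
  open import Data.Sum using (_⊎_; inj₁; inj₂; [_,_]′)
  open import Function using (_∘_; id)
  open import Relation.Binary.Definitions using (tri<; tri≈; tri>)
  open import Relation.Binary.PropositionalEquality using (_≡_; _≢_; refl; sym; trans; cong; cong₂; subst; setoid)
  open import Relation.Nullary using (¬_; Dec; yes; no; contradiction)
  open import Relation.Nullary.Decidable using (_×-dec_; _⊎-dec_; ¬?)

  open Counting
  open Multipartite using (adjacent⇒≢)
  open Copies using (T⇒≡; ≡⇒T)
  open Upper using (Symmetries; T-ext)

  private
    variable
      v : ℕ

  edges-≥ : (L : Graph v) {N : ℕ} (x y : Fin N → Fin v) → (∀ s → adj L (x s) (y s) ≡ true) →
            (∀ s t → x s ≡ x t → y s ≡ y t → s ≡ t) → (∀ s t → x s ≡ y t → y s ≡ x t → s ≡ t) → N ≤ numEdges L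
  edges-≥ {v} L {N} x y xy straight crossed = Fin.injective⇒≤ λ {s} {t} e →
    same s t (index-injective (setoid _) (listed s) (listed t) e)
    where
    ordered : Fin v → Fin v → Fin v × Fin v
    ordered a b with <-cmp (toℕ a) (toℕ b)
    ... | tri> _ _ _ = b , a
    ... | _          = a , b
    edges : List (Fin v × Fin v)
    edges = filter (λ (i , j) → (i Fin.<? j) ×-dec T? (adj L i j)) (cartesianProduct (allFin v) (allFin v))
    listed′ : ∀ a b → adj L a b ≡ true → ordered a b ∈ edges
    listed′ a b l with <-cmp (toℕ a) (toℕ b)
    ... | tri< a<b _ _ = ∈-filter⁺ _ (∈-cartesianProduct⁺ (∈-allFin a) (∈-allFin b)) (a<b , ≡⇒T l)
    ... | tri≈ _ e _   = contradiction (Fin.toℕ-injective e) (adjacent⇒≢ L l)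
    ... | tri> _ _ b<a = ∈-filter⁺ _ (∈-cartesianProduct⁺ (∈-allFin b) (∈-allFin a)) (b<a , ≡⇒T (trans (adj-sym L b a) l))
    listed : ∀ s → ordered (x s) (y s) ∈ edges
    listed s = listed′ (x s) (y s) (xy s)
    ordered⁻ : ∀ a b c d → ordered a b ≡ ordered c d → (a ≡ c × b ≡ d) ⊎ (a ≡ d × b ≡ c)
    ordered⁻ a b c d e with <-cmp (toℕ a) (toℕ b) | <-cmp (toℕ c) (toℕ d)
    ... | tri< _ _ _ | tri< _ _ _ = inj₁ (cong proj₁ e , cong proj₂ e)
    ... | tri< _ _ _ | tri≈ _ _ _ = inj₁ (cong proj₁ e , cong proj₂ e)
    ... | tri≈ _ _ _ | tri< _ _ _ = inj₁ (cong proj₁ e , cong proj₂ e)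
    ... | tri≈ _ _ _ | tri≈ _ _ _ = inj₁ (cong proj₁ e , cong proj₂ e)
    ... | tri< _ _ _ | tri> _ _ _ = inj₂ (cong proj₁ e , cong proj₂ e)
    ... | tri≈ _ _ _ | tri> _ _ _ = inj₂ (cong proj₁ e , cong proj₂ e)
    ... | tri> _ _ _ | tri< _ _ _ = inj₂ (cong proj₂ e , cong proj₁ e)
    ... | tri> _ _ _ | tri≈ _ _ _ = inj₂ (cong proj₂ e , cong proj₁ e)
    ... | tri> _ _ _ | tri> _ _ _ = inj₁ (cong proj₂ e , cong proj₁ e)
    same : ∀ s t → ordered (x s) (y s) ≡ ordered (x t) (y t) → s ≡ t
    same s t e with ordered⁻ (x s) (y s) (x t) (y t) e
    ... | inj₁ (p , q) = straight s t p q
    ... | inj₂ (p , q) = crossed s t p q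

  avoiding : (L : Graph v) {r : ℕ} (g : Fin v → Fin (suc r)) → (∀ a c → Adj L a c → g a ≢ g c) →
             ∀ i → (∀ a → i ≢ g a) → Colourable L r
  avoiding L g proper i avoid = (λ a → punchOut (avoid a)) ,
    λ a c l e → proper a c l (Fin.punchOut-injective (avoid a) (avoid c) e)

  -- Otherwise the two classes could be merged.
  edge-between : (L : Graph v) {r : ℕ} → ¬ Colourable L r → (colouring : Colourable L (suc r)) → let f = proj₁ colouring in
                 ∀ i j → i ≢ j → ∃[ x ] ∃[ y ] f x ≡ i × f y ≡ j × adj L x y ≡ true
  edge-between {v} L {r} hard (f , proper) i j i≢j with Fin.any? (λ x → Fin.any? λ y → (f x Fin.≟ i) ×-dec (f y Fin.≟ j) ×-dec (adj L x y Bool.≟ true))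
  ... | yes found = found
  ... | no ¬found = contradiction (avoiding L g proper′ i avoid) hard
    where
    g : Fin v → Fin (suc r)
    g x with f x Fin.≟ i
    ... | yes _ = j
    ... | no _  = f x
    avoid : ∀ x → i ≢ g x
    avoid x with f x Fin.≟ i
    ... | yes _ = i≢j
    ... | no ≢i = λ e → ≢i (sym e)
    proper′ : ∀ a c → Adj L a c → g a ≢ g c
    proper′ a c l e with f a Fin.≟ i | f c Fin.≟ i
    ... | yes p | yes q = proper a c l (trans p (sym q))
    ... | yes p | no _  = ¬found (a , c , p , sym e , T⇒≡ l)
    ... | no _  | yes q = ¬found (c , a , q , e , trans (adj-sym L c a) (T⇒≡ l))
    ... | no _  | no _  = proper a c l e

  trivial-symmetry : (L : Graph v) → Symmetries L 1
  trivial-symmetry L = record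
    { σ        = λ _ x → x
    ; onto     = λ _ x → x , refl
    ; preserve = λ _ _ _ → refl
    ; distinct = λ { zero zero _ → refl }
    }

  twins : (L : Graph v) → ∀ a b → a ≢ b → (∀ w → w ≢ a → w ≢ b → adj L a w ≡ adj L b w) → Symmetries L 2
  twins {v} L a b a≢b twin = record
    { σ        = σ
    ; onto     = λ { zero x → x , refl ; (suc zero) x → τ x , involutive x }
    ; preserve = λ { zero _ _ → refl ; (suc zero) x y → preserve x y }
    ; distinct = λ { zero zero _ → refl ; (suc zero) (suc zero) _ → refl
                   ; zero (suc zero) e → contradiction (e a) λ e → a≢b (trans e τa)
                   ; (suc zero) zero e → contradiction (e a) λ e → a≢b (trans (sym e) τa) }
    }
    where
    τ : Fin v → Fin v
    τ x with x Fin.≟ a | x Fin.≟ b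
    ... | yes _ | _     = b
    ... | no _  | yes _ = a
    ... | no _  | no _  = x
    σ : Fin 2 → Fin v → Fin v
    σ zero    = id
    σ (suc _) = τ
    τa : τ a ≡ b
    τa with a Fin.≟ a
    ... | yes _ = refl
    ... | no ≢a = contradiction refl ≢a
    τb : τ b ≡ a
    τb with b Fin.≟ a | b Fin.≟ b
    ... | yes e | _     = e
    ... | no _  | yes _ = refl
    ... | no _  | no ≢b = contradiction refl ≢b
    involutive : ∀ x → τ (τ x) ≡ x
    involutive x with x Fin.≟ a | x Fin.≟ b
    ... | yes refl | _        = τb
    ... | no _     | yes refl = τa
    ... | no p     | no q     with x Fin.≟ a | x Fin.≟ b
    ...   | yes e | _     = contradiction e p
    ...   | no _  | yes e = contradiction e q
    ...   | no _  | no _  = refl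
    preserve : ∀ x y → adj L (τ x) (τ y) ≡ adj L x y
    preserve x y with x Fin.≟ a | x Fin.≟ b | y Fin.≟ a | y Fin.≟ b
    ... | yes refl | _        | yes refl | _        = trans (adj-irrefl L b) (sym (adj-irrefl L a))
    ... | yes refl | _        | no _     | yes refl = adj-sym L b a
    ... | yes refl | _        | no p     | no q     = sym (twin y p q)
    ... | no _     | yes refl | yes refl | _        = adj-sym L a b
    ... | no _     | yes refl | no _     | yes refl = trans (adj-irrefl L a) (sym (adj-irrefl L b))
    ... | no _     | yes refl | no p     | no q     = twin y p q
    ... | no p     | no q     | yes refl | _        = trans (adj-sym L x b) (trans (sym (twin x p q)) (adj-sym L a x))
    ... | no p     | no q     | no _     | yes refl = trans (adj-sym L x a) (trans (twin x p q) (adj-sym L b x))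
    ... | no _     | no _     | no _     | no _     = refl

  -- 2 r is at most the number of pairs of r + 1 colours when r ≥ 3.
  colour-pairs : ∀ r → let R = 3 + r in Fin R ⊎ Fin R → Fin (suc R) × Fin (suc R)
  colour-pairs r (inj₁ j)       = zero , suc j
  colour-pairs r (inj₂ zero)    = suc (suc zero) , suc (suc (suc zero))
  colour-pairs r (inj₂ (suc j)) = suc zero , suc (suc j)

  colour-pairs-< : ∀ r s → toℕ (proj₁ (colour-pairs r s)) < toℕ (proj₂ (colour-pairs r s))
  colour-pairs-< r (inj₁ j)       = s≤s z≤n
  colour-pairs-< r (inj₂ zero)    = s≤s (s≤s (s≤s z≤n))
  colour-pairs-< r (inj₂ (suc j)) = s≤s (s≤s z≤n)

  colour-pairs-injective : ∀ r s t → colour-pairs r s ≡ colour-pairs r t → s ≡ t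
  colour-pairs-injective r (inj₁ i)       (inj₁ .i)       refl = refl
  colour-pairs-injective r (inj₁ _)       (inj₂ zero)    ()
  colour-pairs-injective r (inj₁ _)       (inj₂ (suc _)) ()
  colour-pairs-injective r (inj₂ zero)    (inj₁ _)       ()
  colour-pairs-injective r (inj₂ (suc _)) (inj₁ _)       ()
  colour-pairs-injective r (inj₂ zero)    (inj₂ zero)    refl = refl
  colour-pairs-injective r (inj₂ (suc i)) (inj₂ (suc .i)) refl = refl

  Is : Fin v → Fin v → Fin v × Fin v → Set
  Is u w (x , y) = (u ≡ x × w ≡ y) ⊎ (u ≡ y × w ≡ x)

  is? : ∀ (u w : Fin v) e → Dec (Is u w e)
  is? u w (x , y) = ((u Fin.≟ x) ×-dec (w Fin.≟ y)) ⊎-dec ((u Fin.≟ y) ×-dec (w Fin.≟ x))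

  module Between (L : Graph v) {r : ℕ} (hard : ¬ Colourable L r) (colouring : Colourable L (suc r))
                 {N : ℕ} (c d : Fin N → Fin (suc r)) (c<d : ∀ s → toℕ (c s) < toℕ (d s))
                 (injective : ∀ s t → c s ≡ c t → d s ≡ d t → s ≡ t) where

    f : Fin v → Fin (suc r)
    f = proj₁ colouring

    edge : ∀ s → ∃[ x ] ∃[ y ] f x ≡ c s × f y ≡ d s × adj L x y ≡ true
    edge s = edge-between L hard colouring (c s) (d s) (Fin.<⇒≢ (c<d s))

    x y : Fin N → Fin v
    x s = proj₁ (edge s)
    y s = proj₁ (proj₂ (edge s))

    fx : ∀ s → f (x s) ≡ c s
    fx s = proj₁ (proj₂ (proj₂ (edge s)))

    fy : ∀ s → f (y s) ≡ d s
    fy s = proj₁ (proj₂ (proj₂ (proj₂ (edge s))))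

    xy : ∀ s → adj L (x s) (y s) ≡ true
    xy s = proj₂ (proj₂ (proj₂ (proj₂ (edge s))))

    distinct : ∀ s t → Is (x s) (y s) (x t , y t) → s ≡ t
    distinct s t (inj₁ (p , q)) = injective s t
      (trans (sym (fx s)) (trans (cong f p) (fx t))) (trans (sym (fy s)) (trans (cong f q) (fy t)))
    distinct s t (inj₂ (p , q)) = contradiction
      (<-trans (c<d s) (subst (λ i → toℕ i < toℕ (d t)) (trans (sym (fx t)) (trans (cong f (sym q)) (fy s))) (c<d t)))
      (<-irrefl (cong toℕ (trans (sym (fx s)) (trans (cong f p) (fy t)))))

    at-least : N ≤ numEdges L
    at-least = edges-≥ L x y xy (λ s t p q → distinct s t (inj₁ (p , q))) (λ s t p q → distinct s t (inj₂ (p , q)))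

  -- For small r, this either supplies the edge missing to 2 r or shows that L is known up to
  -- isolated vertices.
  complete? : (L : Graph v) {N : ℕ} (x y : Fin N → Fin v) → (∀ s → adj L (x s) (y s) ≡ true) →
              (∀ s t → Is (x s) (y s) (x t , y t) → s ≡ t) →
              suc N ≤ numEdges L ⊎ (∀ u w → adj L u w ≡ true → ∃[ s ] Is u w (x s , y s))
  complete? {v} L {N} x y xy distinct with Fin.any? (λ u → Fin.any? λ w → (adj L u w Bool.≟ true) ×-dec ¬? (Fin.any? λ s → is? u w (x s , y s)))
  ... | no ¬other = inj₂ λ u w l → decide u w l (Fin.any? λ s → is? u w (x s , y s))
    where
    decide : ∀ u w → adj L u w ≡ true → Dec (∃[ s ] Is u w (x s , y s)) → ∃[ s ] Is u w (x s , y s)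
    decide u w l (yes h) = h
    decide u w l (no ¬h) = contradiction (u , w , l , ¬h) ¬other
  ... | yes (u , w , l , new) = inj₁ (edges-≥ L x⁺ y⁺ xy⁺ straight crossed)
    where
    x⁺ y⁺ : Fin (suc N) → Fin v
    x⁺ zero    = u
    x⁺ (suc s) = x s
    y⁺ zero    = w
    y⁺ (suc s) = y s
    xy⁺ : ∀ s → adj L (x⁺ s) (y⁺ s) ≡ true
    xy⁺ zero    = l
    xy⁺ (suc s) = xy s
    straight : ∀ s t → x⁺ s ≡ x⁺ t → y⁺ s ≡ y⁺ t → s ≡ t
    straight zero    zero    _ _ = refl
    straight zero    (suc t) p q = contradiction (t , inj₁ (p , q)) new
    straight (suc s) zero    p q = contradiction (s , inj₁ (sym p , sym q)) new
    straight (suc s) (suc t) p q = cong suc (distinct s t (inj₁ (p , q)))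
    crossed : ∀ s t → x⁺ s ≡ y⁺ t → y⁺ s ≡ x⁺ t → s ≡ t
    crossed zero    zero    _ _ = refl
    crossed zero    (suc t) p q = contradiction (t , inj₂ (p , q)) new
    crossed (suc s) zero    p q = contradiction (s , inj₂ (sym q , sym p)) new
    crossed (suc s) (suc t) p q = cong suc (distinct s t (inj₂ (p , q)))

  -- If the edges p p′ and s s′ leaving class i have different ends there, the
  -- third edge joins the classes j and k, and class i can be distributed to j, k.
  redistribute : (L : Graph v) → ((f , _) : Colourable L 3) → ∀ i j k → i ≢ j → i ≢ k → j ≢ k → ∀ {p p′ s s′ t t′} →
    f p ≡ i → f p′ ≡ j → f s ≡ i → f s′ ≡ k → f t ≡ j → f t′ ≡ k → p ≢ s →
    (∀ u w → adj L u w ≡ true → Is u w (p , p′) ⊎ Is u w (s , s′) ⊎ Is u w (t , t′)) → Colourable L 2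
  redistribute {v} L (f , _) i j k i≢j i≢k j≢k {p} {p′} {s} {s′} {t} {t′} fp fp′ fs fs′ ft ft′ p≢s all =
    avoiding L g proper i avoid
    where
    g : Fin v → Fin 3
    g x with f x Fin.≟ i | x Fin.≟ s
    ... | no _  | _     = f x
    ... | yes _ | yes _ = j
    ... | yes _ | no _  = k
    avoid : ∀ x → i ≢ g x
    avoid x with f x Fin.≟ i | x Fin.≟ s
    ... | no ≢i | _     = λ e → ≢i (sym e)
    ... | yes _ | yes _ = i≢j
    ... | yes _ | no _  = i≢k
    stay : ∀ {x c} → f x ≡ c → i ≢ c → g x ≡ c
    stay {x} fx i≢c with f x Fin.≟ i | x Fin.≟ s
    ... | no _  | _ = fx
    ... | yes e | _ = contradiction (trans (sym e) fx) i≢c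
    gs : g s ≡ j
    gs with f s Fin.≟ i | s Fin.≟ s
    ... | no ≢i | _      = contradiction fs ≢i
    ... | yes _ | yes _  = refl
    ... | yes _ | no ≢s  = contradiction refl ≢s
    gp : g p ≡ k
    gp with f p Fin.≟ i | p Fin.≟ s
    ... | no ≢i | _      = contradiction fp ≢i
    ... | yes _ | yes e  = contradiction e p≢s
    ... | yes _ | no _   = refl
    differ : ∀ {x y a b} → g x ≡ a → g y ≡ b → a ≢ b → ∀ {u w} → Is u w (x , y) → g u ≢ g w
    differ gx gy a≢b (inj₁ (refl , refl)) e = a≢b (trans (sym gx) (trans e gy))
    differ gx gy a≢b (inj₂ (refl , refl)) e = a≢b (trans (sym gx) (trans (sym e) gy))
    proper : ∀ u w → Adj L u w → g u ≢ g w
    proper u w l with all u w (T⇒≡ l)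
    ... | inj₁ h        = differ gp (stay fp′ i≢j) (λ e → j≢k (sym e)) h
    ... | inj₂ (inj₁ h) = differ gs (stay fs′ i≢k) j≢k h
    ... | inj₂ (inj₂ h) = differ (stay ft i≢j) (stay ft′ i≢k) j≢k h

  -- Each copy has at least a labellings, so density θ is allowed when θ < a c. The claimed rate
  -- asks for θ close to 2 r c / e, and 2 r ≤ a e makes the two compatible.
  Enough : Graph v → ℕ → Set
  Enough L r = 1 ≤ numEdges L × ∃[ a ] Symmetries L a × 2 * r ≤ a * numEdges L

  many⇒enough : (L : Graph v) {r : ℕ} → 1 ≤ r → 2 * r ≤ numEdges L → Enough L r
  many⇒enough L {r} 1≤r h = ≤-trans 1≤r (≤-trans (m≤m+n r _) h) ,
    1 , trivial-symmetry L , ≤-trans h (≤-reflexive (sym (*-identityˡ _)))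

  -- A graph with fewer than 2 r edges is an edge (r = 1) or a triangle (r = 2)
  -- up to isolated vertices, and so has two twins.
  enough-symmetries : (L : Graph v) → ∀ r′ → ¬ Colourable L (suc r′) → Colourable L (2 + r′) → Enough L (suc r′)
  enough-symmetries {v} L zero hard colouring = finish (complete? L x y xy distinct)
    where
    unique : (s t : Fin 1) → _≡_ {A = Fin 2} zero zero → _≡_ {A = Fin 2} (suc zero) (suc zero) → s ≡ t
    unique zero zero _ _ = refl
    open Between L hard colouring {1} (λ _ → zero) (λ _ → suc zero) (λ _ → s≤s z≤n) unique
    p q : Fin v
    p = x zero
    q = y zero
    finish : (2 ≤ numEdges L) ⊎ (∀ u w → adj L u w ≡ true → ∃[ s ] Is u w (x s , y s)) → Enough L 1
    finish (inj₁ two) = many⇒enough L {1} ≤-refl two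
    finish (inj₂ all) = at-least , 2 , twins L p q (adjacent⇒≢ L (xy zero)) twin , *-monoʳ-≤ 2 at-least
      where
      only : ∀ {u w} → w ≢ p → w ≢ q → ¬ Adj L u w
      only {u} {w} w≢p w≢q l with all u w (T⇒≡ l)
      ... | zero , inj₁ (_ , e) = w≢q e
      ... | zero , inj₂ (_ , e) = w≢p e
      twin : ∀ w → w ≢ p → w ≢ q → adj L p w ≡ adj L q w
      twin w w≢p w≢q = T-ext (λ l → contradiction l (only w≢p w≢q)) (λ l → contradiction l (only w≢p w≢q))
  enough-symmetries {v} L (suc zero) hard colouring = finish (complete? L x y xy distinct)
    where
    c d : Fin 3 → Fin 3
    c zero          = zero
    c (suc zero)    = zero
    c (suc (suc _)) = suc zero
    d zero    = suc zero
    d (suc _) = suc (suc zero)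
    c<d : ∀ s → toℕ (c s) < toℕ (d s)
    c<d zero             = s≤s z≤n
    c<d (suc zero)       = s≤s z≤n
    c<d (suc (suc zero)) = s≤s (s≤s z≤n)
    cd-injective : ∀ s t → c s ≡ c t → d s ≡ d t → s ≡ t
    cd-injective zero             zero             _ _ = refl
    cd-injective (suc zero)       (suc zero)       _ _ = refl
    cd-injective (suc (suc zero)) (suc (suc zero)) _ _ = refl
    cd-injective zero (suc zero) _ ()
    cd-injective zero (suc (suc zero)) () _
    cd-injective (suc zero) zero _ ()
    cd-injective (suc zero) (suc (suc zero)) () _
    cd-injective (suc (suc zero)) zero () _
    cd-injective (suc (suc zero)) (suc zero) () _
    open Between L hard colouring {3} c d c<d cd-injective
    i₀ i₁ i₂ : Fin 3
    i₀ = zero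
    i₁ = suc zero
    i₂ = suc (suc zero)
    finish : (4 ≤ numEdges L) ⊎ (∀ u w → adj L u w ≡ true → ∃[ s ] Is u w (x s , y s)) → Enough L 2
    finish (inj₁ four) = many⇒enough L {2} (s≤s z≤n) four
    finish (inj₂ all) = ≤-trans (s≤s z≤n) at-least , 2 , symmetries , ≤-trans (m≤m+n 4 2) (*-monoʳ-≤ 2 at-least)
      where
      all′ : ∀ u w → adj L u w ≡ true → Is u w (x i₀ , y i₀) ⊎ Is u w (x i₁ , y i₁) ⊎ Is u w (x i₂ , y i₂)
      all′ u w l with all u w l
      ... | zero , h             = inj₁ h
      ... | suc zero , h         = inj₂ (inj₁ h)
      ... | suc (suc zero) , h   = inj₂ (inj₂ h)
      flip : ∀ {u w a b} → Is {v} u w (a , b) → Is u w (b , a)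
      flip (inj₁ h) = inj₂ h
      flip (inj₂ h) = inj₁ h
      -- The three edges join the three pairs of classes, with two ends in each class. Two different
      -- ends would allow a 2-colouring by `redistribute`, so the edges close up to a triangle.
      x₀≡x₁ : x i₀ ≡ x i₁
      x₀≡x₁ with x i₀ Fin.≟ x i₁
      ... | yes e = e
      ... | no ¬e = contradiction (redistribute L colouring i₀ i₁ i₂ (λ ()) (λ ()) (λ ())
        (fx i₀) (fy i₀) (fx i₁) (fy i₁) (fx i₂) (fy i₂) ¬e all′) hard
      y₀≡x₂ : y i₀ ≡ x i₂
      y₀≡x₂ with y i₀ Fin.≟ x i₂
      ... | yes e = e
      ... | no ¬e = contradiction (redistribute L colouring i₁ i₀ i₂ (λ ()) (λ ()) (λ ())
        (fy i₀) (fx i₀) (fx i₂) (fy i₂) (fx i₁) (fy i₁) ¬e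
        λ u w l → [ inj₁ ∘ flip , [ inj₂ ∘ inj₂ , inj₂ ∘ inj₁ ]′ ]′ (all′ u w l)) hard
      y₁≡y₂ : y i₁ ≡ y i₂
      y₁≡y₂ with y i₁ Fin.≟ y i₂
      ... | yes e = e
      ... | no ¬e = contradiction (redistribute L colouring i₂ i₀ i₁ (λ ()) (λ ()) (λ ())
        (fy i₁) (fx i₁) (fy i₂) (fx i₂) (fx i₀) (fy i₀) ¬e
        λ u w l → [ inj₂ ∘ inj₂ , [ inj₁ ∘ flip , inj₂ ∘ inj₁ ∘ flip ]′ ]′ (all′ u w l)) hard
      third : ∀ u w → w ≢ x i₀ → w ≢ y i₀ → Adj L u w → w ≡ y i₁
      third u w w≢x w≢y l with all′ u w (T⇒≡ l)
      ... | inj₁ (inj₁ (_ , e))        = contradiction e w≢y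
      ... | inj₁ (inj₂ (_ , e))        = contradiction e w≢x
      ... | inj₂ (inj₁ (inj₁ (_ , e))) = e
      ... | inj₂ (inj₁ (inj₂ (_ , e))) = contradiction (trans e (sym x₀≡x₁)) w≢x
      ... | inj₂ (inj₂ (inj₁ (_ , e))) = trans e (sym y₁≡y₂)
      ... | inj₂ (inj₂ (inj₂ (_ , e))) = contradiction (trans e (sym y₀≡x₂)) w≢y
      apex : adj L (x i₀) (y i₁) ≡ true × adj L (y i₀) (y i₁) ≡ true
      apex = trans (cong (λ z → adj L z (y i₁)) x₀≡x₁) (xy i₁) , trans (cong₂ (adj L) y₀≡x₂ y₁≡y₂) (xy i₂)
      symmetries : Symmetries L 2
      symmetries = twins L (x i₀) (y i₀) (adjacent⇒≢ L (xy i₀)) λ w w≢x w≢y → T-ext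
        (λ l → subst (Adj L (y i₀)) (sym (third _ w w≢x w≢y l)) (≡⇒T (proj₂ apex)))
        (λ l → subst (Adj L (x i₀)) (sym (third _ w w≢x w≢y l)) (≡⇒T (proj₁ apex)))
  enough-symmetries L (suc (suc r)) hard colouring = many⇒enough L {3 + r} (s≤s z≤n)
    (≤-trans (≤-reflexive (cong ((3 + r) +_) (+-identityʳ (3 + r)))) at-least)
    where
    R : ℕ
    R = 3 + r
    open Between L hard colouring {R + R} (proj₁ ∘ colour-pairs r ∘ splitAt R) (proj₂ ∘ colour-pairs r ∘ splitAt R)
      (λ s → colour-pairs-< r (splitAt R s))
      (λ s t p q → trans (sym (Fin.join-splitAt R R s)) (trans
        (cong (join R R) (colour-pairs-injective r (splitAt R s) (splitAt R t) (cong₂ _,_ p q))) (Fin.join-splitAt R R t)))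

-- Fractions, cuts and logarithms

module Reals where

  open import Defs
  open import Data.Integer as ℤ using (+_; -[1+_])
  import Data.Integer.Properties as ℤ
  open import Data.Nat as ℕ using (ℕ; zero; suc; _∸_; s≤s; z≤n)
  import Data.Nat.Coprimality as Coprime
  import Data.Nat.Properties as ℕ
  open import Data.Nat.Tactic.RingSolver using (solve-∀)
  open import Data.Product using (∃-syntax; _,_)
  open import Data.Rational as ℚ using (ℚ; mkℚ; 0ℚ; toℚᵘ)
  import Data.Rational.Properties as ℚ
  open import Data.Rational.Unnormalised as ℚᵘ using (mkℚᵘ; *≡*; *<*; *≤*)
  import Data.Rational.Unnormalised.Properties as ℚᵘ
  open import Function.Bundles using (module Equivalence)
  open import Relation.Binary.PropositionalEquality using (_≡_; refl; sym; trans; cong; cong₂; subst; subst₂)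
  open import Relation.Nullary using (¬_; yes; no; contradiction)

  private
    variable
      a b c d : ℕ
      p q : ℚ

  -- p = a / (b + 1)
  Fraction : ℚ → ℕ → ℕ → Set
  Fraction p a b = toℚᵘ p ℚᵘ.≃ mkℚᵘ (+ a) b

  fraction-/ : ∀ a b → Fraction (+ a ℚ./ suc b) a b
  fraction-/ a b = ℚ.toℚᵘ-fromℚᵘ (mkℚᵘ (+ a) b)

  fraction-* : Fraction p a b → Fraction q c d → Fraction (p ℚ.* q) (a ℕ.* c) (d ℕ.+ b ℕ.* suc d)
  fraction-* {p} {a} {b} {q} {c} {d} x y = ℚᵘ.≃-trans (ℚ.toℚᵘ-homo-* p q) (ℚᵘ.≃-trans (ℚᵘ.*-cong x y)
    (ℚᵘ.≃-reflexive (cong (λ n → mkℚᵘ n (d ℕ.+ b ℕ.* suc d)) (sym (ℤ.pos-* a c)))))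

  fraction-- : Fraction p a b → Fraction q c d → c ℕ.* suc b ℕ.≤ a ℕ.* suc d →
               Fraction (p ℚ.- q) (a ℕ.* suc d ∸ c ℕ.* suc b) (d ℕ.+ b ℕ.* suc d)
  fraction-- {p} {a} {b} {q} {c} {d} x y c≤a = ℚᵘ.≃-trans (ℚ.toℚᵘ-homo-+ p (ℚ.- q)) (ℚᵘ.≃-trans
    (ℚᵘ.+-cong x (ℚᵘ.≃-trans (ℚ.toℚᵘ-homo‿- q) (ℚᵘ.-‿cong y)))
    (ℚᵘ.≃-reflexive (cong (λ n → mkℚᵘ n (d ℕ.+ b ℕ.* suc d)) numerator)))
    where
    numerator : + a ℤ.* + suc d ℤ.+ (ℤ.- + c) ℤ.* + suc b ≡ + (a ℕ.* suc d ∸ c ℕ.* suc b)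
    numerator = trans (cong₂ ℤ._+_ (sym (ℤ.pos-* a (suc d)))
        (trans (sym (ℤ.neg-distribˡ-* (+ c) (+ suc b))) (cong ℤ.-_ (sym (ℤ.pos-* c (suc b))))))
      (trans (ℤ.m-n≡m⊖n (a ℕ.* suc d) (c ℕ.* suc b)) (ℤ.⊖-≥ c≤a))

  fraction-< : Fraction p a b → Fraction q c d → a ℕ.* suc d ℕ.< c ℕ.* suc b → p ℚ.< q
  fraction-< {a = a} {b} {c = c} {d} x y h = ℚ.toℚᵘ-cancel-< (ℚᵘ.<-respˡ-≃ (ℚᵘ.≃-sym x) (ℚᵘ.<-respʳ-≃ (ℚᵘ.≃-sym y)
    (*<* (subst₂ ℤ._<_ (ℤ.pos-* a (suc d)) (ℤ.pos-* c (suc b)) (ℤ.+<+ h)))))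

  fraction-≤ : Fraction p a b → Fraction q c d → a ℕ.* suc d ℕ.≤ c ℕ.* suc b → p ℚ.≤ q
  fraction-≤ {a = a} {b} {c = c} {d} x y h = ℚ.toℚᵘ-cancel-≤ (ℚᵘ.≤-respˡ-≃ (ℚᵘ.≃-sym x) (ℚᵘ.≤-respʳ-≃ (ℚᵘ.≃-sym y)
    (*≤* (subst₂ ℤ._≤_ (ℤ.pos-* a (suc d)) (ℤ.pos-* c (suc b)) (ℤ.+≤+ h)))))

  fraction-<⁻ : Fraction p a b → Fraction q c d → p ℚ.< q → a ℕ.* suc d ℕ.< c ℕ.* suc b
  fraction-<⁻ {a = a} {b} {c = c} {d} x y p<q with ℚᵘ.<-respˡ-≃ x (ℚᵘ.<-respʳ-≃ y (ℚ.toℚᵘ-mono-< p<q))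
  ... | *<* h = ℤ.drop‿+<+ (subst₂ ℤ._<_ (sym (ℤ.pos-* a (suc d))) (sym (ℤ.pos-* c (suc b))) h)

  nonNegative : 0ℚ ℚ.≤ p → ∃[ a ] ∃[ b ] Fraction p a b
  nonNegative {mkℚ (+ a) b _}    _ = a , b , ℚᵘ.≃-refl
  nonNegative {mkℚ -[1+ _ ] _ _} (ℚ.*≤* ())

  lower-≤ : ∀ x → q ℚ.≤ p → lower x p → lower x q
  lower-≤ {q} {p} x q≤p l with q ℚ.<? p
  ... | yes q<p = Equivalence.from (lower-rounded x q) (p , q<p , l)
  ... | no q≮p  = subst (lower x) (ℚ.≤-antisym (ℚ.≮⇒≥ q≮p) q≤p) l

  fromℕ-<⁻ : ∀ {n k : ℕ} → lower (fromℕ n) p → Fraction p k b → k ℕ.< n ℕ.* suc b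
  fromℕ-<⁻ {n = n} {k} l x = subst (ℕ._< _) (ℕ.*-identityʳ k) (fraction-<⁻ x (fraction-/ n 0) l)

  rate-lower : ∀ {m u k C} → Fraction p a b → C ≡ suc k → 2 ℕ.^ u ℕ.≤ m → a ℕ.* C ℕ.< suc b ℕ.* u →
               lower (log₂ m / C) p
  rate-lower {m = zero} {u} _ refl h _ = contradiction h (ℕ.<⇒≱ (ℕ.m^n>0 2 u))
  rate-lower {p} {a} {b} {m@(suc _)} {u} {k} x refl 2^u≤m h =
    mkℚ (+ u) 0 (Coprime.sym (Coprime.1-coprimeTo u)) ,
    fraction-< (fraction-* x (fraction-/ (suc k) 0)) ℚᵘ.≃-refl (subst₂ ℕ._<_ (sym (ℕ.*-identityʳ _)) denominator h) ,
    subst (2 ℕ.^ u ℕ.≤_) (sym (trans (ℕ.*-identityʳ (m ℕ.^ 1)) (ℕ.*-identityʳ m))) 2^u≤m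
    where
    denominator : suc b ℕ.* u ≡ u ℕ.* suc (b ℕ.* 1)
    denominator = trans (ℕ.*-comm (suc b) u) (cong (λ b → u ℕ.* suc b) (sym (ℕ.*-identityʳ b)))

  rate-upper : ∀ {m u k C} → Fraction p a b → C ≡ suc k → m ℕ.≤ 2 ℕ.^ u → suc b ℕ.* u ℕ.< a ℕ.* C →
               upper (log₂ m / C) p
  rate-upper {p} {a} {b} {m} {u} {k} x refl m≤2^u h = at m m≤2^u
    where
    C = suc k
    product : Fraction (p ℚ.* (+ C ℚ./ 1)) (a ℕ.* C) (0 ℕ.+ b ℕ.* 1)
    product = fraction-* x (fraction-/ C 0)
    at : ∀ m → m ℕ.≤ 2 ℕ.^ u → upper (log₂ m / C) p
    -- The logarithm of 0 is 0 by convention; it lies below p because h forces a > 0.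
    at zero _ = fraction-< {p = 0ℚ} {a = 0} {b = 0} ℚᵘ.≃-refl product
      (subst (0 ℕ.<_) (sym (ℕ.*-identityʳ _)) (ℕ.≤-<-trans z≤n h))
    at m@(suc _) m≤ = mkℚ (+ u) 0 (Coprime.sym (Coprime.1-coprimeTo u)) ,
      fraction-< ℚᵘ.≃-refl product (subst₂ ℕ._<_ numerator (sym (ℕ.*-identityʳ _)) h) ,
      subst (ℕ._≤ 2 ℕ.^ u) (sym (trans (ℕ.*-identityʳ (m ℕ.^ 1)) (ℕ.*-identityʳ m))) m≤
      where
      numerator : suc b ℕ.* u ≡ u ℕ.* suc (b ℕ.* 1)
      numerator = trans (ℕ.*-comm (suc b) u) (cong (λ b → u ℕ.* suc b) (sym (ℕ.*-identityʳ b)))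

  scale-inverse : ∀ p w → (p ℚ.* (+ suc w ℚ./ 1)) ℚ.* (+ 1 ℚ./ suc w) ≡ p
  scale-inverse p w = trans (ℚ.*-assoc p _ _) (trans (cong (p ℚ.*_) one) (ℚ.*-identityʳ p))
    where
    one : (+ suc w ℚ./ 1) ℚ.* (+ 1 ℚ./ suc w) ≡ ℚ.1ℚ
    one = ℚ.toℚᵘ-injective (ℚᵘ.≃-trans (fraction-* (fraction-/ (suc w) 0) (fraction-/ 1 w))
      (*≡* (cong +_ (ring w))))
      where
      ring : ∀ w → suc w ℕ.* 1 ℕ.* 1 ≡ 1 ℕ.* suc (w ℕ.+ 0)
      ring = solve-∀

  multiple-lower : ∀ x w → lower x p → lower (suc w · x) (p ℚ.* (+ suc w ℚ./ 1))
  multiple-lower {p} x w l = subst (lower x) (sym (scale-inverse p w)) l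

  -- A multiple k = w · x of x exceeds every natural number below w p, for p < x.
  multiple-> : ∀ x {k : ℝ} {w N : ℕ} → 1 ℕ.≤ w → w · x ≤ k → Fraction p a b → lower x p → k ≤ fromℕ N →
               a ℕ.* w ℕ.< N ℕ.* suc b
  multiple-> {p} {a} {b} x {w = suc w} {N} _ wx≤k f l k≤N =
    subst (λ d → a ℕ.* suc w ℕ.< N ℕ.* suc d) (ℕ.*-identityʳ b)
      (fromℕ-<⁻ {n = N} (k≤N _ (wx≤k _ (multiple-lower x w l))) (fraction-* f (fraction-/ (suc w) 0)))

  -- With ε = 1/Z, k n is at most f n / Z, hence at most K.
  little-o⇒≤ : ∀ {k f} → k =o f → ∀ Z → 1 ℕ.≤ Z → Eventually λ n → ∀ K → f n ℕ.≤ Z ℕ.* K → k n ≤ fromℕ K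
  little-o⇒≤ {k} {f} small (suc z) _ =
    let n₀ , bound = small (+ 1 ℚ./ suc z) (fraction-< {p = 0ℚ} {a = 0} {b = 0} ℚᵘ.≃-refl (fraction-/ 1 z) (s≤s z≤n))
    in n₀ , λ n n₀≤n K h q l → ℚ.<-≤-trans (bound n n₀≤n q l)
      (fraction-≤ (fraction-* (fraction-/ 1 z) (fraction-/ (f n) 0)) (fraction-/ K 0) (begin
        1 ℕ.* f n ℕ.* 1           ≡⟨ trans (ℕ.*-identityʳ _) (ℕ.*-identityˡ (f n)) ⟩
        f n                       ≤⟨ h ⟩
        suc z ℕ.* K               ≡⟨ ℕ.*-comm (suc z) K ⟩
        K ℕ.* suc z               ≡⟨ cong (λ z → K ℕ.* suc z) (ℕ.*-identityʳ z) ⟨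
        K ℕ.* suc (z ℕ.* 1)       ∎))
    where open ℕ.≤-Reasoning

  positive⇒≰0 : ∀ {k : ℝ} {N} → N ≡ 0 → 0ℝ < k → ¬ (k ≤ fromℕ N)
  positive⇒≰0 refl (s , 0<s , l) k≤0 = ℚ.<-irrefl refl (ℚ.<-trans 0<s (k≤0 s l))

-- Passage to the limits

module Limits where

  open import Defs
  open import Data.Fin using (zero; suc)
  open import Data.Integer using (+_)
  open import Data.Nat as ℕ using (ℕ; zero; suc; _∸_; _^_; _+_; _*_; s≤s; z≤n; NonZero)
  open import Data.Nat.Combinatorics using (_C_)
  import Data.Nat.DivMod as DivMod
  import Data.Nat.Properties as ℕ
  open import Data.Nat.Tactic.RingSolver using (solve-∀)
  open import Data.Product using (∃-syntax; _×_; _,_; proj₁; proj₂)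
  open import Data.Rational as ℚ using (ℚ; 0ℚ)
  import Data.Rational.Properties as ℚ
  import Data.Rational.Unnormalised.Properties as ℚᵘ
  open import Data.Sum using (inj₁; inj₂)
  open import Function.Bundles using (module Equivalence)
  open import Relation.Binary.PropositionalEquality using (_≡_; refl; sym; trans; cong; subst)
  open import Relation.Nullary using (¬_; yes; no; contradiction)

  open Arithmetic
  open Copies using (pairs≡nC2)
  open Lower using (lower-bound; 2pairs+n≡n²)
  open Upper using (Symmetries; family-bound; maskSize; module Dense)
  open Automorphism using (Enough; enough-symmetries; trivial-symmetry)
  open Reals

  nC2-positive : ∀ n → 2 ℕ.≤ n → ∃[ k ] n C 2 ≡ suc k
  nC2-positive (suc zero)    (s≤s ())
  nC2-positive (suc (suc n)) _ = _ , sym (pairs≡nC2 (2 + n))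

  eventually-× : {P Q : ℕ → Set} → Eventually P → Eventually Q → Eventually λ n → P n × Q n
  eventually-× (m , p) (n , q) = m + n ,
    λ k h → p k (ℕ.≤-trans (ℕ.m≤m+n m n) h) , q k (ℕ.≤-trans (ℕ.m≤n+m n m) h)

  eventually-map : {P Q : ℕ → Set} → (∀ n → P n → Q n) → Eventually P → Eventually Q
  eventually-map f (m , p) = m , λ n h → f n (p n h)

  eventually-≥ : ∀ m → Eventually (m ℕ.≤_)
  eventually-≥ m = m , λ _ h → h

  labelledBound : (r q p v′ n : ℕ) {{_ : NonZero r}} {{_ : NonZero q}} → ℕ
  labelledBound r q p v′ n = r ^ suc v′ * (suc (n DivMod./ r DivMod./ q) ^ suc v′ * (q ^ v′ * p))

  open ℕ.≤-Reasoning

  -- Rounding n up to full blocks of length r q adds at most r q.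
  labelledBound-≤ : ∀ r q p v′ n {{_ : NonZero r}} {{_ : NonZero q}} →
    q * labelledBound r q p v′ n ℕ.≤ p * (n + r * q) ^ suc v′
  labelledBound-≤ r q p v′ n = begin
    q * labelledBound r q p v′ n               ≡⟨ regroup q (r ^ suc v′) (suc w ^ suc v′) (q ^ v′) p ⟩
    p * (r ^ suc v′ * (suc w ^ suc v′ * q ^ suc v′))
      ≡⟨ cong (p *_) (trans (cong (r ^ suc v′ *_) (sym (^-distribʳ-* (suc v′) (suc w) q))) (sym (^-distribʳ-* (suc v′) r (suc w * q)))) ⟩
    p * (r * (suc w * q)) ^ suc v′             ≤⟨ ℕ.*-monoʳ-≤ p (ℕ.^-monoˡ-≤ (suc v′) blocks) ⟩
    p * (n + r * q) ^ suc v′                   ∎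
    where
    w = n DivMod./ r DivMod./ q
    regroup : ∀ q x y z p → q * (x * (y * (z * p))) ≡ p * (x * (y * (q * z)))
    regroup = solve-∀
    blocks : r * (suc w * q) ℕ.≤ n + r * q
    blocks = begin
      r * (suc w * q)                 ≡⟨ expand r w q ⟩
      r * (w * q) + r * q             ≤⟨ ℕ.+-monoˡ-≤ (r * q) (ℕ.*-monoʳ-≤ r (DivMod.m/n*n≤m (n DivMod./ r) q)) ⟩
      r * (n DivMod./ r) + r * q      ≡⟨ cong (_+ r * q) (ℕ.*-comm r _) ⟩
      n DivMod./ r * r + r * q        ≤⟨ ℕ.+-monoˡ-≤ (r * q) (DivMod.m/n*n≤m n r) ⟩
      n + r * q                       ∎
      where
      expand : ∀ r w q → r * (suc w * q) ≡ r * (w * q) + r * q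
      expand = solve-∀

  upper-bound : ∀ {v′} (L : Graph (suc v′)) r q p {{_ : NonZero r}} {{_ : NonZero q}} → ¬ Colourable L r →
    ∀ {a} → Symmetries L a → (k : ℕ → ℝ) →
    Eventually (λ n → ∀ N → N * a ℕ.≤ labelledBound r q p v′ n → ¬ (k n ≤ fromℕ N)) →
    (M : ℕ → ℕ) → (∀ n → IsM L n (k n) (M n)) → ∀ A B → (q ∸ p) * B ℕ.< A * (r * q) →
    Eventually λ n → ∃[ u ] M n ℕ.≤ 2 ^ u × B * u ℕ.< A * (n C 2)
  upper-bound L r q p hard symmetries k few M isM A B slope = eventually-map bound
    (eventually-× few (eventually-≥ (2 + 2 * G)))
    where
    -- G n is the rounding error of the mask. For n ≥ 2 + 2 G it is below C(n,2) = n (n - 1)/2, the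
    -- amount left over by the strict inequality `slope`.
    D G : ℕ
    D = r * q
    G = B * D * (q ∸ p)
    bound : ∀ n → _ → ∃[ u ] M n ℕ.≤ 2 ^ u × B * u ℕ.< A * (n C 2)
    bound n (few-n , n-large) = u , family-bound L r q p hard symmetries n (k n) few-n (M n) (proj₁ (isM n)) ,
      ℕ.*-cancelˡ-< D _ _ (begin-strict
        D * (B * u)                                         ≡⟨ swap D B u ⟩
        B * (D * u)                                         ≤⟨ ℕ.*-monoʳ-≤ B (Dense.mask-bound r q p n) ⟩
        B * ((q ∸ p) * (n C 2) + D * (q ∸ p) * n)           ≡⟨ expand B (q ∸ p) (n C 2) D n ⟩
        (q ∸ p) * B * (n C 2) + G * n                       <⟨ ℕ.+-monoʳ-< ((q ∸ p) * B * (n C 2)) linear ⟩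
        (q ∸ p) * B * (n C 2) + n C 2                       ≡⟨ ℕ.+-comm _ (n C 2) ⟩
        suc ((q ∸ p) * B) * (n C 2)                         ≤⟨ ℕ.*-monoˡ-≤ (n C 2) slope ⟩
        A * D * (n C 2)                                     ≡⟨ swap′ A D (n C 2) ⟩
        D * (A * (n C 2))                                   ∎)
      where
      u : ℕ
      u = maskSize (Dense.gap r q p) n
      swap : ∀ D B u → D * (B * u) ≡ B * (D * u)
      swap = solve-∀
      swap′ : ∀ A D c → A * D * c ≡ D * (A * c)
      swap′ = solve-∀
      expand : ∀ B d c D n → B * (d * c + D * d * n) ≡ d * B * c + B * D * d * n
      expand = solve-∀
      linear : G * n ℕ.< n C 2
      linear = ℕ.*-cancelˡ-< 2 _ _ (ℕ.+-cancelʳ-< n _ _ (begin-strict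
        2 * (G * n) + n           ≡⟨ collect G n ⟩
        (1 + 2 * G) * n           <⟨ ℕ.*-monoˡ-< n {{ℕ.>-nonZero (ℕ.≤-trans (s≤s z≤n) n-large)}} n-large ⟩
        n * n                     ≡⟨ 2pairs+n≡n² n ⟨
        2 * (n C 2) + n           ∎))
        where
        collect : ∀ G n → 2 * (G * n) + n ≡ (1 + 2 * G) * n
        collect = solve-∀

  -- With T = 3^v Q, each further factor 1 + Q/n at most triples T, because Q ≤ T and Q ≤ n.
  binomial-≤ : ∀ v n Q → Q ℕ.≤ n → n * (n + Q) ^ v ℕ.≤ (n + 3 ^ v * Q) * n ^ v
  binomial-≤ zero    n Q Q≤n = ℕ.*-monoˡ-≤ 1 (ℕ.m≤m+n n (1 * Q))
  binomial-≤ (suc v) n Q Q≤n = begin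
    n * ((n + Q) * (n + Q) ^ v)                   ≡⟨ swap n (n + Q) _ ⟩
    (n + Q) * (n * (n + Q) ^ v)                   ≤⟨ ℕ.*-monoʳ-≤ (n + Q) (binomial-≤ v n Q Q≤n) ⟩
    (n + Q) * ((n + T) * n ^ v)                   ≡⟨ ℕ.*-assoc (n + Q) (n + T) _ ⟨
    (n + Q) * (n + T) * n ^ v                     ≤⟨ ℕ.*-monoˡ-≤ (n ^ v) quadratic ⟩
    (n + 3 ^ suc v * Q) * n * n ^ v               ≡⟨ ℕ.*-assoc (n + 3 ^ suc v * Q) n _ ⟩
    (n + 3 ^ suc v * Q) * n ^ suc v               ∎
    where
    T = 3 ^ v * Q
    swap : ∀ n x y → n * (x * y) ≡ x * (n * y)
    swap = solve-∀
    expand : ∀ n Q T → (n + Q) * (n + T) ≡ n * n + n * Q + T * n + T * Q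
    expand = solve-∀
    collect : ∀ n Q z → n * n + n * (z * Q) + z * Q * n + z * Q * n ≡ (n + (z + (z + (z + 0))) * Q) * n
    collect = solve-∀
    quadratic : (n + Q) * (n + T) ℕ.≤ (n + 3 ^ suc v * Q) * n
    quadratic = begin
      (n + Q) * (n + T)                         ≡⟨ expand n Q T ⟩
      n * n + n * Q + T * n + T * Q             ≤⟨ ℕ.+-mono-≤ (ℕ.+-monoˡ-≤ (T * n) (ℕ.+-monoʳ-≤ (n * n)
                                                     (ℕ.*-monoʳ-≤ n (ℕ.m≤n*m Q (3 ^ v) {{ℕ.m^n≢0 3 v}})))) (ℕ.*-monoʳ-≤ T Q≤n) ⟩
      n * n + n * T + T * n + T * n             ≡⟨ collect n Q (3 ^ v) ⟩
      (n + 3 ^ suc v * Q) * n                   ∎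

  -- With S/D > p e / 2 r q, more than (S/D) n^v copies with a labellings each
  -- exceed the bound (p/q) (n + r q)^v on labelled copies, since 2 r ≤ a e.
  copies-contradiction : ∀ S D N a n q r p e nv P H T → 1 ℕ.≤ r → 1 ℕ.≤ nv →
    S * nv ℕ.< N * D → N * a ℕ.≤ H → q * H ℕ.≤ p * P → p * e * D ℕ.< S * (2 * r * q) → 2 * r ℕ.≤ a * e →
    n * P ℕ.≤ (n + T) * nv → ¬ (e * D * p * T ℕ.< n)
  copies-contradiction S D N a n q r p e nv P H T 1≤r 1≤nv h₁ h₂ h₃ h₄ h₅ h₆ n-large =
    ℕ.<⇒≱ n-large (ℕ.*-cancelʳ-≤ n (X * T) nv {{ℕ.>-nonZero 1≤nv}} (ℕ.+-cancelˡ-≤ (X * n * nv) _ _ (begin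
      X * n * nv + n * nv         ≡⟨ collect X n nv ⟩
      suc X * nv * n              ≤⟨ ℕ.*-monoˡ-≤ n main ⟩
      X * P * n                   ≡⟨ trans (ℕ.*-assoc X P n) (cong (X *_) (ℕ.*-comm P n)) ⟩
      X * (n * P)                 ≤⟨ ℕ.*-monoʳ-≤ X h₆ ⟩
      X * ((n + T) * nv)          ≡⟨ split X n T nv ⟩
      X * n * nv + X * T * nv     ∎)))
    where
    X : ℕ
    X = e * D * p
    collect : ∀ X n nv → X * n * nv + n * nv ≡ suc X * nv * n
    collect = solve-∀
    split : ∀ X n T nv → X * ((n + T) * nv) ≡ X * n * nv + X * T * nv
    split = solve-∀
    a≢0 : NonZero a
    a≢0 = positive a (ℕ.≤-trans (ℕ.≤-trans 1≤r (ℕ.m≤m+n r _)) h₅)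
      where
      positive : ∀ a → 1 ℕ.≤ a * e → NonZero a
      positive (suc a) _ = _
    reorder : ∀ p e D → e * D * p ≡ p * e * D
    reorder = solve-∀
    -- Strictness of h₄ between natural numbers gives the X + 1 on the left; compared with P / nv ≤
    -- 1 + T/n, it forces n ≤ X T.
    main : suc X * nv ℕ.≤ X * P
    main = ℕ.*-cancelˡ-≤ a {{a≢0}} (begin
      a * (suc X * nv)                    ≡⟨ cong (λ X → a * (suc X * nv)) (reorder p e D) ⟩
      a * (suc (p * e * D) * nv)          ≤⟨ ℕ.*-monoʳ-≤ a (ℕ.*-monoˡ-≤ nv h₄) ⟩
      a * (S * (2 * r * q) * nv)          ≡⟨ step₁ a S r q nv ⟩
      2 * r * q * a * (S * nv)            ≤⟨ ℕ.*-monoʳ-≤ (2 * r * q * a) (ℕ.<⇒≤ h₁) ⟩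
      2 * r * q * a * (N * D)             ≡⟨ step₂ r q a N D ⟩
      2 * r * D * q * (N * a)             ≤⟨ ℕ.*-monoʳ-≤ (2 * r * D * q) h₂ ⟩
      2 * r * D * q * H                   ≡⟨ ℕ.*-assoc (2 * r * D) q H ⟩
      2 * r * D * (q * H)                 ≤⟨ ℕ.*-monoʳ-≤ (2 * r * D) h₃ ⟩
      2 * r * D * (p * P)                 ≡⟨ ℕ.*-assoc (2 * r) D (p * P) ⟩
      2 * r * (D * (p * P))               ≤⟨ ℕ.*-monoˡ-≤ (D * (p * P)) h₅ ⟩
      a * e * (D * (p * P))               ≡⟨ step₃ a e D p P ⟩
      a * (X * P)                         ∎)
      where
      step₁ : ∀ a S r q nv → a * (S * (2 * r * q) * nv) ≡ 2 * r * q * a * (S * nv)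
      step₁ = solve-∀
      step₂ : ∀ r q a N D → 2 * r * q * a * (N * D) ≡ 2 * r * D * q * (N * a)
      step₂ = solve-∀
      step₃ : ∀ a e D p P → a * e * (D * (p * P)) ≡ a * (e * D * p * P)
      step₃ = solve-∀

  many-copies-bound : ∀ {v′} (L : Graph (suc v′)) r q p {{_ : NonZero r}} {{_ : NonZero q}} → ¬ Colourable L r →
    ∀ {a} → Symmetries L a → (k : ℕ → ℝ) (c : ℝ) → (∀ n → (n ^ suc v′) · c ≤ k n) →
    ∀ e → 2 * r ℕ.≤ a * e → ∀ {s S d} D → lower c s → Fraction s S d → suc d ≡ D → p * e * D ℕ.< S * (2 * r * q) →
    (M : ℕ → ℕ) → (∀ n → IsM L n (k n) (M n)) → ∀ A B → (q ∸ p) * B ℕ.< A * (r * q) →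
    Eventually λ n → ∃[ u ] M n ℕ.≤ 2 ^ u × B * u ℕ.< A * (n C 2)
  many-copies-bound {v′} L r q p hard {a} symmetries k c k≥ e 2r≤ae {s} {S} {d} D l g D≡ h M isM A B =
    upper-bound L r q p hard symmetries k (eventually-map few (eventually-≥ (suc (e * D * p * T) + r * q))) M isM A B
    where
    v T : ℕ
    v = suc v′
    T = 3 ^ v * (r * q)
    few : ∀ n → suc (e * D * p * T) + r * q ℕ.≤ n → ∀ N → N * a ℕ.≤ labelledBound r q p v′ n → ¬ (k n ≤ fromℕ N)
    few n n-large N Na≤ k≤N = copies-contradiction S D N a n q r p e (n ^ v) ((n + r * q) ^ v) (labelledBound r q p v′ n) T
      (ℕ.>-nonZero⁻¹ r) 1≤n^v (subst (λ D → S * n ^ v ℕ.< N * D) D≡ (multiple-> c {k n} {n ^ v} {N} 1≤n^v (k≥ n) g l k≤N))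
      Na≤ (labelledBound-≤ r q p v′ n) h 2r≤ae
      (binomial-≤ v n (r * q) (ℕ.≤-trans (ℕ.m≤n+m (r * q) (suc (e * D * p * T))) n-large))
      (ℕ.≤-trans (ℕ.m≤m+n _ (r * q)) n-large)
      where
      1≤n^v : 1 ℕ.≤ n ^ v
      1≤n^v = ℕ.m^n>0 n {{ℕ.>-nonZero (ℕ.≤-trans (s≤s z≤n) n-large)}} v

  -- The density p / q with p = q - A₁ r makes (1 - p/q)/r at most A₁/q, also where p is truncated
  -- to 0.
  density-slope : ∀ r q A₁ A B {{_ : NonZero r}} → A₁ * B ℕ.< A * q → (q ∸ (q ∸ A₁ * r)) * B ℕ.< A * (r * q)
  density-slope r q A₁ A B h = begin-strict
    (q ∸ (q ∸ A₁ * r)) * B      ≤⟨ ℕ.*-monoˡ-≤ B (ℕ.m≤n+o⇒m∸n≤o q (q ∸ A₁ * r) (ℕ.≤-trans (ℕ.m≤n+m∸n q (A₁ * r)) (ℕ.≤-reflexive (ℕ.+-comm (A₁ * r) _)))) ⟩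
    A₁ * r * B                  ≡⟨ swap A₁ r B ⟩
    r * (A₁ * B)                <⟨ ℕ.*-monoʳ-< r h ⟩
    r * (A * q)                 ≡⟨ swap′ r A q ⟩
    A * (r * q)                 ∎
    where
    swap : ∀ A r b → A * r * b ≡ r * (A * b)
    swap = solve-∀
    swap′ : ∀ r A b → r * (A * b) ≡ A * (r * b)
    swap′ = solve-∀

  module _ {v′ : ℕ} (L : Graph (suc v′)) (edge : ∃[ a ] ∃[ b ] Adj L a b) (r′ : ℕ)
           (hard : ¬ Colourable L (suc r′)) (colouring : Colourable L (2 + r′))
           (k : ℕ → ℝ) (M : ℕ → ℕ) (isM : ∀ n → IsM L n (k n) (M n)) where

    private
      r v : ℕ
      r = suc r′
      v = suc v′

    -- Density 0 is the Turán graph itself; a positive k n already excludes it as a difference.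
    zero-copies : ∀ n N → N * 1 ℕ.≤ labelledBound r 1 0 v′ n → N ≡ 0
    zero-copies n N h = ℕ.n≤0⇒n≡0 (ℕ.≤-trans (ℕ.≤-trans (ℕ.≤-reflexive (sym (ℕ.*-identityʳ N))) h)
      (ℕ.≤-reflexive (vanish (r ^ v) (suc (n DivMod./ r DivMod./ 1) ^ v) (1 ^ v′))))
      where
      vanish : ∀ x y z → x * (y * (z * 0)) ≡ 0
      vanish = solve-∀

    few-copies-limit : (∀ n → 0ℝ < k n) → k =o (λ n → n ^ v) → rate M ⟶ fromℚ (+ 1 ℚ./ r)
    few-copies-limit positive small p q p<ρ ρ<q = eventually-× below above
      where
      below-nonNegative : ∀ {p a b} → Fraction p a b → p ℚ.< + 1 ℚ./ r → Eventually λ n → lower (rate M n) p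
      below-nonNegative {p} {a} {b} f p<ρ = eventually-map
        (λ n (2≤n , _ , 2^u≤M , h) → rate-lower f (proj₂ (nC2-positive n 2≤n)) 2^u≤M h)
        (eventually-× (eventually-≥ 2) (lower-bound L edge r′ colouring k (little-o⇒≤ {k} {λ n → n ^ v} small) M isM a (suc b)
          (subst (a * r ℕ.<_) (ℕ.*-identityˡ (suc b)) (fraction-<⁻ f (fraction-/ 1 r′) p<ρ))))
      0<ρ : 0ℚ ℚ.< + 1 ℚ./ r
      0<ρ = fraction-< {p = 0ℚ} {a = 0} {b = 0} ℚᵘ.≃-refl (fraction-/ 1 r′) (s≤s z≤n)
      below : Eventually λ n → lower (rate M n) p
      below with ℚ.≤-total 0ℚ p
      ... | inj₁ 0≤p = let _ , _ , f = nonNegative 0≤p in below-nonNegative f p<ρ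
      -- Since 0 < 1/r, the bound at 0 holds and implies that at p ≤ 0.
      ... | inj₂ p≤0 = eventually-map (λ n → lower-≤ (rate M n) p≤0) (below-nonNegative {0ℚ} {0} {0} ℚᵘ.≃-refl 0<ρ)
      above : Eventually λ n → upper (rate M n) q
      above = let a , b , f = nonNegative (ℚ.<⇒≤ (ℚ.<-trans 0<ρ ρ<q)) in eventually-map
        (λ n (2≤n , _ , M≤2^u , h) → rate-upper f (proj₂ (nC2-positive n 2≤n)) M≤2^u h)
        (eventually-× (eventually-≥ 2) (upper-bound L r 1 0 hard (trivial-symmetry L) k
          (0 , λ n _ N h → positive⇒≰0 {k n} (zero-copies n N h) (positive n)) M isM a (suc b)
          (subst (1 * suc b ℕ.<_) (cong (a *_) (sym (ℕ.*-identityʳ r))) (fraction-<⁻ (fraction-/ 1 r′) f ρ<q))))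

    -- If A/B is less than 1/r - 2c/e, then c exceeds some rational S/D above
    -- p e / 2 r B, where p = B - A r is truncated at 0.
    density : ∀ c e′ {q A b} → 0ℝ < c → Fraction q A b → upper ((+ 1 ℚ./ r) ⊖ (2 · c) / suc e′) q →
      ∃[ s ] ∃[ S ] ∃[ d ] lower c s × Fraction s S d × (suc b ∸ A * r) * suc e′ * suc d ℕ.< S * (2 * r * suc b)
    density c e′ {q} {A} {b} (s , 0<s , l) f u with ℕ.≤-total (A * r) (suc b)
    ... | inj₂ B≤Ar =
      let S , d , g = nonNegative (ℚ.<⇒≤ 0<s)
          1≤S = subst (0 ℕ.<_) (ℕ.*-identityʳ S) (fraction-<⁻ {p = 0ℚ} {a = 0} {b = 0} ℚᵘ.≃-refl g 0<s)
      in s , S , d , l , g ,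
         subst (λ p → p * suc e′ * suc d ℕ.< S * (2 * r * suc b)) (sym (ℕ.m≤n⇒m∸n≡0 B≤Ar)) (ℕ.*-mono-≤ 1≤S (s≤s z≤n))
    ... | inj₁ Ar≤B =
      -- Unfolding `⊖`, `/` and `·`, the hypothesis u says that c₁ = (1/r - A/B) e / 2 is in the
      -- lower cut of c. Roundedness moves it up to some s, which makes the inequality strict.
      let s , c₁<s , l = Equivalence.to (lower-rounded c _) u
          c₁ = fraction-* (fraction-* (fraction-- (fraction-/ 1 r′) f (subst (A * r ℕ.≤_) (sym (ℕ.*-identityˡ (suc b))) Ar≤B)) (fraction-/ (suc e′) 0)) (fraction-/ 1 1)
          0≤c₁ = fraction-≤ {p = 0ℚ} {a = 0} {b = 0} ℚᵘ.≃-refl c₁ z≤n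
          S , d , g = nonNegative (ℚ.≤-trans 0≤c₁ (ℚ.<⇒≤ c₁<s))
          h = fraction-<⁻ c₁ g c₁<s
      in s , S , d , l , g , subst₂′ (numerator (suc d)) (denominator S) h
      where
      subst₂′ : ∀ {x x′ y y′} → x ≡ x′ → y ≡ y′ → x ℕ.< y → x′ ℕ.< y′
      subst₂′ refl refl h = h
      numerator : ∀ D → (1 * suc b ∸ A * r) * suc e′ * 1 * D ≡ (suc b ∸ A * r) * suc e′ * D
      numerator D = cong (_* D) (trans (ℕ.*-identityʳ _) (cong (λ B → (B ∸ A * r) * suc e′) (ℕ.*-identityˡ (suc b))))
      denominator : ∀ S → S * (suc r′ * suc b * 1 * 2) ≡ S * (2 * r * suc b)
      denominator S = cong (S *_) (ring (suc r′) (suc b))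
        where
        ring : ∀ x y → x * y * 1 * 2 ≡ 2 * x * y
        ring = solve-∀

    many-copies-limsup : (c : ℝ) → 0ℝ < c → (∀ n → k n ≃ (n ^ v) · c) → ∀ e → e ≡ numEdges L →
      0ℝ ≤ (+ 1 ℚ./ r) ⊖ (2 · c) / e → limsup rate M ≤ ((+ 1 ℚ./ r) ⊖ (2 · c) / e)
    many-copies-limsup c 0<c k≃ e e≡ 0≤x = from e e≡ 0≤x (enough-symmetries L r′ hard colouring)
      where
      -- Division by e unfolds only for a successor, hence the case split; `Enough` excludes e = 0.
      from : ∀ e → e ≡ numEdges L → 0ℝ ≤ (+ 1 ℚ./ r) ⊖ (2 · c) / e → Enough L r →
             limsup rate M ≤ ((+ 1 ℚ./ r) ⊖ (2 · c) / e)
      from zero e≡ _ (1≤e , _) = contradiction (subst (1 ℕ.≤_) (sym e≡) 1≤e) (λ ())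
      from e@(suc e′) e≡ 0≤x (_ , a , symmetries , 2r≤ae) q u =
        -- The density is chosen for q₁, and the distance from q₁ to q absorbs the error terms. Both
        -- exceed x ≥ 0, so they are fractions with natural numerators.
        let q₁ , q₁<q , u₁ = Equivalence.to (upper-rounded x q) u
            A , b , f = nonNegative (ℚ.<⇒≤ (positive q u))
            A₁ , b₁ , f₁ = nonNegative (ℚ.<⇒≤ (positive q₁ u₁))
            s , S , d , l , g , h = density c e′ 0<c f₁ u₁
        in eventually-map
          (λ n (2≤n , _ , M≤2^u , h) → rate-upper f (proj₂ (nC2-positive n 2≤n)) M≤2^u h)
          (eventually-× (eventually-≥ 2) (many-copies-bound L r (suc b₁) (suc b₁ ∸ A₁ * r) hard symmetries k c (λ n → proj₂ (k≃ n))
            e (subst (λ e → 2 * r ℕ.≤ a * e) (sym e≡) 2r≤ae) (suc d) l g refl h M isM A (suc b)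
            (density-slope r (suc b₁) A₁ A (suc b) (fraction-<⁻ f₁ f q₁<q))))
        where
        x : ℝ
        x = (+ 1 ℚ./ r) ⊖ (2 · c) / e
        positive : ∀ q → upper x q → 0ℚ ℚ.< q
        positive q u with 0ℚ ℚ.<? q
        ... | yes 0<q = 0<q
        ... | no 0≮q = let q′ , q′<q , u′ = Equivalence.to (upper-rounded x q) u in
          contradiction (0≤x q′ (ℚ.<-≤-trans q′<q (ℚ.≮⇒≥ 0≮q)) , u′) (disjoint x q′)

open import Defs
open import Data.Fin using (Fin; zero; suc)
open import Data.Nat using (ℕ; zero; suc; _∸_; _^_)
import Data.Nat.Properties as ℕ
open import Data.Product using (_×_; _,_; ∃-syntax)
open import Relation.Binary.PropositionalEquality using (_≡_; refl)
open import Relation.Nullary using (¬_; contradiction)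

open Limits using (few-copies-limit; many-copies-limsup)

theorem1p3 : {v : ℕ} (L : Graph v) → (∃[ a ] ∃[ b ] Adj L a b) →
    (χ : ℕ) → IsChromaticNumber L χ →
    (k : ℕ → ℝ) (M : ℕ → ℕ) → (∀ n → IsM L n (k n) (M n)) →
    ((∀ n → 0ℝ < k n) → k =o (λ n → n ^ v) →
    rate M ⟶ fromℚ (recip (χ ∸ 1)))
    ×
    ((c : ℝ) → 0ℝ < c → (∀ n → k n ≃ (n ^ v) · c) →
    0ℝ ≤ recip (χ ∸ 1) ⊖ (2 · c) / numEdges L →
    limsup rate M ≤ (recip (χ ∸ 1) ⊖ (2 · c) / numEdges L))
theorem1p3 {zero}   L (() , _) _ _
theorem1p3 {suc _}  L (a , _) zero ((f , _) , _) with () ← f a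
theorem1p3 {suc _}  L (a , b , ab) (suc zero) ((f , proper) , _) = contradiction (only (f a) (f b)) (proper a b ab)
  where
  only : (i j : Fin 1) → i ≡ j
  only zero zero = refl
theorem1p3 {suc v′} L edge (suc (suc r′)) (colouring , least) k M isM =
  few-copies-limit L edge r′ hard colouring k M isM ,
  λ c 0<c k≃ → many-copies-limsup L edge r′ hard colouring k M isM c 0<c k≃ (numEdges L) refl
  where
  hard : ¬ Colourable L (suc r′)
  hard h = ℕ.<-irrefl refl (least (suc r′) h)
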